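{- Let $\Sigma$ be a finite alphabet. For any parameterized problem $\mathcal{Q} \subseteq \Sigma^* \times \mathbb{N}$, the following statements are equivalent: 1. Problem $\mathcal{Q}$ is strongly uniformly fixed-parameter tractable. 2. Problem $\mathcal{Q}$ is decidable and admits a kernel whose size is computable (i.e. a kernel of size $f$ for some computable function $f\colon \mathbb{N}\to\mathbb{N}$). 3. Problem $\mathcal{Q}$ is decidable and there is a polynomial-time quasi-order $\preceq$ on $\Sigma^* \times \mathbb{N}$ and a computable function $f \colon \mathbb{N} \to \mathbb{N}$ such that: (a) the set $\mathcal{Q}$ is a lower ideal of $\Sigma^* \times \mathbb{N}$ under $\preceq$; and (b) for every $(x,k) \notin \mathcal{Q}$ there is an obstruction $(x',k') \notin \mathcal{Q}$ of size at most $f(k)$ with $(x',k') \preceq (x,k)$.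
   Context: A parameterized problem is a subset $\mathcal{Q}\subseteq\Sigma^*\times\mathbb{N}$; the second component of an instance $(x,k)$ is the parameter. The size of an instance $(x,k)\in\Sigma^*\times\mathbb{N}$ is $|(x,k)| := |x|+k$. $\mathcal{Q}$ is (strongly uniformly) fixed-parameter tractable if there exists an algorithm deciding whether $(x,k)\in\mathcal{Q}$ in time $f(k)|x|^{O(1)}$, where $f$ is a computable function. A kernelization algorithm (kernel) of size $f\colon\mathbb{N}\to\mathbb{N}$ for $\mathcal{Q}$ is a polynomial-time algorithm (polynomial in the size $|x|+k$) that, on input $(x,k)\in\Sigma^*\times\mathbb{N}$, outputs an instance $(x',k')$ of size at most $f(k)$ such that $(x,k)\in\mathcal{Q}\Leftrightarrow(x',k')\in\mathcal{Q}$. A quasi-order is a reflexive and transitive binary relation $\preceq$ on a set. A quasi-order $\preceq$ is polynomial-time if there is an algorithm that decides whether $y\preceq z$ in $O((|y|+|z|)^{O(1)})$ time, where for an instance $y=(x,k)\in\Sigma^*\times\mathbb{N}$ the notation $|y|$ denotes its size $|(x,k)| = |x|+k$ (and likewise for $z$). If $S$ is a subset of a universe $U$ and $\preceq$ is a quasi-order on $U$, then $S$ is a lower ideal of $U$ under $\preceq$ if $y\in S$ and $y'\preceq y$ together imply $y'\in S$. -}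

module Defs where

open import Data.Bool.Base using (Bool; T)
open import Data.Fin.Base using (Fin)
open import Data.List.Base using (List; []; _∷_; length; map; replicate)
open import Data.Maybe.Base using (Maybe; just; nothing)
open import Data.Nat.Base using (ℕ; zero; suc; _+_; _*_; _^_; _≤_; _⊔_)
open import Data.Product.Base using (Σ-syntax; ∃-syntax; _×_; _,_; proj₂)
open import Data.Vec.Base as Vec using (Vec; []; _∷_)
open import Function.Bundles using (_⇔_)
open import Level using (0ℓ)
open import Relation.Binary.Core using (Rel)
open import Relation.Binary.Structures using (IsPreorder)
open import Relation.Binary.PropositionalEquality.Core using (_≡_)
open import Relation.Nullary.Negation.Core using (¬_)
open import Relation.Unary using (Pred)

-- Algorithms are deterministic multi-tape Turing machines, and running time is
-- the number of transitions made before halting.  The tape alphabet of a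
-- machine with input alphabet Fin s has, besides the input letters, a blank,
-- a tally mark (for natural numbers in unary) and e auxiliary symbols.

data Symbol (s e : ℕ) : Set where
  blank  : Symbol s e
  letter : Fin s → Symbol s e
  tally  : Symbol s e
  aux    : Fin e → Symbol s e

data Move : Set where
  left stay right : Move

-- The first io tapes carry the input at the start and, for machines computing
-- a function, the output at the end.  The machine halts when δ gives nothing;
-- accepting matters only for the state in which it halts.

record TM (s io : ℕ) : Set where
  field
    auxSymbols : ℕ
    workTapes  : ℕ
    states     : ℕ

  Γ : Set
  Γ = Symbol s auxSymbols

  tapeCount : ℕ
  tapeCount = io + workTapes

  field
    start     : Fin states
    accepting : Fin states → Bool
    δ         : Fin states → Vec Γ tapeCount →
                Maybe (Fin states × Vec (Γ × Move) tapeCount)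

-- A two-way infinite tape: the cell under the head, and the cells on either
-- side listed outwards from the head.  All cells not listed are blank.

record Tape (s e : ℕ) : Set where
  constructor tape
  field
    lefts  : List (Symbol s e)
    head   : Symbol s e
    rights : List (Symbol s e)

module _ {s e : ℕ} where

  write : Symbol s e → Tape s e → Tape s e
  write a (tape ls _ rs) = tape ls a rs

  move : Move → Tape s e → Tape s e
  move left  (tape []       h rs)       = tape [] blank (h ∷ rs)
  move left  (tape (l ∷ ls) h rs)       = tape ls l (h ∷ rs)
  move stay  t                          = t
  move right (tape ls       h [])       = tape (h ∷ ls) blank []
  move right (tape ls       h (r ∷ rs)) = tape (h ∷ ls) r rs

  act : Symbol s e × Move → Tape s e → Tape s e
  act (a , m) t = move m (write a t)

  blankTape : Tape s e
  blankTape = tape [] blank []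

  load : List (Symbol s e) → Tape s e
  load []      = blankTape
  load (a ∷ w) = tape [] a w

  untilBlank : List (Symbol s e) → List (Symbol s e)
  untilBlank []          = []
  untilBlank (blank ∷ _) = []
  untilBlank (a     ∷ w) = a ∷ untilBlank w

  -- The word starting at the head and ending before the first blank.
  contents : Tape s e → List (Symbol s e)
  contents (tape _ h rs) = untilBlank (h ∷ rs)

module _ {s io : ℕ} (M : TM s io) where
  open TM M

  record Config : Set where
    constructor config
    field
      state : Fin states
      tapes : Vec (Tape s auxSymbols) tapeCount

  open Config

  step : Config → Maybe Config
  step (config q ts) with δ q (Vec.map Tape.head ts)
  ... | nothing         = nothing
  ... | just (q′ , ams) = just (config q′ (Vec.zipWith act ams ts))

  -- Run c n d: started in c, the machine halts after exactly n steps, in d.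
  data Run : Config → ℕ → Config → Set where
    halt : ∀ {c} → step c ≡ nothing → Run c 0 c
    next : ∀ {c c′ d n} → step c ≡ just c′ → Run c′ n d → Run c (suc n) d

  initial : Vec (List Γ) io → Config
  initial ws = config start (Vec.map load ws Vec.++ Vec.replicate workTapes blankTape)

  output : Config → Vec (List Γ) io
  output c = Vec.map contents (Vec.take io (tapes c))

  ComputesWithin : ℕ → Vec (List Γ) io → Vec (List Γ) io → Set
  ComputesWithin t ws vs =
    ∃[ n ] ∃[ d ] n ≤ t × Run (initial ws) n d × output d ≡ vs

  DecidesWithin : ℕ → Vec (List Γ) io → Set → Set
  DecidesWithin t ws P =
    ∃[ n ] ∃[ d ] n ≤ t × Run (initial ws) n d × (T (accepting (state d)) ⇔ P)

Computable : (ℕ → ℕ) → Set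
Computable f =
  Σ[ M ∈ TM 0 1 ] (∀ k → ∃[ t ] ComputesWithin M t (unary k ∷ []) (unary (f k) ∷ []))
  where
  unary : ∀ {s e} → ℕ → List (Symbol s e)
  unary k = replicate k tally

Instance : ℕ → Set
Instance s = List (Fin s) × ℕ

ParameterizedProblem : ℕ → Set₁
ParameterizedProblem s = Pred (Instance s) 0ℓ

module _ {s : ℕ} where

  size : Instance s → ℕ
  size (x , k) = length x + k

  -- The parameter is written in unary, in accordance with its contribution
  -- to the size.
  encode : ∀ {e} → Instance s → Vec (List (Symbol s e)) 2
  encode (x , k) = map letter x ∷ replicate k tally ∷ []

  Decidable : ParameterizedProblem s → Set
  Decidable Q =
    Σ[ M ∈ TM s 2 ] (∀ y → ∃[ t ] DecidesWithin M t (encode y) (Q y))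

  -- The base 1 ⊔ |x| only differs from |x| for the empty word, where |x| ^ c
  -- would leave no time at all.
  FixedParameterTractable : ParameterizedProblem s → Set
  FixedParameterTractable Q =
    Σ[ M ∈ TM s 2 ] ∃[ f ] ∃[ c ] Computable f ×
      (∀ x k → DecidesWithin M (f k * (1 ⊔ length x) ^ c) (encode (x , k)) (Q (x , k)))

  -- Every polynomial in n is bounded by c * n ^ c + c for some c.
  polynomial : ℕ → ℕ → ℕ
  polynomial c n = c * n ^ c + c

  HasKernelOfSize : ParameterizedProblem s → (ℕ → ℕ) → Set
  HasKernelOfSize Q f =
    Σ[ M ∈ TM s 2 ] Σ[ κ ∈ (Instance s → Instance s) ] ∃[ c ]
      (∀ y → ComputesWithin M (polynomial c (size y)) (encode y) (encode (κ y))
           × size (κ y) ≤ f (proj₂ y)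
           × (Q y ⇔ Q (κ y)))

  QuasiOrder : Rel (Instance s) 0ℓ → Set
  QuasiOrder _≼_ = IsPreorder _≡_ _≼_

  PolynomialTime : Rel (Instance s) 0ℓ → Set
  PolynomialTime _≼_ =
    Σ[ M ∈ TM s 4 ] ∃[ c ]
      (∀ y z → DecidesWithin M (polynomial c (size y + size z))
                 (encode y Vec.++ encode z) (y ≼ z))

  LowerIdeal : Rel (Instance s) 0ℓ → ParameterizedProblem s → Set
  LowerIdeal _≼_ S = ∀ {y y′} → S y → y′ ≼ y → S y′

  ObstructionsOfSize : Rel (Instance s) 0ℓ → ParameterizedProblem s → (ℕ → ℕ) → Set
  ObstructionsOfSize _≼_ Q f =
    ∀ x k → ¬ Q (x , k) →
      ∃[ y ] ¬ Q y × size y ≤ f k × y ≼ (x , k)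

{-# OPTIONS --safe #-}

-- Machines are written in a language of finite-control programs on several
-- stacks, which are compiled to Turing machines (a stack is a tape), and which
-- can simulate Turing machines (a tape is two stacks and a scanned symbol).
--
-- From tractability to a kernel: run the decision procedure for (|x| + 1) ^ (c + 1)
-- steps.  If it halts, output a fixed instance with the same answer; otherwise
-- |x| ≤ f(k), and (x , k) itself is small.  This kernel κ is idempotent, so that
-- "y ≡ z or y ≡ κ z" is a quasi-order as required in the third statement.
--
-- Back to tractability, from a quasi-order or from the relation "y ≡ z or
-- y ≡ κ z" of an arbitrary kernel: (x , k) is rejected when some rejected y of
-- size at most f(k) is related to it.  Deciding all y of that size takes a time
-- depending on k only; it is bounded by a computable function because a machine
-- can do so while counting its own steps.

module Submission where

open import Axiom.ExcludedMiddle using (ExcludedMiddle)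
open import Data.Bool.Base using (Bool; true; false; if_then_else_; _∧_; _∨_; not) renaming (T to Holds)
open import Data.Empty using (⊥-elim)
open import Data.Fin.Base as Fin using (Fin; zero; suc)
import Data.Fin.Properties as Fin
open import Data.List.Base as List using (List; []; _∷_; _++_; length; replicate; foldl; foldr; reverse)
open import Data.List.Membership.Propositional using (_∈_)
open import Data.List.Properties using (∷-injectiveˡ; ∷-injectiveʳ; reverse-foldl; length-reverse; length-++; length-replicate; length-map; ++-identityʳ; map-injective; map-replicate)
open import Data.List.Relation.Unary.Any using (here; there)
open import Data.Maybe.Base as Maybe using (Maybe; just; nothing; maybe′; is-just)
open import Data.Nat.Base
open import Data.Nat.Properties
open import Data.Nat.Solver using (module +-*-Solver)
open import Data.Product.Base using (Σ-syntax; ∃-syntax; _×_; _,_; proj₁; proj₂; map₁; map₂)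
open import Data.Sum.Base as Sum using (_⊎_; inj₁; inj₂; [_,_]′)
open import Data.Unit.Base using (⊤; tt)
open import Data.Vec.Base as Vec using (Vec; []; _∷_)
import Data.Vec.Properties as Vec
open import Data.Vec.Relation.Binary.Pointwise.Inductive as Pointwise using (Pointwise; []; _∷_)
open import Function.Base using (_∘_; id)
open import Function.Bundles using (_⇔_; mk⇔; Equivalence)
open import Level using (0ℓ)
open import Relation.Binary.Core using (Rel)
open import Relation.Binary.PropositionalEquality
open import Relation.Nullary using (¬_; Dec; yes; no; does)
open import Relation.Nullary.Decidable using (map′)
open import Defs

-- The obstacle on the way back to tractability is uniformity. The decision procedure for Q is only
-- known to halt, so its time has to be measured by a machine that is given k alone, whereas the
-- time of the actual search also depends on x, through the tests of the relation. The search is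
-- therefore a program with a hole: filled with a trivial body it does not look at x, and its
-- measured time controls the number of rounds and all work outside the hole, which is the same for
-- every body. The tests of the relation only add a factor polynomial in n + |x| + k, where n is a
-- length fixed by k, and such a factor splits into a power of a number depending on k and a power
-- of |x|. In the other direction a clocked simulation is polynomial whatever f is; f reappears in
-- the size of the kernel, through a computable function that lies above it. A given kernel need not
-- be idempotent, so the second statement leads to the third by way of the first. Excluded middle
-- enters once, in the choice of an accepted and a rejected instance: it is not decidable whether
-- they exist.

record Finite (X : Set) : Set where
  field
    card   : ℕ
    index  : X → Fin card
    elem   : Fin card → X
    elem-index : ∀ x → elem (index x) ≡ x

open Finite

abstract

  finite-retract : {X Y : Set} (to : X → Y) (from : Y → X) → (∀ x → from (to x) ≡ x) → Finite Y → Finite X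
  finite-retract to from inv Y = record
    { card       = card Y
    ; index      = index Y ∘ to
    ; elem       = from ∘ elem Y
    ; elem-index = λ x → trans (cong from (elem-index Y (to x))) (inv x)
    }

  finite-Fin : ∀ n → Finite (Fin n)
  finite-Fin n = record { card = n ; index = id ; elem = id ; elem-index = λ _ → refl }

  finite-⊤ : Finite ⊤
  finite-⊤ = record { card = 1 ; index = λ _ → zero ; elem = λ _ → tt ; elem-index = λ _ → refl }

  finite-⊎ : {X Y : Set} → Finite X → Finite Y → Finite (X ⊎ Y)
  finite-⊎ X Y = record
    { card       = card X + card Y
    ; index      = Fin.join (card X) (card Y) ∘ Sum.map (index X) (index Y)
    ; elem       = Sum.map (elem X) (elem Y) ∘ Fin.splitAt (card X)
    ; elem-index = λ z → trans (cong (Sum.map (elem X) (elem Y)) (Fin.splitAt-join (card X) (card Y) (Sum.map (index X) (index Y) z)))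
                               (inv z)
    }
    where
    inv : ∀ z → Sum.map (elem X) (elem Y) (Sum.map (index X) (index Y) z) ≡ z
    inv (inj₁ x) = cong inj₁ (elem-index X x)
    inv (inj₂ y) = cong inj₂ (elem-index Y y)

  finite-× : {X Y : Set} → Finite X → Finite Y → Finite (X × Y)
  finite-× X Y = record
    { card       = card X * card Y
    ; index      = λ (x , y) → Fin.combine (index X x) (index Y y)
    ; elem       = λ i → elem X (proj₁ (Fin.remQuot (card Y) i)) , elem Y (proj₂ (Fin.remQuot {card X} (card Y) i))
    ; elem-index = λ (x , y) → cong₂ _,_
        (trans (cong (elem X ∘ proj₁) (Fin.remQuot-combine (index X x) (index Y y))) (elem-index X x))
        (trans (cong (elem Y ∘ proj₂) (Fin.remQuot-combine (index X x) (index Y y))) (elem-index Y y))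
    }

  finite-Maybe : {X : Set} → Finite X → Finite (Maybe X)
  finite-Maybe X = finite-retract (maybe′ inj₂ (inj₁ tt)) [ (λ _ → nothing) , just ]′
    (λ { nothing → refl ; (just _) → refl }) (finite-⊎ finite-⊤ X)

  finite-Bool : Finite Bool
  finite-Bool = finite-retract (λ b → if b then just tt else nothing) (maybe′ (λ _ → true) false)
    (λ { true → refl ; false → refl }) (finite-Maybe finite-⊤)

  finite-Symbol : ∀ s e → Finite (Symbol s e)
  finite-Symbol s e = finite-retract
    (λ { blank → nothing ; tally → just nothing ; (letter i) → just (just (inj₁ i)) ; (aux j) → just (just (inj₂ j)) })
    (λ { nothing → blank ; (just nothing) → tally ; (just (just (inj₁ i))) → letter i ; (just (just (inj₂ j))) → aux j })
    (λ { blank → refl ; tally → refl ; (letter _) → refl ; (aux _) → refl })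
    (finite-Maybe (finite-Maybe (finite-⊎ (finite-Fin s) (finite-Fin e))))

-- Stores of stacks and the operations on them

-- A store of stacks is ⟦ S ⟧ (List A); the shape S names its stacks.

infixr 4 _⊗_

data Shape : Set where
  ε • : Shape
  _⊗_ : Shape → Shape → Shape

⟦_⟧ : Shape → Set → Set
⟦ ε ⟧     X = ⊤
⟦ • ⟧     X = X
⟦ S ⊗ T ⟧ X = ⟦ S ⟧ X × ⟦ T ⟧ X

module _ {X : Set} where

  spure : ∀ S → X → ⟦ S ⟧ X
  spure ε       x = tt
  spure •       x = x
  spure (S ⊗ T) x = spure S x , spure T x

  smap : {Y : Set} → (X → Y) → ∀ S → ⟦ S ⟧ X → ⟦ S ⟧ Y
  smap f ε       _       = tt
  smap f •       x       = f x
  smap f (S ⊗ T) (x , y) = smap f S x , smap f T y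

  szip : {Y Z : Set} → (X → Y → Z) → ∀ S → ⟦ S ⟧ X → ⟦ S ⟧ Y → ⟦ S ⟧ Z
  szip f ε       _       _         = tt
  szip f •       x       y         = f x y
  szip f (S ⊗ T) (x , y) (x′ , y′) = szip f S x x′ , szip f T y y′

abstract

  finite-⟦⟧ : ∀ S {X : Set} → Finite X → Finite (⟦ S ⟧ X)
  finite-⟦⟧ ε       X = finite-⊤
  finite-⟦⟧ •       X = X
  finite-⟦⟧ (S ⊗ T) X = finite-× (finite-⟦⟧ S X) (finite-⟦⟧ T X)

data Op (A : Set) : Set where
  keep pop : Op A
  push     : A → Op A

abstract

  finite-Op : {A : Set} → Finite A → Finite (Op A)
  finite-Op A = finite-retract
    (λ { keep → nothing ; pop → just nothing ; (push a) → just (just a) })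
    (λ { nothing → keep ; (just nothing) → pop ; (just (just a)) → push a })
    (λ { keep → refl ; pop → refl ; (push _) → refl }) (finite-Maybe (finite-Maybe A))

module _ {A : Set} where

  apply : Op A → List A → List A
  apply keep     w = w
  apply pop      w = List.drop 1 w
  apply (push a) w = a ∷ w

  perform : ∀ S → ⟦ S ⟧ (Op A) → ⟦ S ⟧ (List A) → ⟦ S ⟧ (List A)
  perform = szip apply

  tops : ∀ S → ⟦ S ⟧ (List A) → ⟦ S ⟧ (Maybe A)
  tops = smap List.head

  perform-keep : ∀ S σ → perform S (spure S keep) σ ≡ σ
  perform-keep ε       _       = refl
  perform-keep •       _       = refl
  perform-keep (S ⊗ T) (σ , τ) = cong₂ _,_ (perform-keep S σ) (perform-keep T τ)

-- Addressing parts of a store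

infixr 6 _▸_
infixr 5 _&_

data Path : Shape → Shape → Set where
  here : ∀ {S} → Path S S
  lft  : ∀ {S S′ T} → Path S T → Path (S ⊗ S′) T
  rgt  : ∀ {S S′ T} → Path S′ T → Path (S ⊗ S′) T

_▸_ : ∀ {S T U} → Path S T → Path T U → Path S U
here ▸ q = q
lft p  ▸ q = lft (p ▸ q)
rgt p  ▸ q = rgt (p ▸ q)

-- Two paths of which one extends the other name overlapping parts of the store, hence the last
-- clause.
apart : ∀ {S T U} → Path S T → Path S U → Bool
apart (lft p) (lft q) = apart p q
apart (lft p) (rgt q) = true
apart (rgt p) (lft q) = true
apart (rgt p) (rgt q) = apart p q
apart _     _     = false

module _ {X : Set} where

  getP : ∀ {S T} → Path S T → ⟦ S ⟧ X → ⟦ T ⟧ X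
  getP here  σ       = σ
  getP (lft p) (σ , _) = getP p σ
  getP (rgt p) (_ , σ) = getP p σ

  putP : ∀ {S T} → Path S T → ⟦ T ⟧ X → ⟦ S ⟧ X → ⟦ S ⟧ X
  putP here  x _       = x
  putP (lft p) x (σ , τ) = putP p x σ , τ
  putP (rgt p) x (τ , σ) = τ , putP p x σ

  getP-putP : ∀ {S T} (p : Path S T) x σ → getP p (putP p x σ) ≡ x
  getP-putP here  x σ       = refl
  getP-putP (lft p) x (σ , _) = getP-putP p x σ
  getP-putP (rgt p) x (_ , σ) = getP-putP p x σ

  putP-putP : ∀ {S T} (p : Path S T) x y σ → putP p x (putP p y σ) ≡ putP p x σ
  putP-putP here  x y σ       = refl
  putP-putP (lft p) x y (σ , _) = cong (_, _) (putP-putP p x y σ)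
  putP-putP (rgt p) x y (_ , σ) = cong (_ ,_) (putP-putP p x y σ)

  getP-apart : ∀ {S T U} (p : Path S T) (q : Path S U) {_ : Holds (apart p q)} x σ →
               getP p (putP q x σ) ≡ getP p σ
  getP-apart (lft p) (lft q) {d} x (σ , _) = getP-apart p q {d} x σ
  getP-apart (lft p) (rgt q)     x σ       = refl
  getP-apart (rgt p) (lft q)     x σ       = refl
  getP-apart (rgt p) (rgt q) {d} x (_ , σ) = getP-apart p q {d} x σ

  putP-apart : ∀ {S T U} (p : Path S T) (q : Path S U) {_ : Holds (apart p q)} x y σ →
               putP p x (putP q y σ) ≡ putP q y (putP p x σ)
  putP-apart (lft p) (lft q) {d} x y (σ , _) = cong (_, _) (putP-apart p q {d} x y σ)
  putP-apart (lft p) (rgt q)     x y σ       = refl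
  putP-apart (rgt p) (lft q)     x y σ       = refl
  putP-apart (rgt p) (rgt q) {d} x y (_ , σ) = cong (_ ,_) (putP-apart p q {d} x y σ)

module _ {X Y : Set} where

  getP-map : ∀ {S T} (p : Path S T) (f : X → Y) σ → getP p (smap f S σ) ≡ smap f T (getP p σ)
  getP-map here  f σ       = refl
  getP-map (lft p) f (σ , _) = getP-map p f σ
  getP-map (rgt p) f (_ , σ) = getP-map p f σ

  putP-zip : ∀ {Z S T} (p : Path S T) (f : X → Y → Z) x κ σ →
             szip f S (putP p x κ) σ ≡ putP p (szip f T x (getP p σ)) (szip f S κ σ)
  putP-zip here  f x κ       σ       = refl
  putP-zip (lft p) f x (κ , _) (σ , _) = cong (_, _) (putP-zip p f x κ σ)
  putP-zip (rgt p) f x (_ , κ) (_ , σ) = cong (_ ,_) (putP-zip p f x κ σ)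

-- A selection is a tuple of pairwise disjoint paths; disjointness is decided
-- by evaluation.

data Sel (S : Shape) : Shape → Set
aparts : ∀ {S T U} → Path S T → Sel S U → Bool

data Sel S where
  ⟨_⟩ : ∀ {T} → Path S T → Sel S T
  _&_ : ∀ {T U} (p : Path S T) (m : Sel S U) {_ : Holds (aparts p m)} → Sel S (T ⊗ U)

aparts p ⟨ q ⟩   = apart p q
aparts p (q & m) = apart p q ∧ aparts p m

T-∧₁ : ∀ {a b} → Holds (a ∧ b) → Holds a
T-∧₁ {true} _ = tt

T-∧₂ : ∀ {a b} → Holds (a ∧ b) → Holds b
T-∧₂ {true} t = t

module _ {X : Set} where

  get : ∀ {S T} → Sel S T → ⟦ S ⟧ X → ⟦ T ⟧ X
  get ⟨ p ⟩   σ = getP p σ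
  get (p & m) σ = getP p σ , get m σ

  put : ∀ {S T} → Sel S T → ⟦ T ⟧ X → ⟦ S ⟧ X → ⟦ S ⟧ X
  put ⟨ p ⟩   x       σ = putP p x σ
  put (p & m) (x , y) σ = putP p x (put m y σ)

  putP-aparts : ∀ {S T U} (p : Path S T) (m : Sel S U) {_ : Holds (aparts p m)} x y σ →
                putP p x (put m y σ) ≡ put m y (putP p x σ)
  putP-aparts p ⟨ q ⟩   {d} x y       σ = putP-apart p q {d} x y σ
  putP-aparts p (q & m) {d} x (y , z) σ =
    trans (putP-apart p q {T-∧₁ d} x y (put m z σ)) (cong (putP q y) (putP-aparts p m {T-∧₂ {apart p q} d} x z σ))

  get-putP : ∀ {S T U} (p : Path S T) (m : Sel S U) {_ : Holds (aparts p m)} x σ →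
             get m (putP p x σ) ≡ get m σ
  get-putP p ⟨ q ⟩   {d} x σ = getP-apart q p {flip-apart p q d} x σ
    where
    flip-apart : ∀ {S T U} (p : Path S T) (q : Path S U) → Holds (apart p q) → Holds (apart q p)
    flip-apart (lft p) (lft q) d = flip-apart p q d
    flip-apart (lft p) (rgt q) d = tt
    flip-apart (rgt p) (lft q) d = tt
    flip-apart (rgt p) (rgt q) d = flip-apart p q d
  get-putP p (q & m) {d} x σ =
    cong₂ _,_ (get-putP p ⟨ q ⟩ {T-∧₁ d} x σ) (get-putP p m {T-∧₂ {apart p q} d} x σ)

  get-put : ∀ {S T} (m : Sel S T) x σ → get m (put m x σ) ≡ x
  get-put ⟨ p ⟩         x       σ = getP-putP p x σ
  get-put ((p & m) {d}) (x , y) σ =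
    cong₂ _,_ (getP-putP p x (put m y σ)) (trans (get-putP p m {d} x (put m y σ)) (get-put m y σ))

  put-put : ∀ {S T} (m : Sel S T) x y σ → put m x (put m y σ) ≡ put m x σ
  put-put ⟨ p ⟩         x       y        σ = putP-putP p x y σ
  put-put ((p & m) {d}) (x , z) (y , z′) σ = begin
    putP p x (put m z (putP p y (put m z′ σ))) ≡⟨ cong (putP p x) (putP-aparts p m {d} y z (put m z′ σ)) ⟨
    putP p x (putP p y (put m z (put m z′ σ))) ≡⟨ putP-putP p x y _ ⟩
    putP p x (put m z (put m z′ σ))            ≡⟨ cong (putP p x) (put-put m z z′ σ) ⟩
    putP p x (put m z σ)                       ∎
    where open ≡-Reasoning

module _ {X Y : Set} where

  get-map : ∀ {S T} (m : Sel S T) (f : X → Y) σ → get m (smap f S σ) ≡ smap f T (get m σ)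
  get-map ⟨ p ⟩   f σ = getP-map p f σ
  get-map (p & m) f σ = cong₂ _,_ (getP-map p f σ) (get-map m f σ)

  put-zip : ∀ {Z S T} (m : Sel S T) (f : X → Y → Z) x κ σ →
            szip f S (put m x κ) σ ≡ put m (szip f T x (get m σ)) (szip f S κ σ)
  put-zip ⟨ p ⟩   f x       κ σ = putP-zip p f x κ σ
  put-zip (p & m) f (x , y) κ σ = trans (putP-zip p f x (put m y κ) σ) (cong (putP p _) (put-zip m f y κ σ))

-- Stack machines

record Machine (A : Set) (S : Shape) : Set₁ where
  field
    State  : Set
    finite : Finite State
    start  : State
    δ      : State → ⟦ S ⟧ (Maybe A) → Maybe State × ⟦ S ⟧ (Op A)

open Machine

module _ {A : Set} where

  -- The exiting step still acts on the stacks, so every run takes at least one step. In exchange, a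
  -- machine can be followed by another one without any step in between.
  data Exec {S} (M : Machine A S) : State M → ⟦ S ⟧ (List A) → ℕ → ⟦ S ⟧ (List A) → Set where
    exit : ∀ {q σ σ′ o} → δ M q (tops S σ) ≡ (nothing , o) → perform S o σ ≡ σ′ →
           Exec M q σ 1 σ′
    cont : ∀ {q q′ σ σ₁ σ′ o t} → δ M q (tops S σ) ≡ (just q′ , o) → perform S o σ ≡ σ₁ →
           Exec M q′ σ₁ t σ′ → Exec M q σ (suc t) σ′

  Runs : ∀ {S} → Machine A S → ⟦ S ⟧ (List A) → ℕ → ⟦ S ⟧ (List A) → Set
  Runs M = Exec M (start M)

  Exec-map : ∀ {S} {M N : Machine A S} (f : State M → State N) →
             (∀ q h → δ N (f q) h ≡ map₁ (Maybe.map f) (δ M q h)) →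
             ∀ {q σ t σ′} → Exec M q σ t σ′ → Exec N (f q) σ t σ′
  Exec-map f hom (exit e p)     = exit (trans (hom _ _) (cong (map₁ (Maybe.map f)) e)) p
  Exec-map f hom (cont e p run) = cont (trans (hom _ _) (cong (map₁ (Maybe.map f)) e)) p (Exec-map f hom run)

  -- Leaving `M` is turned into a step to `q″`, so the two times add up exactly. This covers both
  -- sequencing and the return of a loop body to the test of its loop.
  Exec-then : ∀ {S} {M N : Machine A S} (f : State M → State N) (q″ : State N) →
              (∀ q h → δ N (f q) h ≡ map₁ (just ∘ maybe′ f q″) (δ M q h)) →
              ∀ {q σ t σ₁ t′ σ′} → Exec M q σ t σ₁ → Exec N q″ σ₁ t′ σ′ → Exec N (f q) σ (t + t′) σ′
  Exec-then f q″ hom (exit e p)     run′ = cont (trans (hom _ _) (cong (map₁ (just ∘ maybe′ f q″)) e)) p run′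
  Exec-then f q″ hom (cont e p run) run′ = cont (trans (hom _ _) (cong (map₁ (just ∘ maybe′ f q″)) e)) p (Exec-then f q″ hom run run′)

  lift : ∀ {S T} → Sel S T → Machine A T → Machine A S
  lift {S} m M = record
    { State = State M ; finite = finite M ; start = start M
    ; δ = λ q h → map₂ (λ o → put m o (spure S keep)) (δ M q (get m h)) }

  perform-lift : ∀ {S T} (m : Sel S T) (o : ⟦ T ⟧ (Op A)) τ σ →
                 perform S (put m o (spure S keep)) (put m τ σ) ≡ put m (perform T o τ) σ
  perform-lift {S} {T} m o τ σ = begin
    perform S (put m o (spure S keep)) (put m τ σ)
      ≡⟨ put-zip m apply o (spure S keep) (put m τ σ) ⟩
    put m (perform T o (get m (put m τ σ))) (perform S (spure S keep) (put m τ σ))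
      ≡⟨ cong₂ (λ τ′ → put m (perform T o τ′)) (get-put m τ σ) (perform-keep S _) ⟩
    put m (perform T o τ) (put m τ σ)
      ≡⟨ put-put m _ τ σ ⟩
    put m (perform T o τ) σ ∎
    where open ≡-Reasoning

  -- A frame rule: stacks outside the selection only undergo `keep` and are never inspected, so a
  -- run on the selected stacks goes through in any surrounding store.
  Exec-lift : ∀ {S T} (m : Sel S T) (M : Machine A T) {q τ t τ′} σ →
              Exec M q τ t τ′ → Exec (lift m M) q (put m τ σ) t (put m τ′ σ)
  Exec-lift {S} {T} m M {q} {τ} σ run = go run
    where
    widen : Maybe (State M) × ⟦ T ⟧ (Op A) → Maybe (State M) × ⟦ S ⟧ (Op A)
    widen = map₂ (λ o → put m o (spure S keep))
    sees : ∀ q τ → δ (lift m M) q (tops S (put m τ σ)) ≡ widen (δ M q (tops T τ))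
    sees q τ = cong (λ h → widen (δ M q h)) (trans (get-map m List.head (put m τ σ)) (cong (tops T) (get-put m τ σ)))
    go : ∀ {q τ t τ′} → Exec M q τ t τ′ → Exec (lift m M) q (put m τ σ) t (put m τ′ σ)
    go {q} {τ} (exit {o = o} e refl)       = exit (trans (sees q τ) (cong widen e)) (perform-lift m o τ σ)
    go {q} {τ} (cont {o = o} e refl run) = cont (trans (sees q τ) (cong widen e)) (perform-lift m o τ σ) (go run)

  stateless : ∀ {S} → (⟦ S ⟧ (Maybe A) → Maybe ⊤ × ⟦ S ⟧ (Op A)) → Machine A S
  stateless f = record { State = ⊤ ; finite = finite-⊤ ; start = tt ; δ = λ _ → f }

  skip : ∀ {S} → Machine A S
  skip {S} = stateless (λ _ → nothing , spure S keep)

  infixr 4 _⨾_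

  _⨾_ : ∀ {S} → Machine A S → Machine A S → Machine A S
  M ⨾ N = record
    { State  = State M ⊎ State N
    ; finite = finite-⊎ (finite M) (finite N)
    ; start  = inj₁ (start M)
    ; δ      = λ { (inj₁ q) h → map₁ (just ∘ maybe′ inj₁ (inj₂ (start N))) (δ M q h)
                 ; (inj₂ q) h → map₁ (Maybe.map inj₂) (δ N q h) } }

  infixr 4 _then_

  _then_ : ∀ {S} {M N : Machine A S} {σ t σ₁ t′ σ′} → Runs M σ t σ₁ → Runs N σ₁ t′ σ′ → Runs (M ⨾ N) σ (t + t′) σ′
  run then run′ = Exec-then inj₁ _ (λ _ _ → refl) run (Exec-map inj₂ (λ _ _ → refl) run′)

  ifte : ∀ {S} → (⟦ S ⟧ (Maybe A) → Bool) → Machine A S → Machine A S → Machine A S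
  ifte {S} b M N = record
    { State  = Maybe (State M ⊎ State N)
    ; finite = finite-Maybe (finite-⊎ (finite M) (finite N))
    ; start  = nothing
    ; δ      = λ { nothing         h → just (just (if b h then inj₁ (start M) else inj₂ (start N))) , spure S keep
                 ; (just (inj₁ q)) h → map₁ (Maybe.map (just ∘ inj₁)) (δ M q h)
                 ; (just (inj₂ q)) h → map₁ (Maybe.map (just ∘ inj₂)) (δ N q h) } }

  module _ {S : Shape} {b : ⟦ S ⟧ (Maybe A) → Bool} {M N : Machine A S} {σ σ′ : ⟦ S ⟧ (List A)} {t : ℕ} where

    ifte-true : b (tops S σ) ≡ true → Runs M σ t σ′ → Runs (ifte b M N) σ (suc t) σ′
    ifte-true e run = cont (cong (λ c → just (just (if c then inj₁ (start M) else inj₂ (start N))) , spure S keep) e)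
      (perform-keep S σ) (Exec-map (just ∘ inj₁) (λ _ _ → refl) run)

    ifte-false : b (tops S σ) ≡ false → Runs N σ t σ′ → Runs (ifte b M N) σ (suc t) σ′
    ifte-false e run = cont (cong (λ c → just (just (if c then inj₁ (start M) else inj₂ (start N))) , spure S keep) e)
      (perform-keep S σ) (Exec-map (just ∘ inj₂) (λ _ _ → refl) run)

  while : ∀ {S} → (⟦ S ⟧ (Maybe A) → Bool) → Machine A S → Machine A S
  while {S} b M = record
    { State  = Maybe (State M)
    ; finite = finite-Maybe (finite M)
    ; start  = nothing
    ; δ      = λ { nothing  h → (if b h then just (just (start M)) else nothing) , spure S keep
                 ; (just q) h → map₁ just (δ M q h) } }

  module _ {S : Shape} {b : ⟦ S ⟧ (Maybe A) → Bool} {M : Machine A S} {σ : ⟦ S ⟧ (List A)} where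

    while-done : b (tops S σ) ≡ false → Runs (while b M) σ 1 σ
    while-done e = exit (cong (λ c → (if c then just (just (start M)) else nothing) , spure S keep) e) (perform-keep S σ)

    while-step : ∀ {t σ₁ t′ σ′} → b (tops S σ) ≡ true → Runs M σ t σ₁ → Runs (while b M) σ₁ t′ σ′ →
                 Runs (while b M) σ (suc (t + t′)) σ′
    while-step e run run′ = cont (cong (λ c → (if c then just (just (start M)) else nothing) , spure S keep) e)
      (perform-keep S σ) (Exec-then just nothing while-hom run run′)
      where
      while-hom : ∀ q h → δ (while b M) (just q) h ≡ map₁ (just ∘ maybe′ just nothing) (δ M q h)
      while-hom q h with δ M q h
      ... | just _  , _ = refl
      ... | nothing , _ = refl

-- Compiling stack machines to Turing machines

arity : Shape → ℕ
arity ε       = 0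
arity •       = 1
arity (S ⊗ T) = arity S + arity T

module _ {X : Set} where

  toVec : ∀ S → ⟦ S ⟧ X → Vec X (arity S)
  toVec ε       _       = []
  toVec •       x       = x ∷ []
  toVec (S ⊗ T) (x , y) = toVec S x Vec.++ toVec T y

  fromVec : ∀ S → Vec X (arity S) → ⟦ S ⟧ X
  fromVec ε       _        = tt
  fromVec •       (x ∷ []) = x
  fromVec (S ⊗ T) xs       = fromVec S (Vec.take (arity S) xs) , fromVec T (Vec.drop (arity S) xs)

  take-++ : ∀ {m n} (xs : Vec X m) (ys : Vec X n) → Vec.take m (xs Vec.++ ys) ≡ xs
  take-++ []       ys = refl
  take-++ (x ∷ xs) ys = cong (x ∷_) (take-++ xs ys)

  drop-++ : ∀ {m n} (xs : Vec X m) (ys : Vec X n) → Vec.drop m (xs Vec.++ ys) ≡ ys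
  drop-++ []       ys = refl
  drop-++ (x ∷ xs) ys = drop-++ xs ys

  fromVec-toVec : ∀ S x → fromVec S (toVec S x) ≡ x
  fromVec-toVec ε       _       = refl
  fromVec-toVec •       _       = refl
  fromVec-toVec (S ⊗ T) (x , y) = cong₂ _,_
    (trans (cong (fromVec S) (take-++ (toVec S x) (toVec T y))) (fromVec-toVec S x))
    (trans (cong (fromVec T) (drop-++ (toVec S x) (toVec T y))) (fromVec-toVec T y))

  toVec-spure : ∀ S x → toVec S (spure S x) ≡ Vec.replicate (arity S) x
  toVec-spure ε       x = refl
  toVec-spure •       x = refl
  toVec-spure (S ⊗ T) x = trans (cong₂ Vec._++_ (toVec-spure S x) (toVec-spure T x)) (replicate-++ (arity S))
    where
    replicate-++ : ∀ m {n} → Vec.replicate m x Vec.++ Vec.replicate n x ≡ Vec.replicate (m + n) x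
    replicate-++ zero    = refl
    replicate-++ (suc m) = cong (x ∷_) (replicate-++ m)

toVec-smap : {X Y : Set} (f : X → Y) → ∀ S x → toVec S (smap f S x) ≡ Vec.map f (toVec S x)
toVec-smap f ε       _       = refl
toVec-smap f •       _       = refl
toVec-smap f (S ⊗ T) (x , y) =
  trans (cong₂ Vec._++_ (toVec-smap f S x) (toVec-smap f T y)) (sym (Vec.map-++ f (toVec S x) (toVec T y)))

toVec-szip : {X Y Z : Set} (f : X → Y → Z) → ∀ S x y →
             toVec S (szip f S x y) ≡ Vec.zipWith f (toVec S x) (toVec S y)
toVec-szip f ε       _       _         = refl
toVec-szip f •       _       _         = refl
toVec-szip f (S ⊗ T) (x , y) (x′ , y′) =
  trans (cong₂ Vec._++_ (toVec-szip f S x x′) (toVec-szip f T y y′))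
        (sym (Vec.zipWith-++ f (toVec S x) (toVec T y) (toVec S x′) (toVec T y′)))

-- The blank is what a head sees when its stack is empty, so it must not encode a stack symbol;
-- `dec-blank` and `dec-enc` together exclude this.
record Coding (A : Set) (s e : ℕ) : Set where
  field
    enc : A → Symbol s e
    dec : Symbol s e → Maybe A
    dec-enc   : ∀ a → dec (enc a) ≡ just a
    dec-blank : dec blank ≡ nothing

-- A stack is kept on a tape with its top under the head.  As a push has to
-- move before it writes, one step of the machine takes two transitions.

module Compile {A : Set} {s e : ℕ} (finA : Finite A) (code : Coding A s e) (IO W : Shape)
               (P : Machine A (IO ⊗ W)) (verdict : ⟦ IO ⊗ W ⟧ (Maybe A) → Bool) where

  open Coding code

  S : Shape
  S = IO ⊗ W

  Γ : Set
  Γ = Symbol s e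

  shift settle : Op A → Γ → Γ × Move
  shift keep     c = c , stay
  shift pop      c = c , right
  shift (push _) c = c , left

  settle (push a) c = enc a , stay
  settle _        c = c , stay

  -- Acceptance depends on the halting state alone, so the verdict, which is read from the tops of
  -- the stacks, is moved into the state by one more transition out of `stopping`.
  data Phase : Set where
    running  : State P → Phase
    settling : Maybe (State P) → ⟦ S ⟧ (Op A) → Phase
    stopping : Phase
    stopped  : Bool → Phase

  abstract
    finite-Phase : Finite Phase
    finite-Phase = finite-retract
      (λ { (running q) → inj₁ q ; (settling q o) → inj₂ (inj₁ (q , o)) ; stopping → inj₂ (inj₂ nothing) ; (stopped b) → inj₂ (inj₂ (just b)) })
      (λ { (inj₁ q) → running q ; (inj₂ (inj₁ (q , o))) → settling q o ; (inj₂ (inj₂ nothing)) → stopping ; (inj₂ (inj₂ (just b))) → stopped b })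
      (λ { (running _) → refl ; (settling _ _) → refl ; stopping → refl ; (stopped _) → refl })
      (finite-⊎ (finite P) (finite-⊎ (finite-× (finite-Maybe (finite P)) (finite-⟦⟧ S (finite-Op finA))) (finite-Maybe finite-Bool)))

  seen : Vec Γ (arity S) → ⟦ S ⟧ (Maybe A)
  seen cs = fromVec S (Vec.map dec cs)

  transition : Phase → Vec Γ (arity S) → Maybe (Phase × Vec (Γ × Move) (arity S))
  transition (running q) cs =
    let q′ , o = δ P q (seen cs) in just (settling q′ o , Vec.zipWith shift (toVec S o) cs)
  transition (settling q o) cs = just (maybe′ running stopping q , Vec.zipWith settle (toVec S o) cs)
  transition stopping cs = just (stopped (verdict (seen cs)) , Vec.map (_, stay) cs)
  transition (stopped _) cs = nothing

  accepts : Phase → Bool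
  accepts (stopped b) = b
  accepts _           = false

  machine : TM s (arity IO)
  machine = record
    { auxSymbols = e
    ; workTapes  = arity W
    ; states     = card finite-Phase
    ; start      = index finite-Phase (running (start P))
    ; accepting  = λ q → accepts (elem finite-Phase q)
    ; δ          = λ q cs → Maybe.map (map₁ (index finite-Phase)) (transition (elem finite-Phase q) cs)
    }

  at : Phase → Vec (Tape s e) (arity S) → Config machine
  at p ts = config (index finite-Phase p) ts

  step-transition : ∀ p ts {p′ ams} → transition p (Vec.map Tape.head ts) ≡ just (p′ , ams) →
                    step machine (at p ts) ≡ just (at p′ (Vec.zipWith act ams ts))
  step-transition p ts eq rewrite elem-index finite-Phase p | eq = refl

  step-stopped : ∀ b ts → step machine (at (stopped b) ts) ≡ nothing
  step-stopped b ts rewrite elem-index finite-Phase (stopped b) = refl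

  -- Nothing is said about the cells to the left of the head: they hold the remains of popped
  -- symbols, which a later push overwrites. On the right, blanks visited by the head may have
  -- become listed cells, hence the padding.
  _≈_ : Tape s e → List A → Set
  t ≈ w = ∃[ j ] Tape.head t ∷ Tape.rights t ≡ List.map enc w ++ replicate j blank

  ≈-head : ∀ {t w} → t ≈ w → dec (Tape.head t) ≡ List.head w
  ≈-head {w = []}    (suc j , eq) = trans (cong dec (∷-injectiveˡ eq)) dec-blank
  ≈-head {w = a ∷ w} (j , eq)     = trans (cong dec (∷-injectiveˡ eq)) (dec-enc a)

  update : Op A → Tape s e → Tape s e
  update o t = let t′ = act (shift o (Tape.head t)) t in act (settle o (Tape.head t′)) t′

  ≈-right : ∀ ls h rs w {j} → rs ≡ List.map enc w ++ replicate j blank → move right (tape ls h rs) ≈ w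
  ≈-right ls h []       []      {j} eq = 1 , refl
  ≈-right ls h (r ∷ rs) w       {j} eq = j , eq

  ≈-update : ∀ o {t w} → t ≈ w → update o t ≈ apply o w
  ≈-update keep     {t}                  (j , eq)     = j , eq
  ≈-update (push a) {tape []      h rs}  (j , eq)     = j , cong (enc a ∷_) eq
  ≈-update (push a) {tape (_ ∷ _) h rs}  (j , eq)     = j , cong (enc a ∷_) eq
  ≈-update pop      {tape ls h []}       {[]}    (suc j , eq) = 1 , refl
  ≈-update pop      {tape ls h (r ∷ rs)} {[]}    (suc j , eq) = j , ∷-injectiveʳ eq
  ≈-update pop      {tape ls h []}       {a ∷ w} (j , eq)     = ≈-right ls h [] w {j} (∷-injectiveʳ eq)
  ≈-update pop      {tape ls h (r ∷ rs)} {a ∷ w} (j , eq)     = j , ∷-injectiveʳ eq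

  _≋_ : ∀ {n} → Vec (Tape s e) n → Vec (List A) n → Set
  _≋_ = Pointwise _≈_

  ≋-heads : ∀ {n} {ts : Vec _ n} {ws} → ts ≋ ws → Vec.map dec (Vec.map Tape.head ts) ≡ Vec.map List.head ws
  ≋-heads []                = refl
  ≋-heads (_∷_ {x = t} p ps) = cong₂ _∷_ (≈-head {t} p) (≋-heads ps)

  seen-tops : ∀ {ts σ} → ts ≋ toVec S σ → seen (Vec.map Tape.head ts) ≡ tops S σ
  seen-tops {σ = σ} ps =
    trans (cong (fromVec S) (trans (≋-heads ps) (sym (toVec-smap List.head S σ)))) (fromVec-toVec S (tops S σ))

  updates : ∀ {n} → Vec (Op A) n → Vec (Tape s e) n → Vec (Tape s e) n
  updates os ts = let ts′ = Vec.zipWith act (Vec.zipWith shift os (Vec.map Tape.head ts)) ts in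
    Vec.zipWith act (Vec.zipWith settle os (Vec.map Tape.head ts′)) ts′

  ≋-updates : ∀ {n} (os : Vec (Op A) n) {ts ws} → ts ≋ ws → updates os ts ≋ Vec.zipWith apply os ws
  ≋-updates []       []       = []
  ≋-updates (o ∷ os) (_∷_ {x = t} p ps) = ≈-update o {t} p ∷ ≋-updates os ps

  settled : Maybe (State P) → Phase
  settled = maybe′ running stopping

  perform-steps : ∀ {q q′ o σ ts} → δ P q (tops S σ) ≡ (q′ , o) → ts ≋ toVec S σ →
    ∃[ ts′ ] ts′ ≋ toVec S (perform S o σ) ×
      (∀ {n d} → Run machine (at (settled q′) ts′) n d → Run machine (at (running q) ts) (2 + n) d)
  perform-steps {q} {q′} {o} {σ} {ts} eq ps =
    updates (toVec S o) ts
    , subst (updates (toVec S o) ts ≋_) (sym (toVec-szip apply S o σ)) (≋-updates (toVec S o) ps)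
    , λ run → next (step-transition (running q) ts first)
             (next (step-transition (settling q′ o) (Vec.zipWith act (Vec.zipWith shift (toVec S o) (Vec.map Tape.head ts)) ts) refl) run)
    where
    first : transition (running q) (Vec.map Tape.head ts) ≡ just (settling q′ o , Vec.zipWith shift (toVec S o) (Vec.map Tape.head ts))
    first rewrite seen-tops {ts} {σ} ps | eq = refl

  act-stay : ∀ {n} (ts : Vec (Tape s e) n) → Vec.zipWith act (Vec.map (_, stay) (Vec.map Tape.head ts)) ts ≡ ts
  act-stay []       = refl
  act-stay (t ∷ ts) = cong (t ∷_) (act-stay ts)

  -- Two transitions for each step, and a last one that records the verdict.
  Exec⇒Run : ∀ {q σ t σ′ ts} → Exec P q σ t σ′ → ts ≋ toVec S σ →
             ∃[ ts′ ] ts′ ≋ toVec S σ′ × Run machine (at (running q) ts) (t * 2 + 1) (at (stopped (verdict (tops S σ′))) ts′)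
  Exec⇒Run {σ′ = σ′} (exit eq refl) ps with perform-steps eq ps
  ... | ts′ , ps′ , run = ts′ , ps′ , run (next
          (trans (step-transition stopping ts′ (cong (λ h → just (stopped (verdict h) , Vec.map (_, stay) (Vec.map Tape.head ts′))) (seen-tops ps′)))
                 (cong (λ ts → just (at (stopped (verdict (tops S σ′))) ts)) (act-stay ts′)))
          (halt (step-stopped (verdict (tops S σ′)) ts′)))
  Exec⇒Run (cont eq refl exec) ps with perform-steps eq ps
  ... | ts₁ , ps₁ , run with Exec⇒Run exec ps₁
  ...   | ts′ , ps′ , run′ = ts′ , ps′ , run run′

  input : ⟦ IO ⟧ (List A) → Vec (List Γ) (arity IO)
  input i = toVec IO (smap (List.map enc) IO i)

  load-≈ : ∀ w → load (List.map enc w) ≈ w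
  load-≈ []      = 1 , refl
  load-≈ (a ∷ w) = 0 , sym (++-[] (enc a ∷ List.map enc w))
    where
    ++-[] : (u : List Γ) → u ++ [] ≡ u
    ++-[] []      = refl
    ++-[] (c ∷ u) = cong (c ∷_) (++-[] u)

  load-≋ : ∀ {n} (ws : Vec (List A) n) → Vec.map load (Vec.map (List.map enc) ws) ≋ ws
  load-≋ []       = []
  load-≋ (w ∷ ws) = load-≈ w ∷ load-≋ ws

  blank-≋ : ∀ n → Vec.replicate n blankTape ≋ Vec.replicate n []
  blank-≋ zero    = []
  blank-≋ (suc n) = (1 , refl) ∷ blank-≋ n

  initial-≋ : ∀ i → Config.tapes (initial machine (input i)) ≋ toVec S (i , spure W [])
  initial-≋ i = Pointwise.++⁺
    (subst (λ ws → Vec.map load ws ≋ toVec IO i) (sym (toVec-smap (List.map enc) IO i)) (load-≋ (toVec IO i)))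
    (subst (Vec.replicate (arity W) blankTape ≋_) (sym (toVec-spure W [])) (blank-≋ (arity W)))

  enc-nonblank : ∀ a → enc a ≢ blank
  enc-nonblank a eq with trans (sym (dec-enc a)) (trans (cong dec eq) dec-blank)
  ... | ()

  untilBlank-enc : ∀ w j → untilBlank (List.map enc w ++ replicate j blank) ≡ List.map enc w
  untilBlank-enc []      zero    = refl
  untilBlank-enc []      (suc j) = refl
  untilBlank-enc (a ∷ w) j with enc a | enc-nonblank a
  ... | blank    | nb with () ← nb refl
  ... | letter i | _  = cong (letter i ∷_) (untilBlank-enc w j)
  ... | tally    | _  = cong (tally ∷_) (untilBlank-enc w j)
  ... | aux i    | _  = cong (aux i ∷_) (untilBlank-enc w j)

  contents-≋ : ∀ {n} {ts : Vec _ n} {ws} → ts ≋ ws → Vec.map contents ts ≡ Vec.map (List.map enc) ws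
  contents-≋ []                                   = refl
  contents-≋ (_∷_ {x = t} {y = w} (j , eq) ps) =
    cong₂ _∷_ (trans (cong untilBlank eq) (untilBlank-enc w j)) (contents-≋ ps)

  output-≋ : ∀ {p ts o w} → ts ≋ toVec S (o , w) → output machine (at p ts) ≡ input o
  output-≋ {ts = ts} {o} {w} ps = begin
    Vec.map contents (Vec.take (arity IO) ts)                             ≡⟨ Vec.take-map contents (arity IO) ts ⟨
    Vec.take (arity IO) (Vec.map contents ts)                             ≡⟨ cong (Vec.take (arity IO)) (contents-≋ ps) ⟩
    Vec.take (arity IO) (Vec.map (List.map enc) (toVec S (o , w)))         ≡⟨ Vec.take-map (List.map enc) (arity IO) (toVec S (o , w)) ⟩
    Vec.map (List.map enc) (Vec.take (arity IO) (toVec IO o Vec.++ toVec W w)) ≡⟨ cong (Vec.map (List.map enc)) (take-++ (toVec IO o) (toVec W w)) ⟩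
    Vec.map (List.map enc) (toVec IO o)                                   ≡⟨ toVec-smap (List.map enc) IO o ⟨
    input o                                                               ∎
    where open ≡-Reasoning

  computes : ∀ {i t o w b} → Runs P (i , spure W []) t (o , w) → t * 2 + 1 ≤ b →
             ComputesWithin machine b (input i) (input o)
  computes {i} {t} {o} {w} exec t≤b with Exec⇒Run exec (initial-≋ i)
  ... | ts′ , ps′ , run = t * 2 + 1 , _ , t≤b , run , output-≋ {stopped (verdict (tops S (o , w)))} ps′

  decides : ∀ {i t σ′ b} {R : Set} → Runs P (i , spure W []) t σ′ → t * 2 + 1 ≤ b →
            (Holds (verdict (tops S σ′)) ⇔ R) → DecidesWithin machine b (input i) R
  decides {i} {t} {σ′} exec t≤b iff with Exec⇒Run exec (initial-≋ i)
  ... | ts′ , ps′ , run = t * 2 + 1 , _ , t≤b , run ,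
    subst (λ p → Holds (accepts p) ⇔ _) (sym (elem-index finite-Phase (stopped (verdict (tops S σ′))))) iff

-- Basic stack programs

multiplyTime : ℕ → ℕ → ℕ
multiplyTime n m = m * (2 + (suc n + suc n)) + 1 + suc (m * n)

module _ {A : Set} where

  recast : ∀ {S} {M : Machine A S} {q σ t t′ σ′ σ″} → t ≡ t′ → σ′ ≡ σ″ → Exec M q σ t σ′ → Exec M q σ t′ σ″
  recast refl refl x = x

  RunsIn : ∀ {S} → Machine A S → ⟦ S ⟧ (List A) → ℕ → ⟦ S ⟧ (List A) → Set
  RunsIn M σ b σ′ = ∃[ t ] t ≤ b × Runs M σ t σ′

  pour : ∀ {T} → (A → ⟦ T ⟧ (Op A)) → Machine A (• ⊗ T)
  pour {T} f = stateless λ { (just a , _) → just tt , pop , f a ; (nothing , _) → nothing , keep , spure T keep }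

  pour-runs : ∀ {T} (f : A → ⟦ T ⟧ (Op A)) w τ →
              Runs (pour f) (w , τ) (suc (length w)) ([] , foldl (λ τ a → perform T (f a) τ) τ w)
  pour-runs {T} f []      τ = exit refl (cong ([] ,_) (perform-keep T τ))
  pour-runs {T} f (a ∷ w) τ = cont refl refl (pour-runs f w (perform T (f a) τ))

  module _ {T : Shape} (f : A → ⟦ T ⟧ (Op A)) where
    private
      forth : Sel (• ⊗ • ⊗ T) (• ⊗ •)
      forth = lft here & ⟨ rgt (lft here) ⟩

      back : Sel (• ⊗ • ⊗ T) (• ⊗ • ⊗ T)
      back = rgt (lft here) & lft here & ⟨ rgt (rgt here) ⟩

      both : A → ⟦ • ⊗ T ⟧ (Op A)
      both a = push a , f a

    -- Reading a stack destroys it, so the word is poured onto an auxiliary stack and back, and `f`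
    -- is performed on the way back. The two reversals cancel: the source is restored and the effect
    -- on the target is a right fold over the word.
    copy : Machine A (• ⊗ • ⊗ T)
    copy = lift forth (pour push) ⨾ lift back (pour both)

    copy-runs : ∀ w τ → Runs copy (w , [] , τ) (suc (length w) + suc (length w)) (w , [] , foldr (λ a → perform T (f a)) τ w)
    copy-runs w τ =
      Exec-lift forth (pour push) (w , [] , τ) (pour-runs push w [])
      then recast (cong suc (length-reverse w)) (cong (λ vτ → proj₁ vτ , [] , proj₂ vτ) restored)
        (Exec-lift back (pour both) ([] , reverse w , τ) (pour-runs both (reverse w) ([] , τ)))
      where
      rebuilt : ∀ w → foldr (λ a → perform (• ⊗ T) (both a)) ([] , τ) w ≡ (w , foldr (λ a → perform T (f a)) τ w)
      rebuilt []      = refl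
      rebuilt (a ∷ w) = cong (perform (• ⊗ T) (both a)) (rebuilt w)
      restored : foldl (λ vτ a → perform (• ⊗ T) (both a) vτ) ([] , τ) (reverse w) ≡ (w , foldr (λ a → perform T (f a)) τ w)
      restored = trans (reverse-foldl _ ([] , τ) w) (rebuilt w)

  foldr-push : ∀ (w v : List A) → foldr (λ a → perform • (push a)) v w ≡ w ++ v
  foldr-push []      v = refl
  foldr-push (a ∷ w) v = cong (a ∷_) (foldr-push w v)

  pushes : List A → Machine A •
  pushes []      = skip
  pushes (a ∷ w) = pushes w ⨾ stateless (λ _ → nothing , push a)

  pushes-runs : ∀ w v → Runs (pushes w) v (suc (length w)) (w ++ v)
  pushes-runs []      v = exit refl refl
  pushes-runs (a ∷ w) v = subst (λ n → Runs (pushes (a ∷ w)) v n (a ∷ w ++ v)) (+-comm (suc (length w)) 1)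
    (pushes-runs w v then exit refl refl)

  AllEmpty : ∀ S → ⟦ S ⟧ (Maybe A) → Bool
  AllEmpty ε       _       = true
  AllEmpty •       h       = not (is-just h)
  AllEmpty (S ⊗ T) (h , k) = AllEmpty S h ∧ AllEmpty T k

  AllEmpty-sound : ∀ S σ → AllEmpty S (tops S σ) ≡ true → σ ≡ spure S []
  AllEmpty-sound ε       _       _ = refl
  AllEmpty-sound •       []      _ = refl
  AllEmpty-sound (S ⊗ T) (σ , τ) e with AllEmpty S (tops S σ) in e₁
  ... | true = cong₂ _,_ (AllEmpty-sound S σ e₁) (AllEmpty-sound T τ e)

  Bounded : ℕ → ∀ S → ⟦ S ⟧ (List A) → Set
  Bounded m ε       _       = ⊤
  Bounded m •       w       = length w ≤ m
  Bounded m (S ⊗ T) (σ , τ) = Bounded m S σ × Bounded m T τ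

  Bounded-empty : ∀ m S → Bounded m S (spure S [])
  Bounded-empty m ε       = tt
  Bounded-empty m •       = z≤n
  Bounded-empty m (S ⊗ T) = Bounded-empty m S , Bounded-empty m T

  Bounded-mono : ∀ {m m′} S {σ} → m ≤ m′ → Bounded m S σ → Bounded m′ S σ
  Bounded-mono ε       m≤m′ _       = tt
  Bounded-mono •       m≤m′ b       = ≤-trans b m≤m′
  Bounded-mono (S ⊗ T) m≤m′ (b , c) = Bounded-mono S m≤m′ b , Bounded-mono T m≤m′ c

  Bounded-perform : ∀ {m} S o {σ} → Bounded m S σ → Bounded (suc m) S (perform S o σ)
  Bounded-perform ε       _        _       = tt
  Bounded-perform •       keep     b       = m≤n⇒m≤1+n b
  Bounded-perform •       pop {[]} b       = z≤n
  Bounded-perform •       pop {_ ∷ _} b    = m≤n⇒m≤1+n (≤-trans (n≤1+n _) b)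
  Bounded-perform •       (push a) b       = s≤s b
  Bounded-perform (S ⊗ T) (o , o′) (b , c) = Bounded-perform S o b , Bounded-perform T o′ c

  Bounded-pop : ∀ {m} S {σ} → Bounded (suc m) S σ → Bounded m S (perform S (spure S pop) σ)
  Bounded-pop ε               _       = tt
  Bounded-pop •       {[]}    _       = z≤n
  Bounded-pop •       {_ ∷ _} (s≤s b) = b
  Bounded-pop (S ⊗ T)         (b , c) = Bounded-pop S b , Bounded-pop T c

  Bounded-zero : ∀ S {σ} → Bounded 0 S σ → AllEmpty S (tops S σ) ≡ true
  Bounded-zero ε            _       = refl
  Bounded-zero •       {[]} _       = refl
  Bounded-zero (S ⊗ T)      (b , c) rewrite Bounded-zero S b = Bounded-zero T c

  -- A step lengthens each stack by at most one symbol. Hence time bounds both the length of an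
  -- output and the work of erasing what a simulation leaves behind.
  Exec-Bounded : ∀ {S} {M : Machine A S} {q σ t σ′ m} → Exec M q σ t σ′ → Bounded m S σ → Bounded (t + m) S σ′
  Exec-Bounded {S} (exit {o = o} _ refl)   b = Bounded-perform S o b
  Exec-Bounded {S} {t = suc t} {σ′} {m} (cont {o = o} _ refl x) b =
    subst (λ n → Bounded n S σ′) (+-suc t m) (Exec-Bounded x (Bounded-perform S o b))

  -- All stacks are popped in the same step, so the time is governed by the longest stack and not by
  -- their total length.
  clear : ∀ {S} → Machine A S
  clear {S} = stateless λ h → if AllEmpty S h then nothing , spure S keep else just tt , spure S pop

  clear-runs : ∀ {S} m {σ} → Bounded m S σ → RunsIn (clear {S}) σ (suc m) (spure S [])
  clear-runs {S} m {σ} b with AllEmpty S (tops S σ) in e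
  ... | true  = 1 , s≤s z≤n , exit (cong (λ c → if c then nothing , spure S keep else just tt , spure S pop) e)
                  (trans (perform-keep S σ) (AllEmpty-sound S σ e))
  clear-runs {S} zero    b | false with () ← trans (sym e) (Bounded-zero S b)
  clear-runs {S} (suc m) b | false with clear-runs {S} m (Bounded-pop S b)
  ... | t , t≤m , x = suc t , s≤s t≤m , cont (cong (λ c → if c then nothing , spure S keep else just tt , spure S pop) e) refl x

  -- The first extra stack is a timer, the second is marked when it runs out.
  clock : ∀ {S} → A → Machine A S → Machine A (S ⊗ • ⊗ •)
  clock {S} mark M = record
    { State = State M ; finite = finite M ; start = start M
    ; δ = λ { q (h , just _  , _) → map₂ (λ o → o , pop , keep) (δ M q h)
            ; q (h , nothing , _) → nothing , spure S keep , keep , push mark } }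

  Clocked : ∀ {S} (mark : A) (M : Machine A S) → State M → ⟦ S ⟧ (List A) → ℕ → ⟦ S ⟧ (List A) → List A → List A → Set
  Clocked mark M q σ t σ′ w c =
    (t ≤ length w × Exec (clock mark M) q (σ , w , c) t (σ′ , List.drop t w , c))
    ⊎ (length w < t × ∃[ σ″ ] Exec (clock mark M) q (σ , w , c) (suc (length w)) (σ″ , [] , mark ∷ c))

  clock-runs : ∀ {S} mark {M : Machine A S} {q σ t σ′} → Exec M q σ t σ′ → ∀ w c → Clocked mark M q σ t σ′ w c
  clock-runs {S} mark {σ = σ} (exit e p)   []      c = inj₂ (s≤s z≤n , σ , exit refl (cong (_, [] , mark ∷ c) (perform-keep S σ)))
  clock-runs {S} mark {σ = σ} (cont e p x) []      c = inj₂ (s≤s z≤n , σ , exit refl (cong (_, [] , mark ∷ c) (perform-keep S σ)))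
  clock-runs mark (exit e p)   (a ∷ w) c = inj₁ (s≤s z≤n , exit (cong (map₂ (λ o → o , pop , keep)) e) (cong (_, w , c) p))
  clock-runs mark (cont e p x) (a ∷ w) c with clock-runs mark x w c
  ... | inj₁ (t≤w , y)      = inj₁ (s≤s t≤w , cont (cong (map₂ (λ o → o , pop , keep)) e) (cong (_, w , c) p) y)
  ... | inj₂ (w<t , σ″ , y) = inj₂ (s≤s w<t , σ″ , cont (cong (map₂ (λ o → o , pop , keep)) e) (cong (_, w , c) p) y)

  -- The count costs no time, since the extra stack is served in the same steps. It turns a running
  -- time, known only to exist, into a number written in unary by a machine.
  tick : ∀ {S} → A → Machine A S → Machine A (S ⊗ •)
  tick mark M = record
    { State = State M ; finite = finite M ; start = start M
    ; δ = λ q (h , _) → map₂ (_, push mark) (δ M q h) }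

  tick-runs : ∀ {S} mark {M : Machine A S} {q σ t σ′} → Exec M q σ t σ′ → ∀ w →
              Exec (tick mark M) q (σ , w) t (σ′ , replicate t mark ++ w)
  tick-runs mark (exit e p)   w = exit (cong (map₂ (_, push mark)) e) (cong (_, mark ∷ w) p)
  tick-runs mark {t = suc t} (cont e p x) w = cont (cong (map₂ (_, push mark)) e) (cong (_, mark ∷ w) p)
    (subst (λ v → Exec _ _ _ _ (_ , v)) (shuffle t) (tick-runs mark x (mark ∷ w)))
    where
    shuffle : ∀ n → replicate n mark ++ mark ∷ w ≡ mark ∷ replicate n mark ++ w
    shuffle zero    = refl
    shuffle (suc n) = cong (mark ∷_) (shuffle n)

  private
    factor : Sel (• ⊗ • ⊗ • ⊗ •) •
    factor = ⟨ rgt (rgt (lft here)) ⟩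

    add : Sel (• ⊗ • ⊗ • ⊗ •) (• ⊗ • ⊗ •)
    add = lft here & rgt (lft here) & ⟨ rgt (rgt (rgt here)) ⟩

    result : Sel (• ⊗ • ⊗ • ⊗ •) (• ⊗ •)
    result = rgt (rgt (rgt here)) & ⟨ rgt (rgt (lft here)) ⟩

    drop-one : Machine A •
    drop-one = stateless (λ _ → nothing , pop)

    body : Machine A (• ⊗ • ⊗ • ⊗ •)
    body = lift factor drop-one ⨾ lift add (copy push)

    nonzero : ⟦ • ⊗ • ⊗ • ⊗ • ⟧ (Maybe A) → Bool
    nonzero (_ , _ , h , _) = is-just h

  -- Unary multiplication by repeated addition: every symbol of the third stack is traded for a copy
  -- of the first on the fourth. In `multiplyTime`, a round takes a test, a pop and the two passes
  -- of `copy`; then come the failing test and the transfer of the product back to the third stack,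
  -- where the next multiplication expects it.
  multiply : Machine A (• ⊗ • ⊗ • ⊗ •)
  multiply = while nonzero body ⨾ lift result (pour push)

  multiply-runs : ∀ w v → ∃[ v′ ] length v′ ≡ length v * length w ×
                  Runs multiply (w , [] , v , []) (multiplyTime (length w) (length v)) (w , [] , v′ , [])
  multiply-runs w v with iterate v []
    where
    n = length w
    iterate : ∀ v u → ∃[ u′ ] length u′ ≡ length v * n + length u ×
              Runs (while nonzero body) (w , [] , v , u) (length v * (2 + (suc n + suc n)) + 1) (w , [] , [] , u′)
    popped : ∀ a v u → Runs (lift factor drop-one)
                            (w , [] , a ∷ v , u) 1 (w , [] , v , u)
    popped a v u = exit refl refl
    copied : ∀ v u → Runs (lift add (copy push))
                          (w , [] , v , u) (suc n + suc n) (w , [] , v , w ++ u)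
    copied v u = recast refl (cong (λ u → w , [] , v , u) (foldr-push w u))
      (Exec-lift add (copy push) (w , [] , v , u) (copy-runs push w u))
    iterate []      u = u , refl , while-done refl
    iterate (a ∷ v) u with iterate v (w ++ u)
    ... | u′ , len , x = u′ , trans len lengths ,
          recast (sym (+-assoc (2 + (suc n + suc n)) _ 1)) refl (while-step refl (popped a v u then copied v u) x)
      where
      lengths : length v * n + length (w ++ u) ≡ n + length v * n + length u
      lengths = begin
        length v * n + length (w ++ u)     ≡⟨ cong (length v * n +_) (length-++ w) ⟩
        length v * n + (n + length u)      ≡⟨ +-assoc (length v * n) n _ ⟨
        length v * n + n + length u        ≡⟨ cong (_+ length u) (+-comm (length v * n) n) ⟩
        n + length v * n + length u        ∎
        where open ≡-Reasoning
  ... | u , len , x = reverse u , trans (length-reverse u) len′ , (x then recast (cong suc len′) refl poured)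
    where
    len′ : length u ≡ length v * length w
    len′ = trans len (+-identityʳ _)
    poured : Runs (lift result (pour push)) (w , [] , [] , u) (suc (length u)) (w , [] , reverse u , [])
    poured = Exec-lift result (pour push) (w , [] , [] , u) (pour-runs push u [])

-- Simulating Turing machines by stack machines

cells : ℕ → Shape
cells zero    = ε
cells (suc n) = (• ⊗ •) ⊗ cells n

-- A tape becomes two stacks, the cells to the left of the head and those to
-- its right; the symbols under the heads are held in the control state, and
-- are put on top of the right-hand stacks when the simulated machine halts.

module Simulate {A : Set} {s io : ℕ} (M : TM s io)
                (ι : TM.Γ M → A) (ρ : A → TM.Γ M) (ρ-ι : ∀ c → ρ (ι c) ≡ c) (accept reject : A) where

  private
    Γ : Set
    Γ = TM.Γ M

    Tp : Set
    Tp = Tape s (TM.auxSymbols M)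

  -- An exhausted stack stands for the endless blanks beyond the listed cells.
  read : Maybe A → Γ
  read = maybe′ ρ blank

  cellsOf haltedCells : ∀ {n} → Vec Tp n → ⟦ cells n ⟧ (List A)
  cellsOf []                   = tt
  cellsOf (tape ls h rs ∷ ts) = (List.map ι ls , List.map ι rs) , cellsOf ts

  haltedCells []                   = tt
  haltedCells (tape ls h rs ∷ ts) = (List.map ι ls , List.map ι (h ∷ rs)) , haltedCells ts

  -- Before the simulation starts, the control state holds no scanned symbols: a whole input word
  -- lies on its right-hand stack, where other programs can put it, and the first step picks up the
  -- scanned symbols.
  inputCells : ∀ {m n} → Vec (List Γ) m → ⟦ cells (m + n) ⟧ (List A)
  inputCells {n = n} [] = spure (cells n) []
  inputCells (w ∷ ws) = ([] , List.map ι w) , inputCells ws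

  readCells : ∀ {n} → ⟦ cells n ⟧ (Maybe A) → Vec Γ n
  readCells {zero}  _             = []
  readCells {suc n} ((_ , h) , k) = read h ∷ readCells k

  popRights : ∀ n → ⟦ cells n ⟧ (Op A)
  popRights zero    = tt
  popRights (suc n) = (keep , pop) , popRights n

  pushRights : ∀ {n} → Vec Γ n → ⟦ cells n ⟧ (Op A)
  pushRights []       = tt
  pushRights (c ∷ cs) = (keep , push (ι c)) , pushRights cs

  moveCell : Γ × Move → Maybe A × Maybe A → Γ × ⟦ • ⊗ • ⟧ (Op A)
  moveCell (c , left)  (h , _) = read h , pop , push (ι c)
  moveCell (c , stay)  _       = c , keep , keep
  moveCell (c , right) (_ , h) = read h , push (ι c) , pop

  moveCells : ∀ {n} → Vec (Γ × Move) n → ⟦ cells n ⟧ (Maybe A) → Vec Γ n × ⟦ cells n ⟧ (Op A)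
  moveCells []         _       = [] , tt
  moveCells (am ∷ ams) (h , k) =
    let c , o = moveCell am h ; cs , os = moveCells ams k in c ∷ cs , o , os

  Control : Set
  Control = Maybe (Fin (TM.states M) × Vec Γ (TM.tapeCount M))

  finite-Vec : ∀ {X : Set} → Finite X → ∀ n → Finite (Vec X n)
  finite-Vec X zero    = finite-retract (λ _ → tt) (λ _ → []) (λ { [] → refl }) finite-⊤
  finite-Vec X (suc n) = finite-retract (λ { (x ∷ xs) → x , xs }) (λ (x , xs) → x ∷ xs) (λ { (_ ∷ _) → refl })
    (finite-× X (finite-Vec X n))

  verdict : Fin (TM.states M) → A
  verdict q = if TM.accepting M q then accept else reject

  S : Shape
  S = cells (TM.tapeCount M) ⊗ •

  react : Fin (TM.states M) → Vec Γ (TM.tapeCount M) → ⟦ cells (TM.tapeCount M) ⟧ (Maybe A) →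
          Maybe (Fin (TM.states M) × Vec (Γ × Move) (TM.tapeCount M)) → Maybe Control × ⟦ S ⟧ (Op A)
  react q hs h nothing           = nothing , pushRights hs , push (verdict q)
  react q hs h (just (q′ , ams)) = just (just (q′ , proj₁ (moveCells ams h))) , proj₂ (moveCells ams h) , keep

  simulate : Machine A S
  simulate = record
    { State  = Control
    ; finite = finite-Maybe (finite-× (finite-Fin _) (finite-Vec (finite-Symbol _ _) _))
    ; start  = nothing
    ; δ      = λ { nothing         (h , _) → just (just (TM.start M , readCells h)) , popRights _ , keep
                 ; (just (q , hs)) (h , _) → react q hs h (TM.δ M q hs) } }

  cellOf : Tp → ⟦ • ⊗ • ⟧ (List A)
  cellOf (tape ls h rs) = List.map ι ls , List.map ι rs

  moveCell-head : ∀ am t → proj₁ (moveCell am (tops (• ⊗ •) (cellOf t))) ≡ Tape.head (act am t)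
  moveCell-head (c , left)  (tape []      h rs)       = refl
  moveCell-head (c , left)  (tape (a ∷ _) h rs)       = ρ-ι a
  moveCell-head (c , stay)  (tape ls      h rs)       = refl
  moveCell-head (c , right) (tape ls      h [])       = refl
  moveCell-head (c , right) (tape ls      h (a ∷ rs)) = ρ-ι a

  moveCell-perform : ∀ am t → perform (• ⊗ •) (proj₂ (moveCell am (tops (• ⊗ •) (cellOf t)))) (cellOf t) ≡ cellOf (act am t)
  moveCell-perform (c , left)  (tape []       h rs)       = refl
  moveCell-perform (c , left)  (tape (_ ∷ ls) h rs)       = refl
  moveCell-perform (c , stay)  (tape ls       h rs)       = refl
  moveCell-perform (c , right) (tape ls       h [])       = refl
  moveCell-perform (c , right) (tape ls       h (_ ∷ rs)) = refl

  moveCells-heads : ∀ {n} (ams : Vec _ n) ts →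
    proj₁ (moveCells ams (tops (cells n) (cellsOf ts))) ≡ Vec.map Tape.head (Vec.zipWith act ams ts)
  moveCells-heads []         []       = refl
  moveCells-heads (am ∷ ams) (t ∷ ts) = cong₂ _∷_ (moveCell-head am t) (moveCells-heads ams ts)

  moveCells-perform : ∀ {n} (ams : Vec _ n) ts →
    perform (cells n) (proj₂ (moveCells ams (tops (cells n) (cellsOf ts)))) (cellsOf ts) ≡ cellsOf (Vec.zipWith act ams ts)
  moveCells-perform []         []       = refl
  moveCells-perform (am ∷ ams) (t ∷ ts) = cong₂ _,_ (moveCell-perform am t) (moveCells-perform ams ts)

  pushRights-perform : ∀ {n} (ts : Vec _ n) → perform (cells n) (pushRights (Vec.map Tape.head ts)) (cellsOf ts) ≡ haltedCells ts
  pushRights-perform []       = refl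
  pushRights-perform (t ∷ ts) = cong (_ ,_) (pushRights-perform ts)

  Run⇒Exec : ∀ {c n d} → Run M c n d → ∀ f →
    Exec simulate (just (Config.state c , Vec.map Tape.head (Config.tapes c))) (cellsOf (Config.tapes c) , f) (suc n)
                  (haltedCells (Config.tapes d) , verdict (Config.state d) ∷ f)
  Run⇒Exec {config q ts} (halt e) f with TM.δ M q (Vec.map Tape.head ts) in eq
  Run⇒Exec {config q ts} (halt e) f | nothing =
    exit (cong (react q _ _) eq) (cong (_, verdict q ∷ f) (pushRights-perform ts))
  Run⇒Exec {config q ts} (next e run) f with TM.δ M q (Vec.map Tape.head ts) in eq
  Run⇒Exec {config q ts} (next refl run) f | just (q′ , ams) =
    cont (trans (cong (react q _ _) eq) (cong (λ hs → just (just (q′ , hs)) , proj₂ (moveCells ams (tops (cells (TM.tapeCount M)) (cellsOf ts))) , keep) (moveCells-heads ams ts)))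
         (cong (_, f) (moveCells-perform ams ts)) (Run⇒Exec run f)

  blankCells-read : ∀ n → readCells (tops (cells n) (spure (cells n) [])) ≡ Vec.map Tape.head (Vec.replicate n blankTape)
  blankCells-read zero    = refl
  blankCells-read (suc n) = cong (blank ∷_) (blankCells-read n)

  blankCells-pop : ∀ n → perform (cells n) (popRights n) (spure (cells n) []) ≡ cellsOf (Vec.replicate n blankTape)
  blankCells-pop zero    = refl
  blankCells-pop (suc n) = cong (_ ,_) (blankCells-pop n)

  inputCells-read : ∀ {m n} (ws : Vec (List Γ) m) →
    readCells (tops (cells (m + n)) (inputCells ws)) ≡ Vec.map Tape.head (Vec.map load ws Vec.++ Vec.replicate n blankTape)
  inputCells-read {n = n} []      = blankCells-read n
  inputCells-read ([] ∷ ws)       = cong (blank ∷_) (inputCells-read ws)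
  inputCells-read ((c ∷ _) ∷ ws) = cong₂ _∷_ (ρ-ι c) (inputCells-read ws)

  inputCells-pop : ∀ {m n} (ws : Vec (List Γ) m) →
    perform (cells (m + n)) (popRights (m + n)) (inputCells ws) ≡ cellsOf (Vec.map load ws Vec.++ Vec.replicate n blankTape)
  inputCells-pop {n = n} []      = blankCells-pop n
  inputCells-pop ([] ∷ ws)       = cong (_ ,_) (inputCells-pop ws)
  inputCells-pop ((_ ∷ _) ∷ ws) = cong (_ ,_) (inputCells-pop ws)

  -- One step picks up the scanned symbols and one puts them back and reports the verdict, hence the
  -- 2.
  simulate-runs : ∀ {ws n d} → Run M (initial M ws) n d → ∀ f →
    Runs simulate (inputCells ws , f) (2 + n) (haltedCells (Config.tapes d) , verdict (Config.state d) ∷ f)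
  simulate-runs {ws} run f =
    cont (cong (λ hs → just (just (TM.start M , hs)) , popRights (TM.tapeCount M) , keep) (inputCells-read ws)) (cong (_, f) (inputCells-pop ws)) (Run⇒Exec run f)

-- Comparing words that end at a blank

module _ {s e : ℕ} where

  private
    A : Set
    A = Symbol s e

  -- The stacks left by a simulated machine may continue with arbitrary symbols after the output, so
  -- a blank on top has to count as the end of the word just as an empty stack does.
  visible : Maybe A → Maybe A
  visible (just blank) = nothing
  visible h            = h

  untilBlank-step : ∀ w → untilBlank w ≡ maybe′ (λ a → a ∷ untilBlank (List.drop 1 w)) [] (visible (List.head w))
  untilBlank-step []             = refl
  untilBlank-step (blank ∷ w)    = refl
  untilBlank-step (letter _ ∷ w) = refl
  untilBlank-step (tally ∷ w)    = refl
  untilBlank-step (aux _ ∷ w)    = refl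

  untilBlank-head : ∀ w → List.head (untilBlank w) ≡ visible (List.head w)
  untilBlank-head w = trans (cong List.head (untilBlank-step w)) (go (visible (List.head w)))
    where
    go : ∀ h → List.head (maybe′ (λ a → a ∷ untilBlank (List.drop 1 w)) [] h) ≡ h
    go nothing  = refl
    go (just _) = refl

  abstract
    _≡ᵛ_ : (h k : Maybe A) → Dec (visible h ≡ visible k)
    h ≡ᵛ k = map′ (λ eq → trans (sym (elem-index F _)) (trans (cong (elem F) eq) (elem-index F _))) (cong (index F))
             (index F (visible h) Fin.≟ index F (visible k))
      where
      F : Finite (Maybe (Symbol s e))
      F = finite-Maybe (finite-Symbol s e)

  skipVisible : Maybe A → Op A
  skipVisible h = if is-just (visible h) then pop else keep

  Quad : Shape
  Quad = • ⊗ • ⊗ • ⊗ • ⊗ •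

  decideMatch : Bool → Bool → ⟦ Quad ⟧ (Maybe A) → Maybe ⊤ × ⟦ Quad ⟧ (Op A)
  decideMatch same more (a , b , c , d , _) =
    if same
    then (if more
          then just tt , skipVisible a , skipVisible b , skipVisible c , skipVisible d , keep
          else nothing , keep , keep , keep , keep , push tally)
    else nothing , spure Quad keep

  -- Reports on the last stack whether the first two and the next two hold the
  -- same words, a word ending before its first blank.
  matchPairs : Machine A Quad
  matchPairs = stateless λ { h@(a , b , c , d , _) →
    decideMatch (does (a ≡ᵛ b) ∧ does (c ≡ᵛ d)) (is-just (visible a) ∨ is-just (visible c)) h }

  Same : (a b c d : List A) → Set
  Same a b c d = untilBlank a ≡ untilBlank b × untilBlank c ≡ untilBlank d

  Matched : (a b c d f f′ : List A) → Set
  Matched a b c d f f′ = (f′ ≡ tally ∷ f × Same a b c d) ⊎ (f′ ≡ f × ¬ Same a b c d)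

  advance : List A → List A
  advance w = apply (skipVisible (List.head w)) w

  advance-same : ∀ a b → visible (List.head a) ≡ visible (List.head b) →
                 (untilBlank (advance a) ≡ untilBlank (advance b)) ⇔ (untilBlank a ≡ untilBlank b)
  advance-same a b eq with visible (List.head a) | visible (List.head b) | untilBlank-step a | untilBlank-step b
  advance-same a b refl | nothing | _ | _  | _  = mk⇔ id id
  advance-same a b refl | just _  | _ | ea | eb = mk⇔
    (λ e → trans ea (trans (cong (_ ∷_) e) (sym eb)))
    (λ e → ∷-injectiveʳ (trans (sym ea) (trans e eb)))

  advance-≤ : ∀ w → length (advance w) ≤ length w
  advance-≤ []             = z≤n
  advance-≤ (blank ∷ w)    = ≤-refl
  advance-≤ (letter _ ∷ w) = n≤1+n _
  advance-≤ (tally ∷ w)    = n≤1+n _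
  advance-≤ (aux _ ∷ w)    = n≤1+n _

  advance-< : ∀ w → is-just (visible (List.head w)) ≡ true → length (advance w) < length w
  advance-< (letter _ ∷ w) _ = ≤-refl
  advance-< (tally ∷ w)    _ = ≤-refl
  advance-< (aux _ ∷ w)    _ = ≤-refl

  visible-ends : ∀ w → is-just (visible (List.head w)) ≡ false → untilBlank w ≡ []
  visible-ends w e with visible (List.head w) | untilBlank-step w
  ... | nothing | eq = eq

  -- As long as the tops agree, `b` and `d` end exactly when `a` and `c` do, so it is enough to ask
  -- `a` and `c` whether there is more. Each further round shortens one of these two, which bounds
  -- the time without reference to the lengths of `b` and `d`.
  matchPairs-runs : ∀ m a b c d f → length a + length c ≤ m →
    ∃[ a′ ] ∃[ b′ ] ∃[ c′ ] ∃[ d′ ] ∃[ f′ ]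
      RunsIn matchPairs (a , b , c , d , f) (suc m) (a′ , b′ , c′ , d′ , f′) × Matched a b c d f f′
  matchPairs-runs m a b c d f le = go m a b c d le
    where
    ∨-false₁ : ∀ {x y} → x ∨ y ≡ false → x ≡ false
    ∨-false₁ {false} _ = refl
    ∨-false₂ : ∀ x {y} → x ∨ y ≡ false → y ≡ false
    ∨-false₂ false e = e
    ∨-true : ∀ x {y} → x ∨ y ≡ true → x ≡ true ⊎ y ≡ true
    ∨-true true  _ = inj₁ refl
    ∨-true false e = inj₂ e
    shorter : ∀ a c → is-just (visible (List.head a)) ∨ is-just (visible (List.head c)) ≡ true →
              length (advance a) + length (advance c) < length a + length c
    shorter a c e with ∨-true (is-just (visible (List.head a))) e
    ... | inj₁ ea = +-mono-<-≤ (advance-< a ea) (advance-≤ c)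
    ... | inj₂ ec = +-mono-≤-< (advance-≤ a) (advance-< c ec)
    look : ∀ {a b c d same more} → (does (List.head a ≡ᵛ List.head b) ∧ does (List.head c ≡ᵛ List.head d)) ≡ same →
           is-just (visible (List.head a)) ∨ is-just (visible (List.head c)) ≡ more →
           δ matchPairs tt (tops Quad (a , b , c , d , f)) ≡ decideMatch same more (tops Quad (a , b , c , d , f))
    look {a} {b} {c} {d} = cong₂ (λ same more → decideMatch same more (tops Quad (a , b , c , d , f)))
    go : ∀ m a b c d → length a + length c ≤ m →
      ∃[ a′ ] ∃[ b′ ] ∃[ c′ ] ∃[ d′ ] ∃[ f′ ]
        RunsIn matchPairs (a , b , c , d , f) (suc m) (a′ , b′ , c′ , d′ , f′) × Matched a b c d f f′
    go m a b c d le with List.head a ≡ᵛ List.head b in ab | List.head c ≡ᵛ List.head d in cd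
    ... | no a≢b | _ = _ , _ , _ , _ , f ,
          (1 , s≤s z≤n , exit (look {a} {b} {c} {d} (cong (λ x → does x ∧ does (List.head c ≡ᵛ List.head d)) ab) refl) refl) ,
          inj₂ (refl , λ (e , _) → a≢b (trans (sym (untilBlank-head a)) (trans (cong List.head e) (untilBlank-head b))))
    ... | yes a≡b | no c≢d = _ , _ , _ , _ , f ,
          (1 , s≤s z≤n , exit (look {a} {b} {c} {d} (cong₂ (λ x y → does x ∧ does y) ab cd) refl) refl) ,
          inj₂ (refl , λ (_ , e) → c≢d (trans (sym (untilBlank-head c)) (trans (cong List.head e) (untilBlank-head d))))
    ... | yes a≡b | yes c≡d with is-just (visible (List.head a)) ∨ is-just (visible (List.head c)) in more
    ...   | false = _ , _ , _ , _ , tally ∷ f , (1 , s≤s z≤n , exit (look {a} {b} {c} {d} (cong₂ (λ x y → does x ∧ does y) ab cd) more) refl) , inj₁ (refl ,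
            trans (visible-ends a a-ends) (sym (visible-ends b (trans (cong is-just (sym a≡b)) a-ends))) ,
            trans (visible-ends c c-ends) (sym (visible-ends d (trans (cong is-just (sym c≡d)) c-ends))))
      where
      a-ends = ∨-false₁ more
      c-ends = ∨-false₂ (is-just (visible (List.head a))) more
    go zero    a b c d le | yes a≡b | yes c≡d | true with () ← ≤-trans (shorter a c more) le
    go (suc m) a b c d le | yes a≡b | yes c≡d | true
      with go m (advance a) (advance b) (advance c) (advance d) (s≤s⁻¹ (≤-trans (shorter a c more) le))
    ... | a′ , b′ , c′ , d′ , f′ , (t , t≤m , x) , cmp = a′ , b′ , c′ , d′ , f′ , (suc t , s≤s t≤m , cont (look {a} {b} {c} {d} (cong₂ (λ x y → does x ∧ does y) ab cd) more) refl x) ,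
          Sum.map (map₂ (λ (e , e′) → Equivalence.to (advance-same a b a≡b) e , Equivalence.to (advance-same c d c≡d) e′))
                  (map₂ (λ ne (e , e′) → ne (Equivalence.from (advance-same a b a≡b) e , Equivalence.from (advance-same c d c≡d) e′))) cmp

*-^ : ∀ m n c → (m * n) ^ c ≡ m ^ c * n ^ c
*-^ m n zero    = refl
*-^ m n (suc c) = trans (cong (m * n *_) (*-^ m n c)) ([m*n]*[o*p]≡[m*o]*[n*p] m n (m ^ c) (n ^ c))

-- Polynomial bounds

module _ {I : Set} (weight : I → ℕ) where

  -- A base of at least 2 allows a single exponent to describe a bound: a constant n is at most 2 ^
  -- n, and the factor 2 in a sum of two powers is absorbed by one more factor of the base.
  Poly : (I → ℕ) → Set
  Poly g = ∃[ c ] (∀ i → g i ≤ (2 + weight i) ^ c)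

module _ {I : Set} {weight : I → ℕ} where

  abstract

    private
      base : ∀ i c → 1 ≤ (2 + weight i) ^ c
      base i c = >-nonZero⁻¹ _ ⦃ m^n≢0 (2 + weight i) c ⦄

    Poly-≤ : ∀ {g h} → (∀ i → g i ≤ h i) → Poly weight h → Poly weight g
    Poly-≤ g≤h (c , b) = c , λ i → ≤-trans (g≤h i) (b i)

    Poly-weight : Poly weight weight
    Poly-weight = 1 , λ i → ≤-trans (m≤n+m _ 2) (≤-reflexive (sym (^-identityʳ _)))

    Poly-const : ∀ n → Poly weight (λ _ → n)
    Poly-const n = n , λ i → ≤-trans (n≤2^n n) (^-monoˡ-≤ n (m≤m+n 2 (weight i)))
      where
      n≤2^n : ∀ n → n ≤ 2 ^ n
      n≤2^n zero    = z≤n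
      n≤2^n (suc n) = +-mono-≤ (m^n>0 2 n) (≤-trans (n≤2^n n) (m≤m+n _ 0))

    Poly-* : ∀ {g h} → Poly weight g → Poly weight h → Poly weight (λ i → g i * h i)
    Poly-* (c , b) (c′ , b′) = c + c′ , λ i →
      ≤-trans (*-mono-≤ (b i) (b′ i)) (≤-reflexive (sym (^-distribˡ-+-* (2 + weight i) c c′)))

    Poly-+ : ∀ {g h} → Poly weight g → Poly weight h → Poly weight (λ i → g i + h i)
    Poly-+ {g} {h} (c , b) (c′ , b′) = suc (c + c′) , λ i →
      let B = 2 + weight i in begin
      g i + h i                         ≤⟨ +-mono-≤ (b i) (b′ i) ⟩
      B ^ c + B ^ c′                    ≤⟨ +-mono-≤ (^-monoʳ-≤ B (m≤m+n c c′)) (^-monoʳ-≤ B (m≤n+m c′ c)) ⟩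
      B ^ (c + c′) + B ^ (c + c′)       ≡⟨ cong (B ^ (c + c′) +_) (+-identityʳ _) ⟨
      2 * B ^ (c + c′)                  ≤⟨ *-monoˡ-≤ (B ^ (c + c′)) (m≤m+n 2 (weight i)) ⟩
      B * B ^ (c + c′)                  ∎
      where open ≤-Reasoning

    Poly-^ : ∀ {g} → Poly weight g → ∀ c → Poly weight (λ i → g i ^ c)
    Poly-^ p zero    = Poly-const 1
    Poly-^ p (suc c) = Poly-* p (Poly-^ p c)

    Poly-polynomial : ∀ {s g} → Poly weight g → ∀ c → Poly weight (λ i → polynomial {s} c (g i))
    Poly-polynomial p c = Poly-+ (Poly-* (Poly-const c) (Poly-^ p c)) (Poly-const c)

    -- For n at least 1 one has 2 + n ≤ 3 n, which gives the coefficient 3 ^ c. The same number must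
    -- serve as exponent and as additive constant; it is at least c, and the additive constant takes
    -- care of n = 0.
    Poly⇒polynomial : ∀ {s g} → Poly weight g → ∃[ c ] (∀ i → g i ≤ polynomial {s} c (weight i))
    Poly⇒polynomial {s} (c , b) = 3 ^ c , λ i → ≤-trans (b i) (power (weight i))
      where
      open ≤-Reasoning
      c≤3^c : ∀ c → c ≤ 3 ^ c
      c≤3^c zero    = z≤n
      c≤3^c (suc c) = +-mono-≤ (m^n>0 3 c) (≤-trans (c≤3^c c) (m≤m+n _ _))
      power : ∀ n → (2 + n) ^ c ≤ polynomial {s} (3 ^ c) n
      power zero    = ≤-trans (^-monoˡ-≤ c (n≤1+n 2)) (m≤n+m _ _)
      power n@(suc m) = begin
        (2 + n) ^ c                     ≤⟨ ^-monoˡ-≤ c (≤-trans (≤-reflexive (+-comm 2 n)) (+-monoʳ-≤ n (*-monoʳ-≤ 2 (s≤s (z≤n {m}))))) ⟩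
        (3 * n) ^ c                     ≡⟨ *-^ 3 n c ⟩
        3 ^ c * n ^ c                   ≤⟨ *-monoʳ-≤ (3 ^ c) (^-monoʳ-≤ n (c≤3^c c)) ⟩
        3 ^ c * n ^ (3 ^ c)             ≤⟨ m≤m+n _ _ ⟩
        3 ^ c * n ^ (3 ^ c) + 3 ^ c     ∎

-- Codings and changes of alphabet

-- Blank is an ordinary stack symbol, so it has to be renamed on tape.
native : ∀ s e → Coding (Symbol s e) s (suc e)
native s e = record
  { enc = λ { blank → aux zero ; (letter i) → letter i ; tally → tally ; (aux j) → aux (suc j) }
  ; dec = λ { blank → nothing ; (letter i) → just (letter i) ; tally → just tally
            ; (aux zero) → just blank ; (aux (suc j)) → just (aux j) }
  ; dec-enc = λ { blank → refl ; (letter _) → refl ; tally → refl ; (aux _) → refl }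
  ; dec-blank = refl }

-- `Computable` speaks of machines without input letters, so a program over an alphabet with letters
-- has to keep these as auxiliary symbols.
letterless : ∀ s e → Coding (Symbol s e) 0 (suc (s + e))
letterless s e = record
  { enc = λ { blank → aux zero ; (letter i) → aux (suc (i Fin.↑ˡ e)) ; tally → tally ; (aux j) → aux (suc (s Fin.↑ʳ j)) }
  ; dec = dec
  ; dec-enc = λ { blank → refl ; tally → refl
                ; (letter i) → cong (λ z → just ([ letter , aux ]′ z)) (Fin.splitAt-↑ˡ s i e)
                ; (aux j) → cong (λ z → just ([ letter , aux ]′ z)) (Fin.splitAt-↑ʳ s e j) }
  ; dec-blank = refl }
  where
  dec : Symbol 0 (suc (s + e)) → Maybe (Symbol s e)
  dec blank         = nothing
  dec tally         = just tally
  dec (aux zero)    = just blank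
  dec (aux (suc j)) = just ([ letter , aux ]′ (Fin.splitAt s j))

module _ {s s′ e e′ : ℕ} (f : Fin s → Fin s′) (g : Fin e → Fin e′) where

  relabel : Symbol s e → Symbol s′ e′
  relabel blank      = blank
  relabel (letter i) = letter (f i)
  relabel tally      = tally
  relabel (aux j)    = aux (g j)

  relabel-tallies : ∀ k → List.map relabel (replicate k tally) ≡ replicate k tally
  relabel-tallies zero    = refl
  relabel-tallies (suc k) = cong (tally ∷_) (relabel-tallies k)

  relabel-untilBlank : ∀ w → untilBlank (List.map relabel w) ≡ List.map relabel (untilBlank w)
  relabel-untilBlank []             = refl
  relabel-untilBlank (blank ∷ w)    = refl
  relabel-untilBlank (letter i ∷ w) = cong (_ ∷_) (relabel-untilBlank w)
  relabel-untilBlank (tally ∷ w)    = cong (_ ∷_) (relabel-untilBlank w)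
  relabel-untilBlank (aux j ∷ w)    = cong (_ ∷_) (relabel-untilBlank w)

relabel-letters : ∀ {s e e′} (g : Fin e → Fin e′) (x : List (Fin s)) →
                  List.map (relabel id g) (List.map letter x) ≡ List.map letter x
relabel-letters g []      = refl
relabel-letters g (i ∷ x) = cong (letter i ∷_) (relabel-letters g x)

module _ {s s′ e e′ : ℕ} (f : Fin s → Maybe (Fin s′)) (g : Fin e → Maybe (Fin e′)) where

  unlabel : Symbol s e → Symbol s′ e′
  unlabel blank      = blank
  unlabel (letter i) = maybe′ letter blank (f i)
  unlabel tally      = tally
  unlabel (aux j)    = maybe′ aux blank (g j)

-- With this, machines with different auxiliary symbols can be simulated over one common stack
-- alphabet; symbols foreign to a machine read as blanks.
unlabel-relabel : ∀ {s s′ e e′} {f : Fin s → Fin s′} {g : Fin e → Fin e′} {f⁻¹ g⁻¹} →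
                  (∀ i → f⁻¹ (f i) ≡ just i) → (∀ j → g⁻¹ (g j) ≡ just j) →
                  ∀ c → unlabel f⁻¹ g⁻¹ (relabel f g c) ≡ c
unlabel-relabel p q blank      = refl
unlabel-relabel p q (letter i) = cong (maybe′ letter blank) (p i)
unlabel-relabel p q tally      = refl
unlabel-relabel p q (aux j)    = cong (maybe′ aux blank) (q j)

-- Powers in unary, copies, and encodings of instances

powerTime : ℕ → ℕ → ℕ → ℕ
powerTime zero    n m = 1
powerTime (suc c) n m = multiplyTime n m + powerTime c n (m * n)

Poly-power : ∀ {I} {weight : I → ℕ} {g h} c → Poly weight g → Poly weight h → Poly weight (λ i → powerTime c (g i) (h i))
Poly-power zero    p q = Poly-const 1
Poly-power (suc c) p q = Poly-+ (Poly-+ (Poly-+ (Poly-* q (Poly-+ (Poly-const 2) (Poly-+ p′ p′))) (Poly-const 1)) (Poly-+ (Poly-const 1) (Poly-* q p)))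
  (Poly-power c p (Poly-* q p))
  where p′ = Poly-+ (Poly-const 1) p

module _ {A : Set} where

  power : ℕ → Machine A (• ⊗ • ⊗ • ⊗ •)
  power zero    = skip
  power (suc c) = multiply ⨾ power c

  power-runs : ∀ c w v → ∃[ v′ ] length v′ ≡ length v * length w ^ c ×
               Runs (power c) (w , [] , v , []) (powerTime c (length w) (length v)) (w , [] , v′ , [])
  power-runs zero    w v = v , sym (*-identityʳ _) , exit refl refl
  power-runs (suc c) w v with multiply-runs w v
  ... | v₁ , len₁ , x with power-runs c w v₁
  ...   | v₂ , len₂ , y = v₂ , trans len₂ (trans (cong (_* length w ^ c) len₁) (*-assoc (length v) (length w) _)) ,
          (x then recast (cong (powerTime c (length w)) len₁) refl y)

  copy-word : ∀ (w : List A) → Runs (copy {T = •} push) (w , [] , []) (suc (length w) + suc (length w)) (w , [] , w)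
  copy-word w = recast refl (cong (λ v → w , [] , v) (trans (foldr-push w []) (++-identityʳ w))) (copy-runs push w [])

  copy-length : ∀ mark (w : List A) → Runs (copy {T = •} (λ _ → push mark)) (w , [] , []) (suc (length w) + suc (length w)) (w , [] , replicate (length w) mark)
  copy-length mark w = recast refl (cong (λ v → w , [] , v) (marks w)) (copy-runs (λ _ → push mark) w [])
    where
    marks : ∀ w → foldr (λ _ → perform • (push mark)) [] w ≡ replicate (length w) mark
    marks []      = refl
    marks (_ ∷ w) = cong (mark ∷_) (marks w)

isTally : ∀ {s e} → Maybe (Symbol s e) → Bool
isTally (just tally) = true
isTally _            = false

letters : ∀ {s e} → List (Fin s) → List (Symbol s e)
letters = List.map letter

unary : ∀ {s e} → ℕ → List (Symbol s e)
unary k = replicate k tally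

encode-native : ∀ {s e} (y : Instance s) →
                toVec (• ⊗ •) (smap (List.map (Coding.enc (native s e))) (• ⊗ •) (letters (proj₁ y) , unary (proj₂ y))) ≡ encode y
encode-native {s} {e} (x , k) = cong₂ (λ u v → u ∷ v ∷ []) (word x) (number k)
  where
  word : ∀ x → List.map (Coding.enc (native s e)) (letters x) ≡ letters x
  word []      = refl
  word (i ∷ x) = cong (letter i ∷_) (word x)
  number : ∀ k → List.map (Coding.enc (native s e)) (unary k) ≡ unary k
  number zero    = refl
  number (suc k) = cong (tally ∷_) (number k)

computes-cast : ∀ {s io} {M : TM s io} {b ws ws′ vs vs′} → ws ≡ ws′ → vs ≡ vs′ →
               ComputesWithin M b ws vs → ComputesWithin M b ws′ vs′
computes-cast refl refl c = c

-- The clocked simulation accepts, rejects or runs out of time. Here `n` counts the transitions of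
-- the simulated run, and the 2 is the overhead of the simulation; in the third case the timer of
-- length (|x| + 1) ^ (c + 1) was too short for it.
Outcome : ∀ {s} → ℕ → (y₁ y₀ : Instance s) → Set → Instance s → ℕ → Instance s → Set
Outcome c y₁ y₀ R y n y′ = (y′ ≡ y₁ × R) ⊎ (y′ ≡ y₀ × ¬ R) ⊎ (y′ ≡ y × suc (length (proj₁ y)) ^ suc c < 2 + n)

-- From a decision procedure to a kernel

module Kernelize {s : ℕ} (M : TM s 2) (c : ℕ) (y₁ y₀ : Instance s) where

  open TM M using (workTapes; auxSymbols)

  private
    A : Set
    A = Symbol s auxSymbols

  open Simulate {A} M (relabel id id) (unlabel just just) (unlabel-relabel (λ _ → refl) (λ _ → refl)) tally blank
    using (simulate; simulate-runs; haltedCells; inputCells; verdict)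

  Work S : Shape
  Work = • ⊗ • ⊗ • ⊗ • ⊗ • ⊗ cells (2 + workTapes) ⊗ •
  S = (• ⊗ •) ⊗ Work

  word param tmp count timer spare late : Path S •
  word  = lft (lft here)
  param = lft (rgt here)
  tmp   = rgt (lft here)
  count = rgt (rgt (lft here))
  timer = rgt (rgt (rgt (lft here)))
  spare = rgt (rgt (rgt (rgt (lft here))))
  late  = rgt (rgt (rgt (rgt (rgt (lft here)))))

  sim : Path S (cells (2 + workTapes) ⊗ •)
  sim = rgt (rgt (rgt (rgt (rgt (rgt here)))))

  wordTape paramTape flag : Path S •
  wordTape  = sim ▸ lft (lft (rgt here))
  paramTape = sim ▸ lft (rgt (lft (rgt here)))
  flag      = sim ▸ rgt here

  counting copyWord copyParam : Sel S (• ⊗ • ⊗ •)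
  counting  = word & tmp & ⟨ count ⟩
  copyWord  = word & tmp & ⟨ wordTape ⟩
  copyParam = param & tmp & ⟨ paramTape ⟩

  powering : Sel S (• ⊗ • ⊗ • ⊗ •)
  powering = count & tmp & timer & ⟨ spare ⟩

  timed : Sel S ((cells (2 + workTapes) ⊗ •) ⊗ • ⊗ •)
  timed = sim & timer & ⟨ late ⟩

  inputPair : Sel S (• ⊗ •)
  inputPair = ⟨ lft here ⟩

  isLate accepted : ⟦ S ⟧ (Maybe A) → Bool
  isLate h   = is-just (getP late h)
  accepted h = isTally (getP flag h)

  answer : Instance s → Machine A S
  answer (x , k) = lift ⟨ word ⟩ (pushes (letters x)) ⨾ lift ⟨ param ⟩ (pushes (unary k))

  prepare conclude kernel : Machine A S
  -- `count` becomes |x| + 1 in unary, and the single tally on `timer` is multiplied by it c + 1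
  -- times. The input is only copied to the simulated tapes, as it may have to be the output.
  prepare = lift counting (copy (λ _ → push tally)) ⨾ lift ⟨ count ⟩ (pushes (tally ∷ []))
          ⨾ lift ⟨ timer ⟩ (pushes (tally ∷ [])) ⨾ lift powering (power (suc c))
          ⨾ lift copyWord (copy push) ⨾ lift copyParam (copy push)
  -- When time has run out, the untouched input already stands on the output stacks.
  conclude = ifte isLate skip (lift inputPair clear ⨾ ifte accepted (answer y₁) (answer y₀))
  kernel = prepare ⨾ lift timed (clock tally simulate) ⨾ conclude

  loaded : List (Fin s) → ℕ → ⟦ cells (2 + workTapes) ⟧ (List A)
  loaded x k = ([] , letters x) , ([] , unary k) , spure (cells workTapes) []

  loaded-input : ∀ x k → loaded x k ≡ inputCells {n = workTapes} (encode (x , k))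
  loaded-input x k = cong₂ (λ u v → ([] , u) , ([] , v) , spure (cells workTapes) []) (sym (relabel-letters id x)) (sym (relabel-tallies id id k))

  idle : ⟦ cells (2 + workTapes) ⟧ (List A)
  idle = spure (cells (2 + workTapes)) []

  prepareTime : Instance s → ℕ
  prepareTime (x , k) = m + (2 + (2 + (powerTime (suc c) (suc (length N₀)) 1
                      + (m + (suc (length K) + suc (length K))))))
    where
    X K N₀ : List A
    X = letters x
    K = unary k
    N₀ = replicate (length X) tally
    m = suc (length X) + suc (length X)

  prepare-runs : ∀ x k → ∃[ n ] ∃[ w ] length w ≡ suc (length x) ^ suc c ×
    Runs prepare ((letters x , unary k) , spure Work []) (prepareTime (x , k))
                 ((letters x , unary k) , [] , n , w , [] , [] , loaded x k , [])
  prepare-runs x k = let w , len , run = power-runs (suc c) N (tally ∷ []) in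
    N , w , trans len (trans (*-identityˡ _) (cong (_^ suc c) lenN)) ,
      (Exec-lift counting (copy (λ _ → push tally)) (σ [] [] idle) (copy-length tally X)
      then Exec-lift ⟨ count ⟩ (pushes (tally ∷ [])) (σ N₀ [] idle) (pushes-runs (tally ∷ []) N₀)
      then Exec-lift ⟨ timer ⟩ (pushes (tally ∷ [])) (σ N [] idle) (pushes-runs (tally ∷ []) [])
      then Exec-lift powering (power (suc c)) (σ N (tally ∷ []) idle) run
      then Exec-lift copyWord (copy push) (σ N w idle) (copy-word X)
      then Exec-lift copyParam (copy push) (σ N w (([] , X) , ([] , []) , spure (cells workTapes) [])) (copy-word K))
    where
    X K N₀ N : List A
    X = letters x
    K = unary k
    N₀ = replicate (length X) tally
    N = tally ∷ N₀
    lenN : length N ≡ suc (length x)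
    lenN = cong suc (trans (length-replicate (length X)) (length-map letter x))
    σ : List A → List A → ⟦ cells (2 + workTapes) ⟧ (List A) → ⟦ S ⟧ (List A)
    σ n w C = (X , K) , [] , n , w , [] , [] , C , []

  answer-runs : ∀ y τ → Runs (answer y) (([] , []) , τ) (suc (length (letters {s} {auxSymbols} (proj₁ y))) + suc (length (unary {s} {auxSymbols} (proj₂ y))))
                             ((letters (proj₁ y) , unary (proj₂ y)) , τ)
  answer-runs (x , k) τ =
    recast refl (cong (λ u → (u , []) , τ) (++-identityʳ (letters x))) (Exec-lift ⟨ word ⟩ (pushes (letters x)) (([] , []) , τ) (pushes-runs (letters x) []))
    then recast refl (cong (λ u → (letters x , u) , τ) (++-identityʳ (unary k))) (Exec-lift ⟨ param ⟩ (pushes (unary k)) ((letters x , []) , τ) (pushes-runs (unary k) []))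

  answerTime : Instance s → ℕ
  answerTime (x , k) = suc (length (letters {s} {auxSymbols} x)) + suc (length (unary {s} {auxSymbols} k))

  concludeTime kernelTime : Instance s → ℕ
  concludeTime y = 1 + (suc (size y) + (1 + (answerTime y₁ + answerTime y₀)))
  kernelTime y = prepareTime y + (suc (suc (length (proj₁ y)) ^ suc c) + concludeTime y)

  conclude-late : ∀ y τ n w C f →
    RunsIn conclude (τ , [] , n , w , [] , tally ∷ [] , C , f) (concludeTime y) (τ , [] , n , w , [] , tally ∷ [] , C , f)
  conclude-late y τ n w C f = 2 , s≤s (s≤s z≤n) , ifte-true refl (exit refl (perform-keep S _))

  conclude-answer : ∀ y n w C b →
    RunsIn conclude ((letters (proj₁ y) , unary (proj₂ y)) , [] , n , w , [] , [] , C , (if b then tally else blank) ∷ []) (concludeTime y)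
      (let y′ = if b then y₁ else y₀ in (letters (proj₁ y′) , unary (proj₂ y′)) , [] , n , w , [] , [] , C , (if b then tally else blank) ∷ [])
  conclude-answer (x , k) n w C b with clear-runs {S = • ⊗ •} (length x + k) {letters x , unary k}
     (≤-trans (≤-reflexive (length-map letter x)) (m≤m+n _ _) , ≤-trans (≤-reflexive (length-replicate k)) (m≤n+m _ _))
  ... | t , t≤ , cleared = _ , s≤s (+-mono-≤ t≤ (branch-≤ b)) ,
        ifte-false refl (Exec-lift inputPair clear ((letters x , unary k) , rest b) cleared then branch b)
    where
    rest : Bool → ⟦ Work ⟧ (List A)
    rest b = [] , n , w , [] , [] , C , (if b then tally else blank) ∷ []
    answered : Bool → Instance s
    answered b = if b then y₁ else y₀
    branch : ∀ b → Runs (ifte accepted (answer y₁) (answer y₀)) (([] , []) , rest b) (suc (answerTime (answered b)))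
                        ((letters (proj₁ (answered b)) , unary (proj₂ (answered b))) , rest b)
    branch true  = ifte-true refl (answer-runs y₁ (rest true))
    branch false = ifte-false refl (answer-runs y₀ (rest false))
    branch-≤ : ∀ b → suc (answerTime (answered b)) ≤ 1 + (answerTime y₁ + answerTime y₀)
    branch-≤ true  = s≤s (m≤m+n (answerTime y₁) (answerTime y₀))
    branch-≤ false = s≤s (m≤n+m (answerTime y₀) (answerTime y₁))

  open Compile (finite-Symbol s auxSymbols) (native s auxSymbols) (• ⊗ •) Work kernel (λ _ → true)
    using (machine; computes)

  private
    module _ (y : Instance s) {n : ℕ} {d : Config M} (run : Run M (initial M (encode y)) n d) {N w : List A}
             (lenw : length w ≡ suc (length (proj₁ y)) ^ suc c)
             (prepared : Runs prepare ((letters (proj₁ y) , unary (proj₂ y)) , spure Work []) (prepareTime y)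
                   ((letters (proj₁ y) , unary (proj₂ y)) , [] , N , w , [] , [] , loaded (proj₁ y) (proj₂ y) , [])) where
      C′ : ⟦ cells (2 + workTapes) ⟧ (List A)
      C′ = haltedCells (Config.tapes d)
      v  = verdict (Config.state d)
      simulated : Runs simulate (loaded (proj₁ y) (proj₂ y) , []) (2 + n) (C′ , v ∷ [])
      simulated = subst (λ C → Runs simulate (C , []) (2 + n) (C′ , v ∷ [])) (sym (loaded-input (proj₁ y) (proj₂ y))) (simulate-runs run [])
      σ : ⟦ S ⟧ (List A)
      σ = (letters (proj₁ y) , unary (proj₂ y)) , [] , N , w , [] , [] , loaded (proj₁ y) (proj₂ y) , []
      close : ∀ {y′ τ t σ₁} → t ≤ suc (length w) → Runs (lift timed (clock tally simulate)) σ t σ₁ →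
              RunsIn conclude σ₁ (concludeTime y) ((letters (proj₁ y′) , unary (proj₂ y′)) , τ) →
              ComputesWithin machine (kernelTime y * 2 + 1) (encode y) (encode y′)
      close {y′} {τ} {t} t≤ timed-run (t′ , t′≤ , concluded) = computes-cast (encode-native y) (encode-native y′)
        (computes {i = letters (proj₁ y) , unary (proj₂ y)} {o = letters (proj₁ y′) , unary (proj₂ y′)} {w = τ} (prepared then timed-run then concluded)
          le)
       where
        le : (prepareTime y + (t + t′)) * 2 + 1 ≤ kernelTime y * 2 + 1
        le = +-monoˡ-≤ 1 (*-monoˡ-≤ 2 (+-monoʳ-≤ (prepareTime y) (+-mono-≤ (≤-trans t≤ (s≤s (≤-reflexive lenw))) t′≤)))

      decided : ∀ {R : Set} b → (Holds b ⇔ R) → Outcome c y₁ y₀ R y n (if b then y₁ else y₀)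
      decided true  iff = inj₁ (refl , Equivalence.to iff tt)
      decided false iff = inj₂ (inj₁ (refl , Equivalence.from iff))

      finish : ∀ {R : Set} → (Holds (TM.accepting M (Config.state d)) ⇔ R) →
        Clocked tally simulate nothing (loaded (proj₁ y) (proj₂ y) , []) (2 + n) (C′ , v ∷ []) w [] →
        ∃[ y′ ] ComputesWithin machine (kernelTime y * 2 + 1) (encode y) (encode y′) × Outcome c y₁ y₀ R y n y′
      finish iff (inj₁ (t≤w , exec)) =
        _ , close {if TM.accepting M (Config.state d) then y₁ else y₀} (m≤n⇒m≤1+n t≤w) (Exec-lift timed (clock tally simulate) σ exec)
              (conclude-answer y N (List.drop (2 + n) w) C′ (TM.accepting M (Config.state d))) ,
        decided (TM.accepting M (Config.state d)) iff
      finish iff (inj₂ (w<t , (C″ , f) , exec)) =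
        y , close {y} ≤-refl (Exec-lift timed (clock tally simulate) σ exec) (conclude-late y _ N [] C″ f) ,
        inj₂ (inj₂ (refl , subst (_< 2 + n) lenw w<t))

  -- The time does not mention `n`: the clock cuts the simulation off, so the kernel is polynomial
  -- even if the simulated run is not.
  kernel-computes : ∀ {R : Set} y {n d} → Run M (initial M (encode y)) n d → (Holds (TM.accepting M (Config.state d)) ⇔ R) →
    ∃[ y′ ] ComputesWithin machine (kernelTime y * 2 + 1) (encode y) (encode y′) × Outcome c y₁ y₀ R y n y′
  kernel-computes (x , k) run iff =
    let N , w , lenw , prepared = prepare-runs x k in
    finish (x , k) run lenw prepared iff (clock-runs tally (simulated (x , k) run lenw prepared) w [])

  kernelTime-poly : Poly size (λ y → kernelTime y * 2 + 1)
  kernelTime-poly = Poly-+ {g = λ y → kernelTime y * 2} (Poly-* {g = kernelTime} total (Poly-const 2)) (Poly-const 1)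
    where
    X-poly : Poly size (λ y → length (letters {s} {auxSymbols} (proj₁ y)))
    X-poly = Poly-≤ (λ (x , k) → ≤-trans (≤-reflexive (length-map letter x)) (m≤m+n _ k)) Poly-weight
    K-poly : Poly size (λ y → length (unary {s} {auxSymbols} (proj₂ y)))
    K-poly = Poly-≤ (λ (x , k) → ≤-trans (≤-reflexive (length-replicate k)) (m≤n+m k _)) Poly-weight
    N-poly : Poly size (λ y → suc (length (replicate (length (letters {s} {auxSymbols} (proj₁ y))) (tally {s} {auxSymbols}))))
    N-poly = Poly-+ (Poly-const 1) (Poly-≤ (λ y → ≤-reflexive (length-replicate (length (letters {s} {auxSymbols} (proj₁ y))))) X-poly)
    2X-poly : Poly size (λ y → suc (length (letters {s} {auxSymbols} (proj₁ y))) + suc (length (letters {s} {auxSymbols} (proj₁ y))))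
    2X-poly = Poly-+ (Poly-+ (Poly-const 1) X-poly) (Poly-+ (Poly-const 1) X-poly)
    2K-poly : Poly size (λ y → suc (length (unary {s} {auxSymbols} (proj₂ y))) + suc (length (unary {s} {auxSymbols} (proj₂ y))))
    2K-poly = Poly-+ (Poly-+ (Poly-const 1) K-poly) (Poly-+ (Poly-const 1) K-poly)
    prepare-poly : Poly size prepareTime
    prepare-poly = Poly-+ 2X-poly (Poly-+ (Poly-const 2) (Poly-+ (Poly-const 2)
      (Poly-+ (Poly-power (suc c) N-poly (Poly-const 1)) (Poly-+ 2X-poly 2K-poly))))
    timer-poly : Poly size (λ y → suc (suc (length (proj₁ y)) ^ suc c))
    timer-poly = Poly-+ (Poly-const 1) (Poly-^ (Poly-+ (Poly-const 1) (Poly-≤ (λ (x , k) → m≤m+n _ k) Poly-weight)) (suc c))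
    conclude-poly : Poly size concludeTime
    conclude-poly = Poly-+ (Poly-const 1) (Poly-+ (Poly-+ (Poly-const 1) Poly-weight)
      (Poly-const (1 + (answerTime y₁ + answerTime y₀))))
    total : Poly size kernelTime
    total = Poly-+ prepare-poly (Poly-+ timer-poly conclude-poly)

untilBlank-letters : ∀ {s e} (x : List (Fin s)) → untilBlank (letters {s} {e} x) ≡ letters x
untilBlank-letters []      = refl
untilBlank-letters (i ∷ x) = cong (letter i ∷_) (untilBlank-letters x)

untilBlank-unary : ∀ {s e} k → untilBlank (unary {s} {e} k) ≡ unary k
untilBlank-unary zero    = refl
untilBlank-unary (suc k) = cong (tally ∷_) (untilBlank-unary k)

letters-injective : ∀ {s e} {x y : List (Fin s)} → letters {s} {e} x ≡ letters y → x ≡ y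
letters-injective = map-injective λ { refl → refl }

unary-injective : ∀ {s e} {j k} → unary {s} {e} j ≡ unary k → j ≡ k
unary-injective {j = j} {k} eq = trans (sym (length-replicate j)) (trans (cong length eq) (length-replicate k))

length-untilBlank : ∀ {s e} (w : List (Symbol s e)) → length (untilBlank w) ≤ length w
length-untilBlank []             = z≤n
length-untilBlank (blank ∷ w)    = z≤n
length-untilBlank (letter i ∷ w) = s≤s (length-untilBlank w)
length-untilBlank (tally ∷ w)    = s≤s (length-untilBlank w)
length-untilBlank (aux j ∷ w)    = s≤s (length-untilBlank w)

decides-cast : ∀ {s io} {M : TM s io} {b ws ws′ R} → ws ≡ ws′ → DecidesWithin M b ws R → DecidesWithin M b ws′ R
decides-cast refl d = d

decides-≤ : ∀ {s io} {M : TM s io} {b b′ ws R} → b ≤ b′ → DecidesWithin M b ws R → DecidesWithin M b′ ws R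
decides-≤ b≤b′ (n , d , n≤b , rest) = n , d , ≤-trans n≤b b≤b′ , rest

length-letters : ∀ {s e} (x : List (Fin s)) → length (letters {s} {e} x) ≡ length x
length-letters = length-map letter

length-unary : ∀ {s e} k → length (unary {s} {e} k) ≡ k
length-unary k = length-replicate k

module _ {A : Set} where

  copyTwice : Machine A (• ⊗ • ⊗ • ⊗ •)
  copyTwice = copy (λ a → push a , push a)

  copyTwice-runs : ∀ (w : List A) → Runs copyTwice (w , [] , [] , []) (suc (length w) + suc (length w)) (w , [] , w , w)
  copyTwice-runs w = recast refl (cong (λ u → w , [] , u) (twice w)) (copy-runs (λ a → push a , push a) w ([] , []))
    where
    twice : ∀ w → foldr (λ a → perform (• ⊗ •) (push a , push a)) ([] , []) w ≡ (w , w)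
    twice []      = refl
    twice (a ∷ w) = cong (perform (• ⊗ •) (push a , push a)) (twice w)

-- From a kernel to a relation

module Relate {s : ℕ} (K : TM s 2) (κ : Instance s → Instance s) where

  open TM K using (workTapes; auxSymbols)

  private
    A : Set
    A = Symbol s auxSymbols

  open Simulate {A} K (relabel id id) (unlabel just just) (unlabel-relabel (λ _ → refl) (λ _ → refl)) tally blank
    using (simulate; simulate-runs; haltedCells; inputCells; verdict)

  IO Work S : Shape
  IO = (• ⊗ •) ⊗ (• ⊗ •)
  Work = • ⊗ (• ⊗ • ⊗ • ⊗ •) ⊗ • ⊗ cells (2 + workTapes) ⊗ •
  S = IO ⊗ Work

  w₁ k₁ w₂ k₂ tmp a b c d found : Path S •
  w₁    = lft (lft (lft here))
  k₁    = lft (lft (rgt here))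
  w₂    = lft (rgt (lft here))
  k₂    = lft (rgt (rgt here))
  tmp   = rgt (lft here)
  a     = rgt (rgt (lft (lft here)))
  b     = rgt (rgt (lft (rgt (lft here))))
  c     = rgt (rgt (lft (rgt (rgt (lft here)))))
  d     = rgt (rgt (lft (rgt (rgt (rgt here)))))
  found = rgt (rgt (rgt (lft here)))

  sim : Path S (cells (2 + workTapes) ⊗ •)
  sim = rgt (rgt (rgt (rgt here)))

  wordTape paramTape : Path S •
  wordTape  = sim ▸ lft (lft (rgt here))
  paramTape = sim ▸ lft (rgt (lft (rgt here)))

  copyW₁ copyK₁ : Sel S (• ⊗ • ⊗ •)
  copyW₁ = w₁ & tmp & ⟨ a ⟩
  copyK₁ = k₁ & tmp & ⟨ c ⟩

  copyW₂ copyK₂ : Sel S (• ⊗ • ⊗ • ⊗ •)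
  copyW₂ = w₂ & tmp & b & ⟨ wordTape ⟩
  copyK₂ = k₂ & tmp & d & ⟨ paramTape ⟩

  inputs outputs : Sel S (• ⊗ • ⊗ • ⊗ • ⊗ •)
  inputs  = a & b & c & d & ⟨ found ⟩
  outputs = w₁ & wordTape & k₁ & paramTape & ⟨ found ⟩

  -- Comparison consumes its words. The first one, of y with z, works on copies; the second, of y
  -- with the output of the kernel on z, uses up the originals of y. Both report on the same stack,
  -- which is therefore nonempty exactly if one of them succeeds.
  prepare relate : Machine A S
  prepare = lift copyW₁ (copy push) ⨾ lift copyK₁ (copy push) ⨾ lift copyW₂ copyTwice ⨾ lift copyK₂ copyTwice
  relate = prepare ⨾ lift inputs matchPairs ⨾ lift ⟨ sim ⟩ simulate ⨾ lift outputs matchPairs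

  loaded : List A → List A → ⟦ cells (2 + workTapes) ⟧ (List A)
  loaded X K = ([] , X) , ([] , K) , spure (cells workTapes) []

  loaded-input : ∀ x k → loaded (letters x) (unary k) ≡ inputCells {n = workTapes} (encode (x , k))
  loaded-input x k = cong₂ (λ u v → ([] , u) , ([] , v) , spure (cells workTapes) []) (sym (relabel-letters id x)) (sym (relabel-tallies id id k))

  module _ (X₁ K₁ X₂ K₂ : List A) where

    prepareTime : ℕ
    prepareTime = twice X₁ + (twice K₁ + (twice X₂ + twice K₂))
      where
      twice : List A → ℕ
      twice w = suc (length w) + suc (length w)

    io : ⟦ IO ⟧ (List A)
    io = (X₁ , K₁) , (X₂ , K₂)

    prepare-runs : Runs prepare (io , spure Work []) prepareTime
                                (io , [] , (X₁ , X₂ , K₁ , K₂) , [] , loaded X₂ K₂ , [])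
    prepare-runs =
      Exec-lift copyW₁ (copy push) (io , spure Work []) (copy-word X₁)
      then Exec-lift copyK₁ (copy push) (io , [] , (X₁ , [] , [] , []) , [] , loaded [] [] , []) (copy-word K₁)
      then Exec-lift copyW₂ copyTwice (io , [] , (X₁ , [] , K₁ , []) , [] , loaded [] [] , []) (copyTwice-runs X₂)
      then Exec-lift copyK₂ copyTwice (io , [] , (X₁ , X₂ , K₁ , []) , [] , loaded X₂ [] , []) (copyTwice-runs K₂)

  verdictOf : ⟦ S ⟧ (Maybe A) → Bool
  verdictOf h = is-just (getP found h)

  open Compile (finite-Symbol s auxSymbols) (native s auxSymbols) IO Work relate verdictOf
    using (machine; decides)

  matchTime : Instance s → ℕ
  matchTime (x , k) = suc (length (letters {s} {auxSymbols} x) + length (unary {s} {auxSymbols} k))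

  -- Both comparisons are charged to y, whose words they exhaust; the contents of the tapes on which
  -- the kernel halts need not be measured.
  relateTime : ℕ → Instance s → Instance s → ℕ
  relateTime n y z = prepareTime (letters (proj₁ y)) (unary (proj₂ y)) (letters (proj₁ z)) (unary (proj₂ z))
                   + (matchTime y + ((2 + n) + matchTime y))

  read-output : ∀ (t : Tape s auxSymbols) {v} → contents t ≡ v →
                untilBlank (List.map (relabel id id) (Tape.head t ∷ Tape.rights t)) ≡ List.map (relabel id id) v
  read-output t eq = trans (relabel-untilBlank id id (Tape.head t ∷ Tape.rights t)) (cong (List.map (relabel id id)) eq)

  encode-io : ∀ (y z : Instance s) →
    toVec IO (smap (List.map (Coding.enc (native s auxSymbols))) IO (io (letters (proj₁ y)) (unary (proj₂ y)) (letters (proj₁ z)) (unary (proj₂ z))))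
    ≡ encode y Vec.++ encode z
  encode-io y z = cong₂ Vec._++_ (encode-native {e = auxSymbols} y) (encode-native z)

  same-instance : ∀ (y : Instance s) {b d : List A} z → untilBlank b ≡ letters (proj₁ z) → untilBlank d ≡ unary (proj₂ z) →
                  Same (letters (proj₁ y)) b (unary (proj₂ y)) d ⇔ (y ≡ z)
  same-instance (x , k) (x′ , k′) eb ed = mk⇔
    (λ (e , e′) → cong₂ _,_ (letters-injective (trans (sym (untilBlank-letters x)) (trans e eb)))
                            (unary-injective (trans (sym (untilBlank-unary k)) (trans e′ ed))))
    λ { refl → trans (untilBlank-letters x) (sym eb) , trans (untilBlank-unary k) (sym ed) }

  matched⇔ : ∀ {a b c d a′ b′ c′ d′ f f′ : List A} {P Q : Set} →
    Matched a b c d [] f → Matched a′ b′ c′ d′ f f′ → Same a b c d ⇔ P → Same a′ b′ c′ d′ ⇔ Q →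
    Holds (is-just (List.head f′)) ⇔ (P ⊎ Q)
  matched⇔ (inj₁ (refl , p))  (inj₁ (refl , q))  i j = mk⇔ (λ _ → inj₁ (Equivalence.to i p)) (λ _ → tt)
  matched⇔ (inj₁ (refl , p))  (inj₂ (refl , ¬q)) i j = mk⇔ (λ _ → inj₁ (Equivalence.to i p)) (λ _ → tt)
  matched⇔ (inj₂ (refl , ¬p)) (inj₁ (refl , q))  i j = mk⇔ (λ _ → inj₂ (Equivalence.to j q)) (λ _ → tt)
  matched⇔ (inj₂ (refl , ¬p)) (inj₂ (refl , ¬q)) i j =
    mk⇔ (λ ()) [ (λ p → ¬p (Equivalence.from i p)) , (λ q → ¬q (Equivalence.from j q)) ]′

  module _ (y z : Instance s) {n : ℕ} {d : Config K} {t₁ t₂ : Tape s auxSymbols} {ts : Vec (Tape s auxSymbols) workTapes}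
           (run : Run K (initial K (encode z)) n d)
           (tapes-d : Config.tapes d ≡ t₁ ∷ t₂ ∷ ts)
           (out₁ : contents t₁ ≡ letters (proj₁ (κ z))) (out₂ : contents t₂ ≡ unary (proj₂ (κ z))) where

    private
      X₁ K₁ X₂ K₂ : List A
      X₁ = letters (proj₁ y)
      K₁ = unary (proj₂ y)
      X₂ = letters (proj₁ z)
      K₂ = unary (proj₂ z)
      v : A
      v = verdict (Config.state d)
      B D : List A
      B = List.map (relabel id id) (Tape.head t₁ ∷ Tape.rights t₁)
      D = List.map (relabel id id) (Tape.head t₂ ∷ Tape.rights t₂)

      simulated : Runs simulate (loaded X₂ K₂ , []) (2 + n) (haltedCells (t₁ ∷ t₂ ∷ ts) , v ∷ [])
      simulated = subst₂ (λ C ts → Runs simulate (C , []) (2 + n) (haltedCells ts , v ∷ []))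
        (sym (loaded-input (proj₁ z) (proj₂ z))) tapes-d (simulate-runs run [])

    private
      final : (a₁ b₁ c₁ d₁ a₂ b₂ c₂ d₂ f : List A) → ⟦ S ⟧ (List A)
      final a₁ b₁ c₁ d₁ a₂ b₂ c₂ d₂ f = ((a₂ , c₂) , (X₂ , K₂)) , [] , (a₁ , b₁ , c₁ , d₁) , f ,
        ((List.map (relabel id id) (Tape.lefts t₁) , b₂) , (List.map (relabel id id) (Tape.lefts t₂) , d₂) , haltedCells ts) , v ∷ []

    relate-runs : ∀ {m₁ m₂ a₁ b₁ c₁ d₁ f₁ a₂ b₂ c₂ d₂ f₂} →
      Runs matchPairs (X₁ , X₂ , K₁ , K₂ , []) m₁ (a₁ , b₁ , c₁ , d₁ , f₁) →
      Runs matchPairs (X₁ , B , K₁ , D , f₁) m₂ (a₂ , b₂ , c₂ , d₂ , f₂) →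
      Runs relate (io X₁ K₁ X₂ K₂ , spure Work []) (prepareTime X₁ K₁ X₂ K₂ + (m₁ + ((2 + n) + m₂)))
           (final a₁ b₁ c₁ d₁ a₂ b₂ c₂ d₂ f₂)
    relate-runs {a₁ = a₁} {b₁} {c₁} {d₁} {f₁} exec₁ exec₂ =
      prepare-runs X₁ K₁ X₂ K₂
      then Exec-lift inputs matchPairs (io X₁ K₁ X₂ K₂ , [] , (X₁ , X₂ , K₁ , K₂) , [] , loaded X₂ K₂ , []) exec₁
      then Exec-lift ⟨ sim ⟩ simulate (io X₁ K₁ X₂ K₂ , [] , (a₁ , b₁ , c₁ , d₁) , f₁ , loaded X₂ K₂ , []) simulated
      then Exec-lift outputs matchPairs (io X₁ K₁ X₂ K₂ , [] , (a₁ , b₁ , c₁ , d₁) , f₁ , haltedCells (t₁ ∷ t₂ ∷ ts) , v ∷ []) exec₂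

    relate-decides : DecidesWithin machine (relateTime n y z * 2 + 1) (encode y Vec.++ encode z) (y ≡ z ⊎ y ≡ κ z)
    relate-decides =
      let a₁ , b₁ , c₁ , d₁ , f₁ , (m₁ , m₁≤ , exec₁) , matched₁ = matchPairs-runs (length X₁ + length K₁) X₁ X₂ K₁ K₂ [] ≤-refl
          a₂ , b₂ , c₂ , d₂ , f₂ , (m₂ , m₂≤ , exec₂) , matched₂ = matchPairs-runs (length X₁ + length K₁) X₁ B K₁ D f₁ ≤-refl
      in decides-cast {M = machine} (encode-io y z) (decides {i = io X₁ K₁ X₂ K₂} {σ′ = final a₁ b₁ c₁ d₁ a₂ b₂ c₂ d₂ f₂}
        (relate-runs exec₁ exec₂)
        (+-monoˡ-≤ 1 (*-monoˡ-≤ 2 (+-monoʳ-≤ (prepareTime X₁ K₁ X₂ K₂) (+-mono-≤ m₁≤ (+-monoʳ-≤ (2 + n) m₂≤)))))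
        (matched⇔ {a = X₁} {X₂} {K₁} {K₂} {X₁} {B} {K₁} {D} matched₁ matched₂
          (same-instance y z (untilBlank-letters (proj₁ z)) (untilBlank-unary (proj₂ z)))
          (same-instance y (κ z) (trans (read-output t₁ out₁) (relabel-letters id (proj₁ (κ z))))
                                 (trans (read-output t₂ out₂) (relabel-tallies id id (proj₂ (κ z)))))))

  relate-polynomial : ∀ {c} → (∀ y → ComputesWithin K (polynomial {s} c (size y)) (encode y) (encode (κ y))) →
                      PolynomialTime (λ y z → y ≡ z ⊎ y ≡ κ z)
  relate-polynomial {c} computes-κ = machine , proj₁ bound , λ y z →
    decides-≤ {M = machine} {ws = encode y Vec.++ encode z} (proj₂ bound (y , z)) (decided y z (computes-κ z))
    where
    W : Instance s × Instance s → ℕ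
    W (y , z) = size y + size z
    T : Instance s → ℕ
    T z = polynomial {s} c (size z)
    decided : ∀ y z → ComputesWithin K (T z) (encode z) (encode (κ z)) →
              DecidesWithin machine (relateTime (T z) y z * 2 + 1) (encode y Vec.++ encode z) (y ≡ z ⊎ y ≡ κ z)
    decided y z (n , d@(config q (t₁ ∷ t₂ ∷ ts)) , n≤ , run , out) =
      decides-≤ {M = machine} {ws = encode y Vec.++ encode z} (+-monoˡ-≤ 1 (*-monoˡ-≤ 2 (+-monoʳ-≤ (prepareTime (letters (proj₁ y)) (unary (proj₂ y)) (letters (proj₁ z)) (unary (proj₂ z))) (+-monoʳ-≤ (matchTime y) (+-monoˡ-≤ (matchTime y) (+-monoʳ-≤ 2 n≤))))))
        (relate-decides y z run refl (Vec.∷-injectiveˡ out) (Vec.∷-injectiveˡ (Vec.∷-injectiveʳ out)))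
    side : ∀ {g : Instance s → ℕ} (p : Instance s × Instance s → Instance s) → (∀ yz → size (p yz) ≤ W yz) → (∀ y → g y ≤ size y) → Poly W (g ∘ p)
    side p p≤ g≤ = Poly-≤ (λ yz → ≤-trans (g≤ (p yz)) (p≤ yz)) Poly-weight
    len-x : ∀ y → length (letters {s} {auxSymbols} (proj₁ y)) ≤ size y
    len-x (x , k) = ≤-trans (≤-reflexive (length-letters x)) (m≤m+n _ _)
    len-k : ∀ y → length (unary {s} {auxSymbols} (proj₂ y)) ≤ size y
    len-k (x , k) = ≤-trans (≤-reflexive (length-unary {s} {auxSymbols} k)) (m≤n+m _ _)
    left≤ : ∀ yz → size (proj₁ yz) ≤ W yz
    left≤ (y , z) = m≤m+n _ _
    right≤ : ∀ yz → size (proj₂ yz) ≤ W yz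
    right≤ (y , z) = m≤n+m (size z) (size y)
    double : ∀ {g : Instance s × Instance s → ℕ} → Poly W g → Poly W (λ i → suc (g i) + suc (g i))
    double p = Poly-+ (Poly-+ (Poly-const 1) p) (Poly-+ (Poly-const 1) p)
    match-poly : Poly W (matchTime ∘ proj₁)
    match-poly = Poly-+ (Poly-const 1) (Poly-+ (side proj₁ left≤ len-x) (side proj₁ left≤ len-k))
    time-poly : Poly W (λ (y , z) → relateTime (T z) y z)
    time-poly = Poly-+ (Poly-+ (double (side proj₁ left≤ len-x)) (Poly-+ (double (side proj₁ left≤ len-k)) (Poly-+ (double (side proj₂ right≤ len-x)) (double (side proj₂ right≤ len-k)))))
      (Poly-+ match-poly (Poly-+ (Poly-+ (Poly-const 2) (Poly-polynomial {s = s} (side proj₂ right≤ (λ _ → ≤-refl)) c)) match-poly))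
    bound : ∃[ b ] (∀ yz → relateTime (T (proj₂ yz)) (proj₁ yz) (proj₂ yz) * 2 + 1 ≤ polynomial {s} b (W yz))
    bound = Poly⇒polynomial {s = s} (Poly-+ {g = λ (y , z) → relateTime (T z) y z * 2} (Poly-* time-poly (Poly-const 2)) (Poly-const 1))

-- Computable bounds on running times and kernel sizes

power≤time : ∀ c n m → m * n ^ suc c ≤ powerTime (suc c) n m
power≤time zero n m = begin
  m * (n * 1)           ≡⟨ cong (m *_) (*-identityʳ n) ⟩
  m * n                 ≤⟨ n≤1+n _ ⟩
  suc (m * n)           ≤⟨ m≤n+m (suc (m * n)) (m * (2 + (suc n + suc n)) + 1) ⟩
  multiplyTime n m      ≤⟨ m≤m+n (multiplyTime n m) 1 ⟩
  multiplyTime n m + 1  ∎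
  where open ≤-Reasoning
power≤time (suc c) n m = begin
  m * (n * n ^ suc c)                               ≡⟨ *-assoc m n _ ⟨
  m * n * n ^ suc c                                 ≤⟨ power≤time c n (m * n) ⟩
  powerTime (suc c) n (m * n)                       ≤⟨ m≤n+m (powerTime (suc c) n (m * n)) (multiplyTime n m) ⟩
  multiplyTime n m + powerTime (suc c) n (m * n)    ∎
  where open ≤-Reasoning

-- A computable bound on the time t of B is the time of a machine that counts
-- the steps of B and then raises the count to a power.

module Dominate {s e : ℕ} (T : Shape) (input : Path T •) (B : Machine (Symbol s e) T) (a c : ℕ) where

  private
    A : Set
    A = Symbol s e

    T′ S : Shape
    T′ = T ⊗ • ⊗ • ⊗ • ⊗ •
    S  = • ⊗ T′

    tmp count result spare : Path T′ •
    tmp    = rgt (lft here)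
    count  = rgt (rgt (lft here))
    result = rgt (rgt (rgt (lft here)))
    spare  = rgt (rgt (rgt (rgt here)))

    counted : Sel T′ (T ⊗ •)
    counted = lft here & ⟨ count ⟩

    powering : Sel T′ (• ⊗ • ⊗ • ⊗ •)
    powering = count & tmp & result & ⟨ spare ⟩

    distribute : Sel S (• ⊗ • ⊗ •)
    distribute = lft here & rgt (lft input) & ⟨ rgt count ⟩

    ticking : Sel S (T′ ⊗ •)
    ticking = rgt here & ⟨ lft here ⟩

    main : Machine A T′
    main = lift counted (tick tally B) ⨾ lift ⟨ count ⟩ (pushes (replicate a tally))
         ⨾ lift ⟨ result ⟩ (pushes (tally ∷ [])) ⨾ lift powering (power (suc c))

    whole : Machine A S
    whole = lift distribute (pour (λ _ → push tally , push tally)) ⨾ lift ticking (tick tally main)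

    start-T : ℕ → ⟦ T ⟧ (List A)
    start-T k = putP input (unary k) (spure T [])

    two-copies : ∀ k u v → foldl (λ τ c → perform (• ⊗ •) (push tally , push tally) τ) (u , v) (unary {s} {e} k) ≡ (unary k ++ u , unary k ++ v)
    two-copies zero    u v = refl
    two-copies (suc k) u v = trans (two-copies k (tally ∷ u) (tally ∷ v)) (cong₂ _,_ (shuffle k u) (shuffle k v))
      where
      shuffle : ∀ k (u : List A) → unary k ++ tally ∷ u ≡ tally ∷ unary k ++ u
      shuffle zero    u = refl
      shuffle (suc k) u = cong (tally ∷_) (shuffle k u)

  module _ (t : ℕ → ℕ) (final : ℕ → ⟦ T ⟧ (List A))
           (B-runs : ∀ k → Runs B (putP input (unary k) (spure T [])) (t k) (final k)) where

    private
      N : ℕ → List A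
      N k = replicate a tally ++ replicate (t k) tally ++ unary k

      length-N : ∀ k → length (N k) ≡ a + (t k + k)
      length-N k = trans (length-++ (replicate a tally)) (cong₂ _+_ (length-replicate a)
        (trans (length-++ (replicate (t k) tally)) (cong₂ _+_ (length-replicate (t k)) (length-unary {s} {e} k))))

      time : ℕ → ℕ
      time k = t k + (suc (length (replicate a (tally {s} {e}))) + (2 + powerTime (suc c) (length (N k)) 1))

      main-runs : ∀ k → ∃[ w ] Runs main (start-T k , [] , unary k , [] , []) (time k) (final k , [] , N k , w , [])
      main-runs k = let w , _ , powered = power-runs (suc c) (N k) (tally ∷ []) in w ,
        (Exec-lift counted (tick tally B) (start-T k , [] , unary k , [] , []) (tick-runs tally (B-runs k) (unary k))
        then Exec-lift ⟨ count ⟩ (pushes (replicate a tally)) (final k , [] , replicate (t k) tally ++ unary k , [] , []) (pushes-runs (replicate a tally) _)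
        then Exec-lift ⟨ result ⟩ (pushes (tally ∷ [])) (final k , [] , N k , [] , []) (pushes-runs (tally ∷ []) [])
        then Exec-lift powering (power (suc c)) (final k , [] , N k , tally ∷ [] , []) powered)

      distributed : ∀ k → Runs (lift distribute (pour (λ _ → push tally , push tally))) (unary k , spure T′ []) (suc (length (unary {s} {e} k)))
                               ([] , start-T k , [] , unary k , [] , [])
      distributed k = subst₂ (λ σ σ′ → Runs (lift distribute (pour (λ _ → push tally , push tally))) σ (suc (length (unary {s} {e} k))) σ′)
        (cong (λ τ → unary k , τ , [] , [] , [] , []) putP-empty)
        (cong₂ (λ u v → [] , putP input u (spure T []) , [] , v , [] , []) (cong proj₁ copies) (cong proj₂ copies))
        (Exec-lift distribute (pour (λ _ → push tally , push tally)) (unary k , spure T′ []) (pour-runs (λ _ → push tally , push tally) (unary k) ([] , [])))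
        where
        putP-self : ∀ {T} (p : Path T •) → putP p ([] {A = A}) (spure T []) ≡ spure T []
        putP-self here    = refl
        putP-self (lft p) = cong (_, _) (putP-self p)
        putP-self (rgt p) = cong (_ ,_) (putP-self p)
        putP-empty = putP-self input
        copies = trans (two-copies k [] []) (cong₂ _,_ (++-identityʳ (unary k)) (++-identityʳ (unary k)))

      whole-runs : ∀ k → ∃[ τ ] Runs whole (unary k , spure T′ []) (suc (length (unary {s} {e} k)) + time k) (unary (time k) , τ)
      whole-runs k = let w , ran = main-runs k in (final k , [] , N k , w , []) ,
        (distributed k then recast refl (cong (_, (final k , [] , N k , w , [])) (++-identityʳ (unary (time k))))
          (Exec-lift ticking (tick tally main) ([] , start-T k , [] , unary k , [] , []) (tick-runs tally ran [])))

      encode-unary : ∀ k → List.map (Coding.enc (letterless s e)) (unary k) ≡ unary k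
      encode-unary zero    = refl
      encode-unary (suc k) = cong (tally ∷_) (encode-unary k)

    open Compile (finite-Symbol s e) (letterless s e) • T′ whole (λ _ → true) using (machine; computes)

    -- There are two counters. The inner one starts at k and receives the steps of `B` and then `a`
    -- more tallies, so its length is a + (t k + k). The outer one writes down the time of the whole
    -- of `main`, and this is at least the desired power because `power` has to produce its value in
    -- unary.
    dominate : ∃[ g ] Computable g × (∀ k → (a + (t k + k)) ^ suc c ≤ g k)
    dominate = time , (machine , λ k → let τ , ran = whole-runs k in
                 _ , computes-cast {M = machine} (cong (_∷ []) (encode-unary k)) (cong (_∷ []) (encode-unary (time k)))
                       (computes {i = unary k} {o = unary (time k)} ran ≤-refl))
             , λ k → begin
                 (a + (t k + k)) ^ suc c                 ≡⟨ cong (_^ suc c) (length-N k) ⟨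
                 length (N k) ^ suc c                    ≡⟨ *-identityˡ _ ⟨
                 1 * length (N k) ^ suc c                ≤⟨ power≤time c (length (N k)) 1 ⟩
                 powerTime (suc c) (length (N k)) 1      ≤⟨ m≤n+m (powerTime (suc c) (length (N k)) 1) 2 ⟩
                 2 + powerTime (suc c) (length (N k)) 1  ≤⟨ m≤n+m _ (suc (length (replicate a (tally {s} {e})))) ⟩
                 suc (length (replicate a (tally {s} {e}))) + (2 + powerTime (suc c) (length (N k)) 1)
                                                         ≤⟨ m≤n+m _ (t k) ⟩
                 time k                                  ∎
      where open ≤-Reasoning

-- The number m is the time of simulating the machine for `f` on k, plus k: no tape can hold a
-- longer word by then, so m bounds the value `f k` as well as k.
Computable-bound : ∀ {f} → Computable f → ∀ a c → ∃[ g ] Computable g × (∀ k → ∃[ m ] k ≤ m × f k ≤ m × (a + m) ^ suc c ≤ g k)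
Computable-bound {f} (F , F-computes) a c =
  let g , g-computable , bound = dominate time final runs in
  g , g-computable , λ k → time k + k , m≤n+m k (time k) , value-≤ k , bound k
  where
  open TM F using (workTapes; auxSymbols)
  A : Set
  A = Symbol 0 auxSymbols
  open Simulate {A} F (relabel id id) (unlabel just just) (unlabel-relabel (λ _ → refl) (λ _ → refl)) tally blank
    using (S; simulate; simulate-runs; haltedCells; inputCells; verdict)
  input : Path S •
  input = lft (lft (rgt here))
  open Dominate {0} {auxSymbols} S input simulate a c using (dominate)
  steps time : ℕ → ℕ
  steps k = proj₁ (proj₂ (F-computes k))
  time k = 2 + steps k
  last : ∀ k → Config F
  last k = proj₁ (proj₂ (proj₂ (F-computes k)))
  final : ℕ → ⟦ S ⟧ (List A)
  final k = haltedCells (Config.tapes (last k)) , verdict (Config.state (last k)) ∷ []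
  runs : ∀ k → Runs simulate (putP input (unary k) (spure S [])) (time k) (final k)
  runs k = let _ , _ , _ , _ , run , _ = F-computes k in
    subst (λ u → Runs simulate ((([] , u) , spure (cells workTapes) []) , []) (time k) (final k)) (relabel-tallies id id k) (simulate-runs run [])
  bounded : ∀ k → Bounded (time k + k) S (final k)
  bounded k = Exec-Bounded (runs k) (((z≤n , ≤-reflexive (length-unary {0} {auxSymbols} k)) , Bounded-empty k (cells workTapes)) , z≤n)
  value-≤ : ∀ k → f k ≤ time k + k
  value-≤ k with last k | bounded k | proj₂ (proj₂ (proj₂ (proj₂ (F-computes k))))
  ... | config q (tape ls h rs ∷ ts) | ((_ , b) , _) , _ | _ , out = begin
    f k                                      ≡⟨ length-replicate (f k) ⟨
    length (unary {0} {auxSymbols} (f k))    ≡⟨ cong length (Vec.∷-injectiveˡ out) ⟨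
    length (untilBlank (h ∷ rs))             ≤⟨ length-untilBlank (h ∷ rs) ⟩
    length (h ∷ rs)                          ≡⟨ length-map (relabel id id) (h ∷ rs) ⟨
    length (List.map (relabel id id) (h ∷ rs)) ≤⟨ b ⟩
    time k + k                               ∎
    where open ≤-Reasoning

-- With L = l + 1, lateness gives L ^ (c + 1) < 2 + f L ^ c ≤ (2 + f) L ^ c. Cancelling L ^ c leaves
-- L < 2 + f. The timer has one factor L more than the budget precisely for this cancellation.
late⇒short : ∀ c f l n → n ≤ f * (1 ⊔ l) ^ c → suc l ^ suc c < 2 + n → l ≤ f
late⇒short c f l n n≤ late = s≤s⁻¹ (s≤s⁻¹ (*-cancelʳ-< (suc l ^ c) (suc l) (2 + f) (begin-strict
  suc l * suc l ^ c                      <⟨ late ⟩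
  2 + n                                  ≤⟨ +-monoʳ-≤ 2 n≤ ⟩
  2 + f * (1 ⊔ l) ^ c                    ≤⟨ +-mono-≤ (*-monoʳ-≤ 2 (m^n>0 (suc l) c)) (*-monoʳ-≤ f (^-monoˡ-≤ c (⊔-lub (s≤s z≤n) (n≤1+n l)))) ⟩
  2 * suc l ^ c + f * suc l ^ c          ≡⟨ *-distribʳ-+ (suc l ^ c) 2 f ⟨
  (2 + f) * suc l ^ c                    ∎)))
  where open ≤-Reasoning

-- If nothing satisfies `P`, the instance returned is a dummy, and the conclusion holds because its
-- premise never does. So constant or empty problems need no separate treatment in the kernel.
sample : ∀ {s} → ExcludedMiddle 0ℓ → (P : Instance s → Set) → ∃[ y ] (∀ z → P z → P y)
sample em P with em {P = ∃[ z ] P z}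
... | yes (y , p) = y , λ _ _ → p
... | no ¬∃       = ([] , 0) , λ z p → ⊥-elim (¬∃ (z , p))

-- Idempotent kernels and their quasi-orders

IdempotentKernel : ∀ {s} → ParameterizedProblem s → (ℕ → ℕ) → Set
IdempotentKernel Q g = Σ[ (_ , κ , _) ∈ HasKernelOfSize Q g ] (∀ y → κ (κ y) ≡ κ y)

module _ {s : ℕ} {Q : ParameterizedProblem s} where

  module Outcomes (y₁ y₀ : Instance s) (yes-sample : ∀ y → Q y → Q y₁) (no-sample : ∀ y → ¬ Q y → ¬ Q y₀)
                  (c : ℕ) (n : Instance s → ℕ) {κ : Instance s → Instance s}
                  (outcome : ∀ y → Outcome c y₁ y₀ (Q y) y (n y) (κ y)) where

    κ-correct : ∀ y → Q y ⇔ Q (κ y)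
    κ-correct y with κ y | outcome y
    ... | _ | inj₁ (refl , q)         = mk⇔ (yes-sample y) (λ _ → q)
    ... | _ | inj₂ (inj₁ (refl , ¬q)) = mk⇔ (λ q → ⊥-elim (¬q q)) (λ q₀ → ⊥-elim (no-sample y ¬q q₀))
    ... | _ | inj₂ (inj₂ (refl , _))  = mk⇔ id id

    -- A late instance is its own image. Otherwise the image is a sample with the same answer as y;
    -- on that sample κ can report this answer or be late, and both give the sample back, while the
    -- opposite answer would be wrong.
    κ-idempotent : ∀ y → κ (κ y) ≡ κ y
    κ-idempotent y with outcome y
    ... | inj₂ (inj₂ (e , _)) = cong κ e
    ... | inj₁ (e , q) rewrite e with outcome y₁
    ...   | inj₁ (e′ , _)         = e′
    ...   | inj₂ (inj₁ (_ , ¬q))  = ⊥-elim (¬q (yes-sample y q))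
    ...   | inj₂ (inj₂ (e′ , _))  = e′
    κ-idempotent y | inj₂ (inj₁ (e , ¬q)) rewrite e with outcome y₀
    ...   | inj₁ (_ , q)          = ⊥-elim (no-sample y ¬q q)
    ...   | inj₂ (inj₁ (e′ , _))  = e′
    ...   | inj₂ (inj₂ (e′ , _))  = e′

    -- Write B for 2 plus the sizes of the samples plus m. A late instance has |x| ≤ f k ≤ m and k ≤
    -- m, hence size at most 2 B, and the samples are below that too. As B is at least 2, the square
    -- of B is enough.
    κ-small : (f g : ℕ → ℕ) → (∀ k → ∃[ m ] k ≤ m × f k ≤ m × (2 + (size y₁ + size y₀) + m) ^ 2 ≤ g k) →
              (∀ y → n y ≤ f (proj₂ y) * (1 ⊔ length (proj₁ y)) ^ c) → ∀ y → size (κ y) ≤ g (proj₂ y)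
    κ-small f g dominated n≤ (x , k) = let m , k≤m , fk≤m , ≤g = dominated k in
      ≤-trans (small m k≤m fk≤m (κ (x , k)) (outcome (x , k))) ≤g
      where
      a = 2 + (size y₁ + size y₀)
      small : ∀ m → k ≤ m → f k ≤ m → ∀ y′ → Outcome c y₁ y₀ (Q (x , k)) (x , k) (n (x , k)) y′ → size y′ ≤ (a + m) ^ 2
      small m k≤m fk≤m y′ o = ≤-trans (half y′ o) twice
        where
        B = a + m
        twice : B + B ≤ B ^ 2
        twice = begin
          B + B        ≡⟨ cong (B +_) (+-identityʳ B) ⟨
          2 * B        ≤⟨ *-monoˡ-≤ B (≤-trans (m≤m+n 2 (size y₁ + size y₀)) (m≤m+n a m)) ⟩
          B * B        ≡⟨ cong (B *_) (*-identityʳ B) ⟨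
          B ^ 2        ∎
          where open ≤-Reasoning
        a≤ : size y₁ + size y₀ ≤ B + B
        a≤ = ≤-trans (m≤n+m (size y₁ + size y₀) 2) (≤-trans (m≤m+n a m) (m≤m+n B B))
        half : ∀ y′ → Outcome c y₁ y₀ (Q (x , k)) (x , k) (n (x , k)) y′ → size y′ ≤ B + B
        half _ (inj₁ (refl , _))           = ≤-trans (m≤m+n (size y₁) (size y₀)) a≤
        half _ (inj₂ (inj₁ (refl , _)))    = ≤-trans (m≤n+m (size y₀) (size y₁)) a≤
        half _ (inj₂ (inj₂ (refl , late))) = +-mono-≤
          (≤-trans (late⇒short c (f k) (length x) (n (x , k)) (n≤ (x , k)) late) (≤-trans fk≤m (m≤n+m m a)))
          (≤-trans k≤m (m≤n+m m a))

  tractable⇒kernel : ExcludedMiddle 0ℓ → FixedParameterTractable Q → ∃[ g ] Computable g × IdempotentKernel Q g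
  tractable⇒kernel em (M , f , c , f-computable , M-decides) =
    let y₁ , yes-sample = sample em Q
        y₀ , no-sample = sample em (λ y → ¬ Q y)
        g , g-computable , dominated = Computable-bound f-computable (2 + (size y₁ + size y₀)) 1
        open Outcomes y₁ y₀ yes-sample no-sample c n {κ y₁ y₀} (outcome y₁ y₀)
    in g , g-computable
       , (machine y₁ y₀ , κ y₁ y₀ , proj₁ (bound y₁ y₀) , λ y → κ-computes y₁ y₀ y , κ-small f g dominated n≤ y , κ-correct y)
       , κ-idempotent
    where
    n : Instance s → ℕ
    n (x , k) = proj₁ (M-decides x k)
    n≤ : ∀ y → n y ≤ f (proj₂ y) * (1 ⊔ length (proj₁ y)) ^ c
    n≤ (x , k) = proj₁ (proj₂ (proj₂ (M-decides x k)))
    module _ (y₁ y₀ : Instance s) where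
      open Kernelize M c y₁ y₀ using (kernel-computes; kernelTime; kernelTime-poly; Work; kernel)
      open Compile (finite-Symbol s (TM.auxSymbols M)) (native s (TM.auxSymbols M)) (• ⊗ •) Work kernel (λ _ → true) using (machine) public
      abstract
        bound : ∃[ b ] (∀ y → kernelTime y * 2 + 1 ≤ polynomial {s} b (size y))
        bound = Poly⇒polynomial {s = s} kernelTime-poly
        result : ∀ y → ∃[ y′ ] ComputesWithin machine (polynomial {s} (proj₁ bound) (size y)) (encode y) (encode y′)
                             × Outcome c y₁ y₀ (Q y) y (n y) y′
        result y@(x , k) = let _ , _ , _ , run , iff = M-decides x k
                               y′ , (t , d , t≤ , rest) , out = kernel-computes y run iff
                           in y′ , (t , d , ≤-trans t≤ (proj₂ bound y) , rest) , out
      κ : Instance s → Instance s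
      κ y = proj₁ (result y)
      outcome : ∀ y → Outcome c y₁ y₀ (Q y) y (n y) (κ y)
      outcome y = proj₂ (proj₂ (result y))
      κ-computes : ∀ y → ComputesWithin machine (polynomial {s} (proj₁ bound) (size y)) (encode y) (encode (κ y))
      κ-computes y = proj₁ (proj₂ (result y))

  tractable⇒decidable : FixedParameterTractable Q → Decidable Q
  tractable⇒decidable (M , _ , _ , _ , M-decides) = M , λ (x , k) → _ , M-decides x k

  Ordered : (ℕ → ℕ) → Set₁
  Ordered f = Σ[ _≼_ ∈ Rel (Instance s) 0ℓ ] (QuasiOrder _≼_ × PolynomialTime _≼_ × LowerIdeal _≼_ Q × ObstructionsOfSize _≼_ Q f)

  kernel⇒order : ∀ {f} → IdempotentKernel Q f → Ordered f
  kernel⇒order {f} ((K , κ , c , props) , idem) = (λ y z → y ≡ z ⊎ y ≡ κ z)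
    , record { isEquivalence = isEquivalence ; reflexive = inj₁ ; trans = transitive }
    , Relate.relate-polynomial K κ {c} (λ y → proj₁ (props y))
    , (λ { q (inj₁ refl) → q ; q (inj₂ refl) → Equivalence.to (proj₂ (proj₂ (props _))) q })
    , λ x k ¬q → κ (x , k) , (λ q → ¬q (Equivalence.from (proj₂ (proj₂ (props (x , k)))) q)) , proj₁ (proj₂ (props (x , k))) , inj₂ refl
    where
    transitive : ∀ {y z w} → y ≡ z ⊎ y ≡ κ z → z ≡ w ⊎ z ≡ κ w → y ≡ w ⊎ y ≡ κ w
    transitive (inj₁ refl) z≼w         = z≼w
    transitive (inj₂ refl) (inj₁ refl) = inj₂ refl
    -- Here y is κ (κ w): the only case that calls for idempotence.
    transitive {w = w} (inj₂ refl) (inj₂ refl) = inj₂ (idem w)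

-- Enumerating all words of a given length

module _ {g : ℕ} where

  private
    Digit : Set
    Digit = Fin (suc g)

  -- Counting down in base g + 1 with the least significant digit first: a zero turns into the top
  -- digit and borrows from the rest. All zeros is the last word.
  decrement : List Digit → Maybe (List Digit)
  decrement []          = nothing
  decrement (zero  ∷ u) = Maybe.map (Fin.fromℕ g ∷_) (decrement u)
  decrement (suc i ∷ u) = just (Fin.inject₁ i ∷ u)

  decrement-length : ∀ u {u′} → decrement u ≡ just u′ → length u′ ≡ length u
  decrement-length (zero ∷ u) eq with decrement u in e
  decrement-length (zero ∷ u) refl | just u′ = cong suc (decrement-length u e)
  decrement-length (suc i ∷ u) refl = refl

  data Countdown : List Digit → List (List Digit) → Set where
    done : ∀ {u} → decrement u ≡ nothing → Countdown u []
    more : ∀ {u u′ us} → decrement u ≡ just u′ → Countdown u′ us → Countdown u (u′ ∷ us)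

  private
    Extension : Digit → List Digit → List (List Digit) → Set
    Extension i v us = ∃[ us′ ] Countdown (i ∷ v) us′
      × (∀ j → Fin.toℕ j ≤ Fin.toℕ i → (j ∷ v) ∈ (i ∷ v) ∷ us′) × (∀ j u → u ∈ us → (j ∷ u) ∈ us′)

    -- The low digit runs down to zero above each word of the given countdown; a borrow then moves
    -- to the next word and resets the digit to g. Above `v` only the digits up to `i` are met,
    -- above all later words every digit. The recursion is lexicographic in the countdown and the
    -- digit, the latter through its value `m`.
    extend : ∀ {v us} → Countdown v us → ∀ m i → Fin.toℕ i ≡ m → Extension i v us
    extend (done e)    zero    zero    _ = [] , done (cong (Maybe.map _) e) , (λ { zero _ → here refl }) , λ _ _ ()
    extend {v} (more {us = us} e c) zero zero _ with extend c g (Fin.fromℕ g) (Fin.toℕ-fromℕ g)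
    ... | us′ , c′ , first , rest = _ , more (cong (Maybe.map _) e) c′ , (λ { zero _ → here refl }) ,
          λ { j _ (here refl) → first j (subst (Fin.toℕ j ≤_) (sym (Fin.toℕ-fromℕ g)) (Fin.toℕ≤pred[n] j))
            ; j u (there u∈) → there (rest j u u∈) }
    extend c (suc m) (suc i) eq with extend c m (Fin.inject₁ i) (trans (Fin.toℕ-inject₁ i) (suc-injective eq))
    ... | us′ , c′ , first , rest = _ , more refl c′ , first′ , λ j u u∈ → there (rest j u u∈)
      where
      first′ : ∀ j → Fin.toℕ j ≤ suc (Fin.toℕ i) → (j ∷ _) ∈ (suc i ∷ _) ∷ (Fin.inject₁ i ∷ _) ∷ us′
      first′ j j≤ with m≤n⇒m<n∨m≡n j≤
      ... | inj₁ (s≤s j≤i) = there (first j (subst (Fin.toℕ j ≤_) (sym (Fin.toℕ-inject₁ i)) j≤i))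
      ... | inj₂ j≡        = here (cong (_∷ _) (Fin.toℕ-injective j≡))

  countdown : ∀ n → ∃[ us ] Countdown (replicate n (Fin.fromℕ g)) us
              × (∀ u → length u ≡ n → u ∈ replicate n (Fin.fromℕ g) ∷ us)
  countdown zero    = [] , done refl , λ { [] _ → here refl }
  countdown (suc n) with countdown n
  ... | us , c , all with extend c g (Fin.fromℕ g) (Fin.toℕ-fromℕ g)
  ...   | us′ , c′ , first , rest = us′ , c′ , λ { (j ∷ u) eq → place j u (all u (suc-injective eq)) }
    where
    place : ∀ j u → u ∈ replicate n (Fin.fromℕ g) ∷ us → (j ∷ u) ∈ replicate (suc n) (Fin.fromℕ g) ∷ us′
    place j _ (here refl) = first j (subst (Fin.toℕ j ≤_) (sym (Fin.toℕ-fromℕ g)) (Fin.toℕ≤pred[n] j))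
    place j u (there u∈)  = there (rest j u u∈)

module Odometer {A : Set} {g : ℕ} (digit : Fin (suc g) → A) (value : A → Fin (suc g))
                (value-digit : ∀ i → value (digit i) ≡ i) (mark : A) where

  private
    Three : Shape
    Three = • ⊗ • ⊗ •

    lower : Fin (suc g) → Maybe (Maybe (Fin (suc g))) × ⟦ Three ⟧ (Op A)
    lower zero    = just nothing , pop , push (digit (Fin.fromℕ g)) , keep
    lower (suc i) = just (just (Fin.inject₁ i)) , pop , keep , keep

    -- Zeros met on the way are parked as top digits on the second stack, from which they are poured
    -- back. A digit cannot be popped and replaced in one step, so the lowered digit is held in the
    -- state in between.
    scan : Machine A Three
    scan = record
      { State = Maybe (Fin (suc g)) ; finite = finite-Maybe (finite-Fin _) ; start = nothing
      ; δ = λ { (just j) _                → nothing , push (digit j) , keep , keep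
              ; nothing  (nothing , _)    → nothing , keep , keep , push mark
              ; nothing  (just a , _ , _) → lower (value a) } }

    restoring : Sel Three (• ⊗ •)
    restoring = rgt (lft here) & ⟨ lft here ⟩

  decrementer : Machine A Three
  decrementer = scan ⨾ lift restoring (pour push)

  private
    restore : List A → List A → List A
    restore v w = foldl (λ w a → a ∷ w) w v

    Scanned : List (Fin (suc g)) → List A → List A → Set
    Scanned u v o = ∃[ t ] ∃[ w′ ] ∃[ v′ ] ∃[ o′ ] Exec scan nothing (List.map digit u , v , o) t (w′ , v′ , o′)
      × maybe′ (λ u′ → restore v′ w′ ≡ restore v (List.map digit u′) × o′ ≡ o) (o′ ≡ mark ∷ o) (decrement u)

    scan-runs : ∀ u v o → Scanned u v o
    scan-runs []          v o = _ , _ , _ , _ , exit refl refl , refl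
    scan-runs (zero ∷ u)  v o with decrement u | scan-runs u (digit (Fin.fromℕ g) ∷ v) o
    ... | just u′ | t , w′ , v′ , o′ , x , same =
          _ , _ , _ , _ , cont (cong lower (value-digit zero)) refl x , same
    ... | nothing | t , w′ , v′ , o′ , x , same =
          _ , _ , _ , _ , cont (cong lower (value-digit zero)) refl x , same
    scan-runs (suc i ∷ u) v o =
      _ , _ , _ , _ , cont (cong lower (value-digit (suc i))) refl (exit refl refl) , refl , refl

  decrementer-runs : ∀ u → ∃[ t ] ∃[ w ] ∃[ o ] Runs decrementer (List.map digit u , [] , []) t (w , [] , o)
    × maybe′ (λ u′ → w ≡ List.map digit u′ × o ≡ []) (o ≡ mark ∷ []) (decrement u)
  decrementer-runs u with scan-runs u [] []
  ... | t , w′ , v′ , o′ , x , same = _ , restore v′ w′ , o′ ,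
        (x then Exec-lift restoring (pour push) (w′ , v′ , o′) (pour-runs push v′ w′)) , same

module _ {s e : ℕ} where

  digit : Fin (2 + s) → Symbol s e
  digit zero          = blank
  digit (suc zero)    = tally
  digit (suc (suc i)) = letter i

  value : Symbol s e → Fin (2 + s)
  value blank      = zero
  value tally      = suc zero
  value (letter i) = suc (suc i)
  -- An arbitrary value: no auxiliary symbol is ever put on the stack of digits.
  value (aux _)    = zero

  value-digit : ∀ i → value (digit i) ≡ i
  value-digit zero          = refl
  value-digit (suc zero)    = refl
  value-digit (suc (suc i)) = refl

  distribute : Symbol s e → ⟦ • ⊗ • ⟧ (Op (Symbol s e))
  distribute (letter i) = push (letter i) , keep
  distribute tally      = keep , push tally
  distribute _          = keep , keep

-- A word over the blank, the tally and the letters stands for the instance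
-- made of its letters and the number of its tallies, so that the words of
-- length n cover the instances of size at most n.
decode : ∀ {s} → List (Fin (2 + s)) → Instance s
decode []                = [] , 0
decode (zero ∷ u)        = decode u
decode (suc zero ∷ u)    = map₂ suc (decode u)
decode (suc (suc i) ∷ u) = map₁ (i ∷_) (decode u)

distribute-decode : ∀ {s e} (u : List (Fin (2 + s))) →
  foldr (λ a → perform (• ⊗ •) (distribute {s} {e} a)) ([] , []) (List.map digit u) ≡ (letters (proj₁ (decode u)) , unary (proj₂ (decode u)))
distribute-decode []                = refl
distribute-decode (zero ∷ u)        = distribute-decode u
distribute-decode (suc zero ∷ u)    = cong (map₂ (tally ∷_)) (distribute-decode u)
distribute-decode (suc (suc i) ∷ u) = cong (map₁ (letter i ∷_)) (distribute-decode u)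

size-decode : ∀ {s} (u : List (Fin (2 + s))) → size (decode u) ≤ length u
size-decode []                = z≤n
size-decode (zero ∷ u)        = m≤n⇒m≤1+n (size-decode u)
size-decode (suc zero ∷ u)    = ≤-trans (≤-reflexive (+-suc (length (proj₁ (decode u))) _)) (s≤s (size-decode u))
size-decode (suc (suc i) ∷ u) = s≤s (size-decode u)

decode-onto : ∀ {s} n (y : Instance s) → size y ≤ n → ∃[ u ] length u ≡ n × decode u ≡ y
decode-onto zero    ([] , zero)   _       = [] , refl , refl
decode-onto (suc n) (i ∷ x , k)   (s≤s b) with decode-onto n (x , k) b
... | u , len , eq = suc (suc i) ∷ u , cong suc len , cong (map₁ (i ∷_)) eq
decode-onto (suc n) ([] , suc k)  (s≤s b) with decode-onto n ([] , k) b
... | u , len , eq = suc zero ∷ u , cong suc len , cong (map₂ suc) eq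
decode-onto (suc n) ([] , zero)   _       with decode-onto n ([] , zero) z≤n
... | u , len , eq = zero ∷ u , cong suc len , eq

embedding-↑ˡ : ∀ {m} n (i : Fin m) → [ just , (λ _ → nothing) ]′ (Fin.splitAt m (i Fin.↑ˡ n)) ≡ just i
embedding-↑ˡ n i = cong [ just , (λ _ → nothing) ]′ (Fin.splitAt-↑ˡ _ i n)

embedding-↑ʳ : ∀ m {n} (i : Fin n) → [ (λ _ → nothing) , just ]′ (Fin.splitAt m (m Fin.↑ʳ i)) ≡ just i
embedding-↑ʳ m i = cong [ (λ _ → nothing) , just ]′ (Fin.splitAt-↑ʳ m _ i)

-- Searching through the rejected instances

-- The words u of length at least f(k) are enumerated, and body is called when D
-- rejects decode u.  With body = skip the time depends on k only, and the time
-- with any other body is at most that times one more than the time of body.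

module Search {s : ℕ} (F : TM 0 1) (D : TM s 2) (P : TM s 4) where

  eF eD eP wF wD wP : ℕ
  eF = TM.auxSymbols F
  eD = TM.auxSymbols D
  eP = TM.auxSymbols P
  wF = TM.workTapes F
  wD = TM.workTapes D
  wP = TM.workTapes P

  A : Set
  A = Symbol s (eF + (eD + eP))

  ιF : TM.Γ F → A
  ιF = relabel (λ ()) (Fin._↑ˡ (eD + eP))

  ρF : A → TM.Γ F
  ρF = unlabel (λ _ → nothing) (λ j → [ just , (λ _ → nothing) ]′ (Fin.splitAt eF j))

  ρF-ιF : ∀ c → ρF (ιF c) ≡ c
  ρF-ιF = unlabel-relabel (λ ()) (embedding-↑ˡ (eD + eP))

  ιD : TM.Γ D → A
  ιD = relabel id (λ j → eF Fin.↑ʳ (j Fin.↑ˡ eP))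

  ρD : A → TM.Γ D
  ρD = unlabel just (λ j → [ (λ _ → nothing) , (λ i → [ just , (λ _ → nothing) ]′ (Fin.splitAt eD i)) ]′ (Fin.splitAt eF j))

  ρD-ιD : ∀ c → ρD (ιD c) ≡ c
  ρD-ιD = unlabel-relabel (λ _ → refl) λ j →
    trans (cong [ (λ _ → nothing) , _ ]′ (Fin.splitAt-↑ʳ eF _ (j Fin.↑ˡ eP))) (embedding-↑ˡ eP j)

  ιP : TM.Γ P → A
  ιP = relabel id (λ j → eF Fin.↑ʳ (eD Fin.↑ʳ j))

  ρP : A → TM.Γ P
  ρP = unlabel just (λ j → [ (λ _ → nothing) , (λ i → [ (λ _ → nothing) , just ]′ (Fin.splitAt eD i)) ]′ (Fin.splitAt eF j))

  ρP-ιP : ∀ c → ρP (ιP c) ≡ c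
  ρP-ιP = unlabel-relabel (λ _ → refl) λ j →
    trans (cong [ (λ _ → nothing) , _ ]′ (Fin.splitAt-↑ʳ eF _ (eD Fin.↑ʳ j))) (embedding-↑ʳ eD j)

  module SimF = Simulate {A} F ιF ρF ρF-ιF tally blank
  module SimD = Simulate {A} D ιD ρD ρD-ιD tally blank
  module SimP = Simulate {A} P ιP ρP ρP-ιP tally blank
  module Count = Odometer {A} digit value value-digit tally

  IO Work S : Shape
  IO   = • ⊗ •
  Work = • ⊗ SimF.S ⊗ • ⊗ • ⊗ SimD.S ⊗ SimP.S ⊗ •
  S    = IO ⊗ Work

  word param tmp digits over found : Path S •
  word   = lft (lft here)
  param  = lft (rgt here)
  tmp    = rgt (lft here)
  digits = rgt (rgt (rgt (lft here)))
  over   = rgt (rgt (rgt (rgt (lft here))))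
  found  = rgt (rgt (rgt (rgt (rgt (rgt (rgt here))))))

  simF : Path S SimF.S
  simF = rgt (rgt (lft here))

  simD : Path S SimD.S
  simD = rgt (rgt (rgt (rgt (rgt (lft here)))))

  simP : Path S SimP.S
  simP = rgt (rgt (rgt (rgt (rgt (rgt (lft here))))))

  F₀ D₀ D₁ flagD : Path S •
  F₀    = simF ▸ lft (lft (rgt here))
  D₀    = simD ▸ lft (lft (rgt here))
  D₁    = simD ▸ lft (rgt (lft (rgt here)))
  flagD = simD ▸ rgt here

  copyParam : Sel S (• ⊗ • ⊗ •)
  copyParam = param & tmp & ⟨ F₀ ⟩

  toDigits : Sel S (• ⊗ •)
  toDigits = F₀ & ⟨ digits ⟩

  toD : Sel S (• ⊗ • ⊗ • ⊗ •)
  toD = digits & tmp & D₀ & ⟨ D₁ ⟩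

  counter : Sel S (• ⊗ • ⊗ •)
  counter = digits & tmp & ⟨ over ⟩

  top : Fin (2 + s)
  top = Fin.fromℕ (suc s)

  accepted running : ⟦ S ⟧ (Maybe A) → Bool
  accepted h = isTally (getP flagD h)
  running h = not (is-just (getP over h))

  setup : Machine A S
  setup = lift copyParam (copy push) ⨾ lift ⟨ simF ⟩ SimF.simulate ⨾ lift toDigits (pour (λ _ → push (digit top)))

  iteration search : Machine A S → Machine A S
  iteration body = lift toD (copy distribute) ⨾ lift ⟨ simD ⟩ SimD.simulate ⨾ ifte accepted skip body
                 ⨾ lift ⟨ simD ⟩ clear ⨾ lift counter Count.decrementer
  search body = setup ⨾ while running (iteration body)

  Digits : Set
  Digits = List (Fin (2 + s))

  spell : Digits → List A
  spell = List.map digit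

  idleD : ⟦ SimD.S ⟧ (List A)
  idleD = spure SimD.S []

  idleP : ⟦ SimP.S ⟧ (List A)
  idleP = spure SimP.S []

  store : List A → List A → ⟦ SimF.S ⟧ (List A) → List A → List A → ⟦ SimD.S ⟧ (List A) → List A → ⟦ S ⟧ (List A)
  store X K φ U o δ f = (X , K) , [] , φ , U , o , δ , idleP , f

  mark : Bool → List A → List A
  mark b f = if b then tally ∷ f else f

  -- The contract that lets the loop be analysed once for all bodies: the store is returned as it
  -- was, with `simP` empty again, except for a possible mark on `found`, and `b` bounds the time
  -- for every word of length `n`.
  BodySpec : ℕ → List A → List A → Machine A S → ℕ → (Digits → Bool) → Set
  BodySpec n X K body b β = ∀ u φ δ f → length u ≡ n →
    ∃[ τ ] τ ≤ b × Runs body (store X K φ (spell u) [] δ f) τ (store X K φ (spell u) [] δ (mark (β u) f))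

  -- Here `a` is the time with the branch on the verdict counted as a single step in every round,
  -- and `b` bounds what the branch does beyond it. The upper bound limits the actual search in
  -- terms of `a`; the lower bound limits `a` itself by the time of an idle search, which can be
  -- measured.
  Within : ℕ → ℕ → ℕ → Set
  Within a b t = a ≤ t × t ≤ a * suc b

  Within-refl : ∀ a b → Within a b a
  Within-refl a b = ≤-refl , m≤m*n a (suc b)

  Within-+ : ∀ {a t a′ t′ b} → Within a b t → Within a′ b t′ → Within (a + a′) b (t + t′)
  Within-+ {a} {a′ = a′} {b = b} (l , h) (l′ , h′) =
    +-mono-≤ l l′ , ≤-trans (+-mono-≤ h h′) (≤-reflexive (sym (*-distribʳ-+ (suc b) a a′)))

  window : ∀ c₁ c₂ c₃ {τ b} → τ ≤ b → Within (c₁ + (c₂ + (1 + c₃))) b (c₁ + (c₂ + (suc τ + c₃)))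
  window c₁ c₂ c₃ {τ} {b} τ≤b = Within-+ {c₁} (Within-refl c₁ b) (Within-+ {c₂} (Within-refl c₂ b)
    (Within-+ {1} (s≤s z≤n , s≤s (≤-trans τ≤b (≤-reflexive (sym (+-identityʳ b))))) (Within-refl c₃ b)))

  bound : ∀ S (σ : ⟦ S ⟧ (List A)) → ∃[ m ] Bounded m S σ
  bound ε       _       = 0 , tt
  bound •       w       = length w , ≤-refl
  bound (S ⊗ T) (σ , τ) = let m , b = bound S σ ; n , c = bound T τ in
    m + n , Bounded-mono S (m≤m+n m n) b , Bounded-mono T (m≤n+m n m) c

  module _ {Q : ParameterizedProblem s} (D-decides : ∀ y → ∃[ t ] DecidesWithin D t (encode y) (Q y)) where

    stepsD : Instance s → ℕ
    stepsD y = proj₁ (proj₂ (D-decides y))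

    lastD : Instance s → Config D
    lastD y = proj₁ (proj₂ (proj₂ (D-decides y)))

    accepts : Instance s → Bool
    accepts y = TM.accepting D (Config.state (lastD y))

    accepts⇔ : ∀ y → Holds (accepts y) ⇔ Q y
    accepts⇔ y = proj₂ (proj₂ (proj₂ (proj₂ (proj₂ (D-decides y)))))

    hit : (Digits → Bool) → Digits → Bool
    hit β u = if accepts (decode u) then false else β u

    finalD : Instance s → ⟦ SimD.S ⟧ (List A)
    finalD y = SimD.haltedCells (Config.tapes (lastD y)) , SimD.verdict (Config.state (lastD y)) ∷ []

    loadedD : Instance s → ⟦ SimD.S ⟧ (List A)
    loadedD (x , k) = (([] , letters x) , ([] , unary k) , spure (cells wD) []) , []

    D-runs : ∀ y → Runs SimD.simulate (loadedD y) (2 + stepsD y) (finalD y)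
    D-runs y@(x , k) = let _ , _ , _ , _ , run , _ = D-decides y in
      subst₂ (λ u v → Runs SimD.simulate ((([] , u) , ([] , v) , spure (cells wD) []) , []) (2 + stepsD y) (finalD y))
        (relabel-letters _ x) (relabel-tallies _ _ k) (SimD.simulate-runs run [])

    copyTime : Digits → ℕ
    copyTime u = suc (length (spell u)) + suc (length (spell u))

    toD-runs : ∀ X K φ u f → Runs (lift toD (copy distribute)) (store X K φ (spell u) [] idleD f) (copyTime u)
                                  (store X K φ (spell u) [] (loadedD (decode u)) f)
    toD-runs X K φ u f = recast refl
      (cong (λ XK → store X K φ (spell u) [] ((([] , proj₁ XK) , ([] , proj₂ XK) , spure (cells wD) []) , []) f) (distribute-decode u))
      (Exec-lift toD (copy distribute) (store X K φ (spell u) [] idleD f) (copy-runs distribute (spell u) ([] , [])))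

    module _ (n : ℕ) where

      branch-runs : ∀ {X K body b β} u φ C v f → 1 ≤ b → length u ≡ n → BodySpec n X K body b β →
        ∃[ τ ] τ ≤ b × Runs (ifte accepted skip body) (store X K φ (spell u) [] (C , (if v then tally else blank) ∷ []) f) (suc τ)
                              (store X K φ (spell u) [] (C , (if v then tally else blank) ∷ []) (mark (if v then false else β u) f))
      branch-runs u φ C true  f 1≤b len spec = 1 , 1≤b , ifte-true refl (exit refl (perform-keep S _))
      branch-runs u φ C false f 1≤b len spec = let τ , τ≤b , x = spec u φ (C , blank ∷ []) f len in τ , τ≤b , ifte-false refl x

      Iterates : Digits → ℕ → Set₁
      Iterates u a = ∀ X K φ body b β → 1 ≤ b → BodySpec n X K body b β → ∀ f →
        ∃[ t ] ∃[ w ] ∃[ o ] Within a b t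
          × Runs (iteration body) (store X K φ (spell u) [] idleD f) t (store X K φ w o idleD (mark (hit β u) f))
          × maybe′ (λ u′ → w ≡ spell u′ × o ≡ []) (o ≡ tally ∷ []) (decrement u)

      -- The number `a` is chosen before the body. This order of quantifiers is what later transfers
      -- a measurement made with one body to another.
      iteration-runs : ∀ u → length u ≡ n → ∃[ a ] Iterates u a
      iteration-runs u len =
        let y = decode u
            -- Any bound will do. The time of `D` on this instance, and so of erasing its tapes,
            -- merely has to be the same for all bodies.
            m , bounded = bound SimD.S (finalD y)
            tc , _ , cleared = clear-runs {S = SimD.S} m bounded
            td , w , o , decremented , outcome = Count.decrementer-runs u
        in copyTime u + ((2 + stepsD y) + (1 + (tc + td))) , λ X K φ body b β 1≤b spec f →
           let τ , τ≤b , branched = branch-runs {X} {K} {body} {b} {β} u φ (SimD.haltedCells (Config.tapes (lastD y))) (accepts y) f 1≤b len spec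
           in copyTime u + ((2 + stepsD y) + (suc τ + (tc + td))) , w , o , window (copyTime u) (2 + stepsD y) (tc + td) τ≤b ,
              (toD-runs X K φ u f
               then Exec-lift ⟨ simD ⟩ SimD.simulate (store X K φ (spell u) [] (loadedD y) f) (D-runs y)
               then branched
               then Exec-lift ⟨ simD ⟩ clear (store X K φ (spell u) [] (finalD y) (mark (hit β u) f)) cleared
               then Exec-lift counter Count.decrementer (store X K φ (spell u) [] idleD (mark (hit β u) f)) decremented) ,
              outcome

      Loops : Digits → List Digits → ℕ → Set₁
      Loops u us a = ∀ X K φ body b β → 1 ≤ b → BodySpec n X K body b β → ∀ f →
        ∃[ t ] ∃[ w ] Within a b t
          × Runs (while running (iteration body)) (store X K φ (spell u) [] idleD f) t
                 (store X K φ w (tally ∷ []) idleD (foldl (λ f u → mark (hit β u) f) f (u ∷ us)))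

      loop-runs : ∀ {u us} → Countdown u us → length u ≡ n → ∃[ a ] Loops u us a
      loop-runs {u} (done e) len = let a , iterates = iteration-runs u len in 1 + a + 1 , λ X K φ body b β 1≤b spec f →
        let t , w , o , within , x , outcome = iterates X K φ body b β 1≤b spec f
            o≡ = subst (maybe′ (λ u′ → w ≡ spell u′ × o ≡ []) (o ≡ tally ∷ [])) e outcome
        in 1 + t + 1 , w , Within-+ {1 + a} (Within-+ {1} (Within-refl 1 b) within) (Within-refl 1 b) ,
           while-step refl (recast refl (cong (λ o → store X K φ w o idleD (mark (hit β u) f)) o≡) x) (while-done refl)
      loop-runs {u} {us = u′ ∷ us} (more e c) len =
        let a , iterates = iteration-runs u len
            a′ , loops = loop-runs c (trans (decrement-length u e) len)
        in 1 + a + a′ , λ X K φ body b β 1≤b spec f →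
        let t , w , o , within , x , outcome = iterates X K φ body b β 1≤b spec f
            t′ , w′ , within′ , x′ = loops X K φ body b β 1≤b spec (mark (hit β u) f)
            w≡ , o≡ = subst (maybe′ (λ u′ → w ≡ spell u′ × o ≡ []) (o ≡ tally ∷ [])) e outcome
        in 1 + t + t′ , w′ , Within-+ {1 + a} (Within-+ {1} (Within-refl 1 b) within) within′ ,
           while-step refl (recast refl (cong₂ (λ w o → store X K φ w o idleD (mark (hit β u) f)) w≡ o≡) x) x′

    module _ {f : ℕ → ℕ} (F-computes : ∀ k → ∃[ t ] ComputesWithin F t (replicate k tally ∷ []) (replicate (f k) tally ∷ [])) where

      Sets : ℕ → ℕ → ℕ → Set
      Sets k n t = ∃[ φ ] (∀ X → Runs setup ((X , unary k) , spure Work []) t (store X (unary k) φ (replicate n (digit top)) [] idleD []))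

      digits-of : ∀ (w u : List A) → foldl (λ u _ → digit top ∷ u) u w ≡ replicate (length w) (digit top) ++ u
      digits-of []      u = refl
      digits-of (_ ∷ w) u = trans (digits-of w (digit top ∷ u)) (shuffle (length w))
        where
        shuffle : ∀ n → replicate n (digit top) ++ digit top ∷ u ≡ digit top ∷ replicate n (digit top) ++ u
        shuffle zero    = refl
        shuffle (suc n) = cong (digit top ∷_) (shuffle n)

      -- The length `n` counts all listed cells from the head on, including whatever `F` left behind
      -- its output. Searching words longer than `f k` is harmless, because in a lower ideal every
      -- rejected instance below z refutes z, whatever its size.
      setup-runs : ∀ k → ∃[ n ] ∃[ t ] f k ≤ n × n ≤ t × k ≤ t × Sets k n t
      setup-runs k = go (proj₂ (F-computes k))
        where
        K : List A
        K = unary k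
        go : ComputesWithin F (proj₁ (F-computes k)) (replicate k tally ∷ []) (replicate (f k) tally ∷ []) →
             ∃[ n ] ∃[ t ] f k ≤ n × n ≤ t × k ≤ t × Sets k n t
        go (t , config q (tape ls h rs ∷ ts) , _ , run , out) =
          n , (suc (length K) + suc (length K)) + ((2 + t) + suc (length R)) ,
          fk≤n , n≤t , k≤t ,
          ((((List.map ιF ls , []) , SimF.haltedCells ts) , v ∷ []) , λ X →
            (Exec-lift copyParam (copy push) ((X , K) , spure Work []) (copy-word K)
            then Exec-lift ⟨ simF ⟩ SimF.simulate (store X K (loadedF K) [] [] idleD []) simulated
            then recast refl (cong (λ U → store X K (((List.map ιF ls , []) , SimF.haltedCells ts) , v ∷ []) U [] idleD []) (poured R))
                   (Exec-lift toDigits (pour (λ _ → push (digit top))) (store X K (((List.map ιF ls , R) , SimF.haltedCells ts) , v ∷ []) [] [] idleD [])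
                     (pour-runs (λ _ → push (digit top)) R []))))
          where
          R : List A
          R = List.map ιF (h ∷ rs)
          n : ℕ
          n = length R
          v : A
          v = SimF.verdict q
          loadedF : List A → ⟦ SimF.S ⟧ (List A)
          loadedF K = (([] , K) , spure (cells wF) []) , []
          simulated : Runs SimF.simulate (loadedF K) (2 + t) (((List.map ιF ls , R) , SimF.haltedCells ts) , v ∷ [])
          simulated = subst (λ u → Runs SimF.simulate (loadedF u) (2 + t) (((List.map ιF ls , R) , SimF.haltedCells ts) , v ∷ []))
            (relabel-tallies _ _ k) (SimF.simulate-runs run [])
          poured : ∀ w → foldl (λ u _ → digit top ∷ u) [] w ≡ replicate (length w) (digit top)
          poured w = trans (digits-of w []) (++-identityʳ _)
          fk≤n : f k ≤ n
          fk≤n = begin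
            f k                                       ≡⟨ length-replicate (f k) ⟨
            length (replicate (f k) (tally {0} {eF})) ≡⟨ cong length (Vec.∷-injectiveˡ out) ⟨
            length (untilBlank (h ∷ rs))              ≤⟨ length-untilBlank (h ∷ rs) ⟩
            length (h ∷ rs)                           ≡⟨ length-map ιF (h ∷ rs) ⟨
            n                                         ∎
            where open ≤-Reasoning
          n≤t : n ≤ (suc (length K) + suc (length K)) + ((2 + t) + suc (length R))
          n≤t = ≤-trans (n≤1+n n) (≤-trans (m≤n+m (suc n) (2 + t)) (m≤n+m ((2 + t) + suc n) (suc (length K) + suc (length K))))
          k≤t : k ≤ (suc (length K) + suc (length K)) + ((2 + t) + suc (length R))
          k≤t = ≤-trans (≤-reflexive (sym (length-replicate k)))
                (≤-trans (n≤1+n (length K)) (≤-trans (m≤m+n (suc (length K)) (suc (length K))) (m≤m+n (suc (length K) + suc (length K)) _)))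

      Searches : ℕ → ℕ → List Digits → ℕ → Set₁
      Searches k n us a = ∀ X body b β → 1 ≤ b → BodySpec n X (unary k) body b β →
        ∃[ t ] ∃[ σ′ ] Within a b t × Runs (search body) ((X , unary k) , spure Work []) t σ′
          × getP found σ′ ≡ foldl (λ f u → mark (hit β u) f) [] us

      search-runs : ∀ k → ∃[ n ] ∃[ us ] ∃[ a ] f k ≤ n × n ≤ a × k ≤ a × (∀ u → length u ≡ n → u ∈ us) × Searches k n us a
      search-runs k =
        let n , t₀ , fk≤n , n≤t₀ , k≤t₀ , φ , set = setup-runs k
            us , c , covers = countdown {suc s} n
            a , loops = loop-runs n c (length-replicate n)
        in n , replicate n top ∷ us , t₀ + a , fk≤n , ≤-trans n≤t₀ (m≤m+n t₀ a) , ≤-trans k≤t₀ (m≤m+n t₀ a) , covers , λ X body b β 1≤b spec →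
        let t , w , within , x = loops X (unary k) φ body b β 1≤b spec []
        in t₀ + t , store X (unary k) φ w (tally ∷ []) idleD (foldl (λ f u → mark (hit β u) f) [] (replicate n top ∷ us)) ,
           Within-+ {t₀} (Within-refl t₀ b) within ,
           (recast refl (cong (λ U → store X (unary k) φ U [] idleD []) (sym (map-replicate digit n top))) (set X) then x) ,
           refl

-- Testing the relation inside the search

polynomial-mono : ∀ {s} c {m n} → m ≤ n → polynomial {s} c m ≤ polynomial {s} c n
polynomial-mono c m≤n = +-monoˡ-≤ c (*-monoʳ-≤ c (^-monoˡ-≤ c m≤n))

module Consult {s : ℕ} (F : TM 0 1) (D : TM s 2) (P : TM s 4) {R : Rel (Instance s) 0ℓ} {c : ℕ}
  (P-decides : ∀ y z → DecidesWithin P (polynomial {s} c (size y + size z)) (encode y Vec.++ encode z) (R y z)) where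

  open Search {s} F D P

  private
    P₀ P₁ P₂ P₃ flagP : Path S •
    P₀    = simP ▸ lft (lft (rgt here))
    P₁    = simP ▸ lft (rgt (lft (rgt here)))
    P₂    = simP ▸ lft (rgt (rgt (lft (rgt here))))
    P₃    = simP ▸ lft (rgt (rgt (rgt (lft (rgt here)))))
    flagP = simP ▸ rgt here

    toP : Sel S (• ⊗ • ⊗ • ⊗ •)
    toP = digits & tmp & P₀ & ⟨ P₁ ⟩

    copyW copyK : Sel S (• ⊗ • ⊗ •)
    copyW = word & tmp & ⟨ P₂ ⟩
    copyK = param & tmp & ⟨ P₃ ⟩

    positive : ⟦ S ⟧ (Maybe A) → Bool
    positive h = isTally (getP flagP h)

    report : Machine A S
    report = ifte positive (lift ⟨ found ⟩ (pushes (tally ∷ []))) skip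

  -- The instance y is decoded anew from the digits. Since `copy` restores its source, the digits
  -- and the input survive for the next round, and the final `clear` gives `P` empty tapes again.
  consult : Machine A S
  consult = lift toP (copy distribute) ⨾ lift copyW (copy push) ⨾ lift copyK (copy push)
          ⨾ lift ⟨ simP ⟩ SimP.simulate ⨾ report ⨾ lift ⟨ simP ⟩ clear

  stepsP : Instance s → Instance s → ℕ
  stepsP y z = proj₁ (P-decides y z)

  lastP : Instance s → Instance s → Config P
  lastP y z = proj₁ (proj₂ (P-decides y z))

  related : Instance s → Instance s → Bool
  related y z = TM.accepting P (Config.state (lastP y z))

  related⇔ : ∀ y z → Holds (related y z) ⇔ R y z
  related⇔ y z = proj₂ (proj₂ (proj₂ (proj₂ (P-decides y z))))

  private
    doubleLength : List A → ℕ
    doubleLength w = suc (length w) + suc (length w)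

    loadedP : List A → List A → List A → List A → ⟦ SimP.S ⟧ (List A)
    loadedP X′ K′ X K = (([] , X′) , ([] , K′) , ([] , X) , ([] , K) , spure (cells wP) []) , []

    finalP : Instance s → Instance s → ⟦ SimP.S ⟧ (List A)
    finalP y z = SimP.haltedCells (Config.tapes (lastP y z)) , SimP.verdict (Config.state (lastP y z)) ∷ []

    loadedP-of : Instance s → Instance s → ⟦ SimP.S ⟧ (List A)
    loadedP-of (x′ , k′) (x , k) = loadedP (letters x′) (unary k′) (letters x) (unary k)

    P-runs : ∀ y z → Runs SimP.simulate (loadedP-of y z) (2 + stepsP y z) (finalP y z)
    P-runs y@(x′ , k′) z@(x , k) = let _ , _ , _ , run , _ = P-decides y z in
      subst₂ (λ (u , v) (u′ , v′) → Runs SimP.simulate (loadedP u v u′ v′) (2 + stepsP y z) (finalP y z))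
        (cong₂ _,_ (relabel-letters _ x′) (relabel-tallies _ _ k′)) (cong₂ _,_ (relabel-letters _ x) (relabel-tallies _ _ k))
        (SimP.simulate-runs run [])

    loadedP-bounded : ∀ y z → Bounded (size y + size z) SimP.S (loadedP-of y z)
    loadedP-bounded (x′ , k′) (x , k) =
      ((z≤n , ≤-trans (≤-reflexive (length-letters x′)) (≤-trans (m≤m+n _ k′) y≤)) ,
       (z≤n , ≤-trans (≤-reflexive (length-replicate k′)) (≤-trans (m≤n+m k′ (length x′)) y≤)) ,
       (z≤n , ≤-trans (≤-reflexive (length-letters x)) (≤-trans (m≤m+n _ k) z≤)) ,
       (z≤n , ≤-trans (≤-reflexive (length-replicate k)) (≤-trans (m≤n+m k (length x)) z≤)) ,
       Bounded-empty _ (cells wP)) , z≤n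
      where
      y≤ : length x′ + k′ ≤ (length x′ + k′) + (length x + k)
      y≤ = m≤m+n _ _
      z≤ : length x + k ≤ (length x′ + k′) + (length x + k)
      z≤ = m≤n+m _ (length x′ + k′)

    storeP : List A → List A → ⟦ SimF.S ⟧ (List A) → List A → ⟦ SimD.S ⟧ (List A) → ⟦ SimP.S ⟧ (List A) → List A → ⟦ S ⟧ (List A)
    storeP X K φ U δ p f = (X , K) , [] , φ , U , [] , δ , p , f

    report-runs : ∀ {X K φ U δ C f} v → RunsIn report (storeP X K φ U δ (C , (if v then tally else blank) ∷ []) f) 3
                                           (storeP X K φ U δ (C , (if v then tally else blank) ∷ []) (mark v f))
    report-runs {X} {K} {φ} {U} {δ} {C} {f} true  = 3 , ≤-refl , ifte-true refl
      (Exec-lift ⟨ found ⟩ (pushes (tally ∷ [])) (storeP X K φ U δ (C , tally ∷ []) f) (pushes-runs (tally ∷ []) f))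
    report-runs {X} {K} {φ} {U} {δ} {C} {f} false = 2 , s≤s (s≤s z≤n) , ifte-false refl (exit refl (perform-keep S (storeP X K φ U δ (C , blank ∷ []) f)))

  -- The last summand pays for `clear`: within 2 + T steps no stack of the simulation outgrows the
  -- sizes of the two instances by more than 2 + T. The 3 is the time of `report`.
  consultTime : ℕ → Instance s → ℕ
  consultTime n (x , k) = (suc n + suc n) + (doubleLength (letters x) + (doubleLength (unary k) + ((2 + T) + (3 + suc ((2 + T) + (n + (length x + k)))))))
    where
    T : ℕ
    T = polynomial {s} c (n + (length x + k))

  consult-spec : ∀ n x k → BodySpec n (letters x) (unary k) consult (consultTime n (x , k)) (λ u → related (decode u) (x , k))
  consult-spec n x k u φ δ f len =
    let tr , tr≤ , reported = report-runs {X} {K} {φ} {spell u} {δ} {SimP.haltedCells (Config.tapes (lastP y z))} {f} (related y z)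
        tc , tc≤ , cleared = clear-runs {S = SimP.S} _ (Exec-Bounded (P-runs y z) (loadedP-bounded y z))
    in doubleLength (spell u) + (doubleLength X + (doubleLength K + ((2 + stepsP y z) + (tr + tc)))) ,
       +-mono-≤ (≤-reflexive (cong (λ m → suc m + suc m) (trans (length-map digit u) len)))
         (+-monoʳ-≤ (doubleLength X) (+-monoʳ-≤ (doubleLength K) (+-mono-≤ (+-monoʳ-≤ 2 steps≤)
           (+-mono-≤ tr≤ (≤-trans tc≤ (s≤s (+-mono-≤ (+-monoʳ-≤ 2 steps≤) sizes≤))))))) ,
       (recast refl (cong (λ XK → storeP X K φ (spell u) δ (loadedP (proj₁ XK) (proj₂ XK) [] []) f) (distribute-decode u))
          (Exec-lift toP (copy distribute) (storeP X K φ (spell u) δ idleP f) (copy-runs distribute (spell u) ([] , [])))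
        then Exec-lift copyW (copy push) (storeP X K φ (spell u) δ (loadedP X′ K′ [] []) f) (copy-word X)
        then Exec-lift copyK (copy push) (storeP X K φ (spell u) δ (loadedP X′ K′ X []) f) (copy-word K)
        then Exec-lift ⟨ simP ⟩ SimP.simulate (storeP X K φ (spell u) δ (loadedP X′ K′ X K) f) (P-runs y z)
        then reported
        then Exec-lift ⟨ simP ⟩ clear (storeP X K φ (spell u) δ (finalP y z) (mark (related y z) f)) cleared)
    where
    y z : Instance s
    y = decode u
    z = x , k
    X K X′ K′ : List A
    X  = letters x
    K  = unary k
    X′ = letters (proj₁ y)
    K′ = unary (proj₂ y)
    sizes≤ : size y + size z ≤ n + size z
    sizes≤ = +-monoˡ-≤ (size z) (≤-trans (size-decode u) (≤-reflexive len))
    steps≤ : stepsP y z ≤ polynomial {s} c (n + size z)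
    steps≤ = ≤-trans (proj₁ (proj₂ (proj₂ (P-decides y z)))) (polynomial-mono {s} c sizes≤)

  weight : ℕ × Instance s → ℕ
  weight (n , z) = n + size z

  consultTime-poly : Poly weight (λ (n , z) → consultTime n z)
  consultTime-poly = Poly-+ (double n-poly) (Poly-+ (double X-poly) (Poly-+ (double K-poly)
    (Poly-+ T-poly (Poly-+ (Poly-const 3) (Poly-+ (Poly-const 1) (Poly-+ T-poly Poly-weight))))))
    where
    double : ∀ {g : ℕ × Instance s → ℕ} → Poly weight g → Poly weight (λ i → suc (g i) + suc (g i))
    double p = Poly-+ (Poly-+ (Poly-const 1) p) (Poly-+ (Poly-const 1) p)
    n-poly : Poly weight proj₁
    n-poly = Poly-≤ (λ (n , z) → m≤m+n n (size z)) Poly-weight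
    X-poly : Poly weight (λ (n , z) → length (letters {s} {eF + (eD + eP)} (proj₁ z)))
    X-poly = Poly-≤ (λ (n , x , k) → ≤-trans (≤-reflexive (length-letters x)) (≤-trans (m≤m+n (length x) k) (m≤n+m _ n))) Poly-weight
    K-poly : Poly weight (λ (n , z) → length (unary {s} {eF + (eD + eP)} (proj₂ z)))
    K-poly = Poly-≤ (λ (n , x , k) → ≤-trans (≤-reflexive (length-unary {s} {eF + (eD + eP)} k)) (≤-trans (m≤n+m k (length x)) (m≤n+m _ n))) Poly-weight
    T-poly : Poly weight (λ (n , z) → 2 + polynomial {s} c (n + size z))
    T-poly = Poly-+ (Poly-const 2) (Poly-polynomial {s = s} Poly-weight c)

-- From a relation to a decision procedure

search-bound : ∀ c {a b n l k t} → b ≤ (2 + (n + (l + k))) ^ c → n ≤ a → a ≤ t →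
               a * suc b * 2 + 1 ≤ (5 + (t + k)) ^ (2 + c) * (1 ⊔ l) ^ c
search-bound c {a} {b} {n} {l} {k} {t} b≤ n≤a a≤t = begin
  a * suc b * 2 + 1             ≤⟨ +-mono-≤ (*-monoˡ-≤ 2 (*-monoʳ-≤ a (+-mono-≤ 1≤E b≤E))) 1≤E ⟩
  a * (E + E) * 2 + E           ≡⟨ solve 2 (λ a E → a :* (E :+ E) :* con 2 :+ E := (con 4 :* a :+ con 1) :* E) refl a E ⟩
  (4 * a + 1) * E               ≤⟨ *-monoˡ-≤ E square ⟩
  N * N * E                     ≡⟨ cong (N * N *_) (*-^ N L c) ⟩
  N * N * (N ^ c * L ^ c)       ≡⟨ *-assoc (N * N) (N ^ c) (L ^ c) ⟨
  N * N * N ^ c * L ^ c         ≡⟨ cong (_* L ^ c) (*-assoc N N (N ^ c)) ⟩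
  N ^ (2 + c) * L ^ c           ∎
  where
  open ≤-Reasoning
  open +-*-Solver
  N L E : ℕ
  -- The weight 2 + n + l + k is at most N L, since n ≤ t and L is at least 1 and l; this separates
  -- the parameter from the word. Then the time is at most (4 a + 1) (N L) ^ c, and 4 a + 1 ≤ 5 N ≤
  -- N ^ 2 accounts for the 5 and for the exponent 2 + c.
  N = 5 + (t + k)
  L = 1 ⊔ l
  E = (N * L) ^ c
  base : 2 + (n + (l + k)) ≤ N * L
  base = begin
    2 + (n + (l + k))         ≤⟨ +-mono-≤ (m≤m+n 2 2) (+-monoˡ-≤ (l + k) (≤-trans n≤a a≤t)) ⟩
    4 + (t + (l + k))         ≡⟨ solve 3 (λ t l k → con 4 :+ (t :+ (l :+ k)) := l :+ (con 4 :+ (t :+ k))) refl t l k ⟩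
    l + (4 + (t + k))         ≡⟨ cong (l +_) (*-identityʳ _) ⟨
    l + (4 + (t + k)) * 1     ≤⟨ +-mono-≤ (m≤n⊔m 1 l) (*-monoʳ-≤ (4 + (t + k)) (m≤m⊔n 1 l)) ⟩
    N * L                     ∎
  b≤E : b ≤ E
  b≤E = ≤-trans b≤ (^-monoˡ-≤ c base)
  1≤E : 1 ≤ E
  1≤E = m^n>0 (N * L) {{>-nonZero (≤-trans (s≤s z≤n) base)}} c
  square : 4 * a + 1 ≤ N * N
  square = begin
    4 * a + 1          ≤⟨ +-mono-≤ (*-monoʳ-≤ 4 (≤-trans a≤t (≤-trans (m≤m+n t k) (m≤n+m (t + k) 5)))) (s≤s z≤n) ⟩
    4 * N + N          ≡⟨ +-comm (4 * N) N ⟩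
    5 * N              ≤⟨ *-monoˡ-≤ N (m≤m+n 5 (t + k)) ⟩
    N * N              ∎

module _ {X A : Set} {a : A} (h : X → Bool) where

  private
    raise : List A → X → List A
    raise f u = if h u then a ∷ f else f

    marks-keep : ∀ f us → is-just (List.head f) ≡ true → is-just (List.head (foldl raise f us)) ≡ true
    marks-keep f []       p = p
    marks-keep f (u ∷ us) p with h u
    ... | true  = marks-keep (a ∷ f) us refl
    ... | false = marks-keep f us p

  marks-hit : ∀ f us {u} → u ∈ us → h u ≡ true → is-just (List.head (foldl raise f us)) ≡ true
  marks-hit f (u ∷ us) (here refl) hu rewrite hu = marks-keep (a ∷ f) us refl
  marks-hit f (v ∷ us) (there u∈)  hu = marks-hit (raise f v) us u∈ hu

  hit-marks : ∀ us → is-just (List.head (foldl raise [] us)) ≡ true → ∃[ u ] h u ≡ true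
  hit-marks (u ∷ us) p with h u in eq
  ... | true  = u , eq
  ... | false = hit-marks us p

module _ {s : ℕ} {Q : ParameterizedProblem s} where

  -- Obstructions ensure that each rejected z is refuted by some instance in the range of the
  -- search, and the ideal property that an accepted z is refuted by none. It is stated for a mere
  -- relation so as to apply to the one given by an arbitrary kernel.
  relation⇒tractable : ∀ {f} {R : Rel (Instance s) 0ℓ} → Decidable Q → Computable f → PolynomialTime R →
                       LowerIdeal R Q → ObstructionsOfSize R Q f → FixedParameterTractable Q
  relation⇒tractable {f} {R} (D , D-decides) (F , F-computes) (P , c , P-decides) ideal obstructed =
    machine , g , c₀ , g-computable , decided
    where
    open Search {s} F D P
    open Consult {s} F D P {R} {c} P-decides
    open Compile (finite-Symbol s (eF + (eD + eP))) (native s (eF + (eD + eP))) IO Work (search consult)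
      (λ h → not (is-just (getP found h))) using (machine; decides)

    abstract
      searched : ∀ k → ∃[ n ] ∃[ us ] ∃[ a ] f k ≤ n × n ≤ a × k ≤ a × (∀ u → length u ≡ n → u ∈ us) × Searches D-decides F-computes k n us a
      searched = search-runs D-decides F-computes

    idle-spec : ∀ n k → BodySpec n [] (unary k) skip 1 (λ _ → false)
    idle-spec n k u φ δ f _ = 1 , ≤-refl , exit refl (perform-keep S (store [] (unary k) φ (spell u) [] δ f))

    -- With a body that does nothing, the search can be run on the empty word, so a machine that
    -- knows only k can perform and time it.
    idle-search : ∀ k → let n , us , a , _ = searched k in
      ∃[ t ] ∃[ σ′ ] Within a 1 t × Runs (search skip) (([] , unary k) , spure Work []) t σ′
        × getP found σ′ ≡ foldl (λ f u → mark (hit D-decides (λ _ → false) u) f) [] us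
    idle-search k = let n , us , a , _ , _ , _ , _ , searches = searched k in
      searches [] skip 1 (λ _ → false) ≤-refl (idle-spec n k)

    c₀ : ℕ
    c₀ = proj₁ consultTime-poly

    bounding : ∃[ g ] Computable g × (∀ k → (5 + (proj₁ (idle-search k) + k)) ^ (2 + c₀) ≤ g k)
    -- The offset 5 and the exponent 2 + c₀ are those of `search-bound`.
    bounding = Dominate.dominate S (lft (rgt here)) (search skip) 5 (suc c₀)
      (λ k → proj₁ (idle-search k)) (λ k → proj₁ (proj₂ (idle-search k))) (λ k → proj₁ (proj₂ (proj₂ (proj₂ (idle-search k)))))

    g : ℕ → ℕ
    g = proj₁ bounding

    g-computable : Computable g
    g-computable = proj₁ (proj₂ bounding)

    found-iff : ∀ (z : Instance s) us →
      (∀ y → size y ≤ f (proj₂ z) → ∃[ u ] decode u ≡ y × u ∈ us) →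
      Holds (not (is-just (List.head (foldl (λ f u → mark (hit D-decides (λ u → related (decode u) z) u) f) [] us)))) ⇔ Q z
    found-iff z@(x , k) us covers = mk⇔ sound complete
      where
      β : Digits → Bool
      β u = related (decode u) z
      end : List A
      end = foldl (λ f u → mark (hit D-decides β u) f) [] us
      hit⇒ : ∀ u → hit D-decides β u ≡ true → ¬ Q (decode u) × R (decode u) z
      hit⇒ u h with accepts D-decides (decode u) | accepts⇔ D-decides (decode u) | β u | related⇔ (decode u) z
      ... | false | iff | true | iff′ = Equivalence.from iff , Equivalence.to iff′ tt
      hit⇐ : ∀ u → ¬ Q (decode u) → R (decode u) z → hit D-decides β u ≡ true
      hit⇐ u ¬q r with accepts D-decides (decode u) | accepts⇔ D-decides (decode u) | β u | related⇔ (decode u) z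
      ... | true  | iff | _     | _    = ⊥-elim (¬q (Equivalence.to iff tt))
      ... | false | _   | true  | _    = refl
      ... | false | _   | false | iff′ = ⊥-elim (Equivalence.from iff′ r)
      sound : Holds (not (is-just (List.head end))) → Q z
      -- Asking `D` about z reduces the claim to a contradiction in the rejecting case, so no
      -- classical reasoning is involved.
      sound empty with accepts D-decides z | accepts⇔ D-decides z
      ... | true  | iff = Equivalence.to iff tt
      ... | false | iff =
        let y , ¬qy , small , r = obstructed x k (Equivalence.from iff)
            u , dec≡ , u∈ = covers y small
            hit≡ = hit⇐ u (subst (λ y → ¬ Q y) (sym dec≡) ¬qy) (subst (λ y → R y z) (sym dec≡) r)
        in ⊥-elim (subst (λ b → Holds (not b)) (marks-hit (hit D-decides β) [] us u∈ hit≡) empty)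
      complete : Q z → Holds (not (is-just (List.head end)))
      complete q with is-just (List.head end) in eq
      ... | false = tt
      -- The hit may be larger than `f k`; the ideal property does not ask for its size.
      ... | true  = let u , h = hit-marks (hit D-decides β) us eq ; ¬qu , r = hit⇒ u h in ⊥-elim (¬qu (ideal q r))

    decided : ∀ x k → DecidesWithin machine (g k * (1 ⊔ length x) ^ c₀) (encode (x , k)) (Q (x , k))
    decided x k =
      let n , us , a , fk≤n , n≤a , k≤a , covers , searches = searched k
          t , σ′ , (_ , t≤) , run , found≡ = searches (letters x) consult (consultTime n (x , k)) (λ u → related (decode u) (x , k)) (s≤s z≤n) (consult-spec n x k)
          time≤ : t * 2 + 1 ≤ g k * (1 ⊔ length x) ^ c₀
          -- `searched k` fixes one `a` for all bodies, so the lower bound on the time of the idle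
          -- search limits the `a` of the present one.
          time≤ = ≤-trans (+-monoˡ-≤ 1 (*-monoˡ-≤ 2 t≤))
            (≤-trans (search-bound c₀ {b = consultTime n (x , k)} {l = length x} {k} (proj₂ consultTime-poly (n , x , k)) n≤a (proj₁ (proj₁ (proj₂ (proj₂ (idle-search k))))))
              (*-monoˡ-≤ ((1 ⊔ length x) ^ c₀) (proj₂ (proj₂ bounding) k)))
          covering : ∀ y → size y ≤ f k → ∃[ u ] decode u ≡ y × u ∈ us
          covering y small = let u , len , dec≡ = decode-onto n y (≤-trans small fk≤n) in u , dec≡ , covers u len
      in decides-cast {M = machine} (encode-native (x , k)) (decides {i = letters x , unary k} run time≤
           (subst (λ w → Holds (not (is-just (List.head w))) ⇔ Q (x , k)) (sym found≡) (found-iff (x , k) us covering)))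

  kernel⇒tractable : Decidable Q × (∃[ f ] Computable f × HasKernelOfSize Q f) → FixedParameterTractable Q
  kernel⇒tractable (decidable , f , f-computable , K , κ , c , props) =
    relation⇒tractable decidable f-computable (Relate.relate-polynomial K κ {c} (λ y → proj₁ (props y)))
      (λ { q (inj₁ refl) → q ; q (inj₂ refl) → Equivalence.to (proj₂ (proj₂ (props _))) q })
      (λ x k ¬q → κ (x , k) , (λ q → ¬q (Equivalence.from (proj₂ (proj₂ (props (x , k)))) q)) , proj₁ (proj₂ (props (x , k))) , inj₂ refl)

theorem1 : ExcludedMiddle 0ℓ →
    (s : ℕ) (Q : ParameterizedProblem s) →
    (FixedParameterTractable Q
    ⇔ (Decidable Q × (∃[ f ] Computable f × HasKernelOfSize Q f)))
    × ((Decidable Q × (∃[ f ] Computable f × HasKernelOfSize Q f))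
    ⇔ (Decidable Q × (Σ[ _≼_ ∈ Rel (Instance s) 0ℓ ] ∃[ f ] (QuasiOrder _≼_ × PolynomialTime _≼_ × Computable f × LowerIdeal _≼_ Q × ObstructionsOfSize _≼_ Q f))))
-- Each passage between kernels and quasi-orders goes through tractability, in one direction to make
-- the kernel idempotent, in the other because a quasi-order does not by itself compute an
-- equivalent small instance.
theorem1 em s Q = mk⇔ to-kernel kernel⇒tractable , mk⇔ (to-order ∘ kernel⇒tractable) from-order
  where
  to-kernel : FixedParameterTractable Q → Decidable Q × (∃[ f ] Computable f × HasKernelOfSize Q f)
  to-kernel fpt = let g , g-computable , kernel , _ = tractable⇒kernel em fpt in
    tractable⇒decidable fpt , g , g-computable , kernel
  to-order : FixedParameterTractable Q → Decidable Q × (Σ[ _≼_ ∈ Rel (Instance s) 0ℓ ] ∃[ f ] (QuasiOrder _≼_ × PolynomialTime _≼_ × Computable f × LowerIdeal _≼_ Q × ObstructionsOfSize _≼_ Q f))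
  to-order fpt = let g , g-computable , kernel = tractable⇒kernel em fpt
                     _≼_ , quasi , poly , ideal , obstructed = kernel⇒order kernel in
    tractable⇒decidable fpt , _≼_ , g , quasi , poly , g-computable , (λ {y} {y′} → ideal {y} {y′}) , obstructed
  from-order : Decidable Q × (Σ[ _≼_ ∈ Rel (Instance s) 0ℓ ] ∃[ f ] (QuasiOrder _≼_ × PolynomialTime _≼_ × Computable f × LowerIdeal _≼_ Q × ObstructionsOfSize _≼_ Q f)) →
               Decidable Q × (∃[ f ] Computable f × HasKernelOfSize Q f)
  from-order (decidable , _≼_ , f , _ , poly , f-computable , ideal , obstructed) =
    to-kernel (relation⇒tractable decidable f-computable poly (λ {y} {y′} → ideal {y} {y′}) obstructed)
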